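{- Let $p_1,\dots,p_k$ be distinct primes and $\alpha_1,\dots,\alpha_k$ positive integers such that $n=\prod_{i=1}^k p_i^{\alpha_i}\equiv 1\pmod 6$, where $\alpha_i$ is even whenever $p_i\equiv 5\pmod 6$ and $\alpha_i$ is an arbitrary positive integer whenever $p_i\equiv 1\pmod 6$. Then $$r_{1,3}(n)=\sum_{i=1}^{k}\Big(\prod_{j=i+1}^{k}\sigma_1(p_j^{\alpha_j})\Big)\Big(\prod_{j=1}^{i-1}a_{p_j^{\alpha_j}}\Big)\, r_{1,3}(p_i^{\alpha_i}),$$ where $a_\ell$ is the $\ell$-th Fourier coefficient of the cusp form $\eta(6\tau)^4$.
   Context: $r_{1,3}(n)$ is the number of $\vec{x}\in\mathbb{Z}^4$ with $x_1^2+x_2^2+x_3^2+x_4^2=n$ and $x_i\equiv1\pmod3$ for all $i$. $\sigma_1(m)=\sum_{d\mid m}d$. $\eta(\tau)=q^{1/24}\prod_{n\ge1}(1-q^n)$ with $q=e^{2\pi i\tau}$, and $\eta(6\tau)^4=\sum_{\ell\ge1}a_\ell q^\ell$. Empty products equal $1$. -}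

module Defs where

open import Data.Nat as ℕ using (ℕ; zero; suc; _<ᵇ_; _≡ᵇ_)
open import Data.Nat.Divisibility using (_∣?_)
open import Data.Integer as ℤ using (ℤ; +_)
open import Data.Integer.DivMod using (_%ℕ_)
import Data.Fin as Fin
open Fin using (Fin; toℕ)
import Data.Bool.Properties
open import Data.Bool using (Bool; true; false; if_then_else_; _∧_)
open import Data.List using (List; map; upTo; filter; concatMap; length)
open import Data.Nat.ListAction using (sum)
open import Relation.Nullary.Decidable using (T?)

∑Fin : ∀ {k} → (Fin k → ℤ) → ℤ
∑Fin {zero}  f = + 0
∑Fin {suc k} f = f Fin.zero ℤ.+ ∑Fin (λ i → f (Fin.suc i))

∏Fin : ∀ {k} → (Fin k → ℤ) → ℤ
∏Fin {zero}  f = + 1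
∏Fin {suc k} f = f Fin.zero ℤ.* ∏Fin (λ i → f (Fin.suc i))

σ₁ : ℕ → ℕ
σ₁ m = sum (filter (λ d → d ∣? m) (map suc (upTo m)))

range : ℕ → List ℤ
range n = map (λ i → (+ i) ℤ.- (+ n)) (upTo (suc (n ℕ.+ n)))

≡1mod3 : ℤ → Bool
≡1mod3 x = (x %ℕ 3) ≡ᵇ 1

-- r_{1,3}(n): number of x ∈ ℤ⁴ with x₁²+x₂²+x₃²+x₄² = n and all xᵢ ≡ 1 (mod 3).
-- Any solution has |xᵢ| ≤ xᵢ² ≤ n, so enumerating xᵢ ∈ [-n, n] counts all of them.
r₁₃ : ℕ → ℕ
r₁₃ n = length (filter T?
  (concatMap (λ x₁ → concatMap (λ x₂ → concatMap (λ x₃ → map (λ x₄ →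
      ((ℤ.∣ x₁ ℤ.* x₁ ℤ.+ x₂ ℤ.* x₂ ℤ.+ x₃ ℤ.* x₃ ℤ.+ x₄ ℤ.* x₄ ∣ ≡ᵇ n)
        ∧ ≡1mod3 x₁ ∧ ≡1mod3 x₂ ∧ ≡1mod3 x₃ ∧ ≡1mod3 x₄)
      ) (range n)) (range n)) (range n)) (range n)))

-- Power series as coefficient functions ℕ → ℤ.
-- mulOneMinus m c : coefficients of (1 - q^m) · c
mulOneMinus : ℕ → (ℕ → ℤ) → (ℕ → ℤ)
mulOneMinus m c i = if i <ᵇ m then c i else c i ℤ.- c (i ℕ.∸ m)

etaProd : ℕ → (ℕ → ℤ)
etaProd zero i = if i ≡ᵇ 0 then + 1 else + 0
etaProd (suc N) = let m = 6 ℕ.* suc N in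
  mulOneMinus m (mulOneMinus m (mulOneMinus m (mulOneMinus m (etaProd N))))

-- η(6τ)⁴ = q ∏_{t≥1}(1-q^{6t})⁴ = ∑_{ℓ≥1} a_ℓ q^ℓ.
-- a_ℓ = coefficient of q^{ℓ-1} in ∏_{t≥1}(1-q^{6t})⁴; factors with 6t > ℓ-1
-- do not affect it, so the product up to t = ℓ suffices.
a : ℕ → ℤ
a zero = + 0
a (suc l) = etaProd (suc l) l

∏ℕ : ∀ {k} → (Fin k → ℕ) → ℕ
∏ℕ {zero}  f = 1
∏ℕ {suc k} f = f Fin.zero ℕ.* ∏ℕ (λ i → f (Fin.suc i))

{-# OPTIONS --safe #-}
-- A representation of n by four squares of integers ≡ 1 (mod 3) is compared with the fourth powers of two series.
-- Euler's pentagonal number theorem gives η(6τ)⁴ = Σ ±q^((y₁²+y₂²+y₃²+y₄²)/4) over yᵢ ≡ 1 (mod 6), while the number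
-- of y with yᵢ ≡ 1 (mod 4) and Σ yᵢ² = 4n is σ₁(n) for odd n, by Jacobi. Classifying the y modulo 3 and by the
-- parity of Σ yᵢ / 2, and turning them by a Hadamard matrix into solutions of Σ xᵢ² = n, gives
-- 3 r₁₃(n) = σ₁(n) - aₙ for n ≡ 1 (mod 6). As σ₁ and a are multiplicative, the theorem is a telescoping sum.
-- Multiplicativity of a: the cube of Euler's series is Σ ±(2m+1) q^(m(m+1)/2), so that aₙ is the sum of the x ≡ 1 (mod 3)
-- over all x + y√-3 of norm n, and those factor uniquely along coprime factors of n.
-- A power of a series c with c₀ = 1 is characterised by its logarithmic derivative; this reduces the cube of Euler's
-- series to a symmetry of the form x² + 3z², and Jacobi's theorem to Zagier's windmill maps on x² + 4yz.
module Submission where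

open import Defs
open import Algebra.Bundles using (CommutativeRing)
import Algebra.Properties.Ring
open import Data.Bool.Base using (Bool; true; false; T; _∧_)
open import Data.Bool using (if_then_else_)
open import Data.Bool.Properties using (T-∧)
open import Data.Empty using (⊥; ⊥-elim)
open import Data.Fin using (Fin; toℕ)
open import Data.Fin.Properties using (suc-injective; 0≢1+n)
open import Data.Integer using (ℤ; +_; _*_)
open import Data.Integer.Base as ℤ using (-[1+_]; _+_; _-_; -_; ∣_∣)
open import Data.Integer.DivMod using (_%ℕ_; _/ℕ_; a≡a%ℕn+[a/ℕn]*n; n%ℕd<d)
import Data.Integer.Properties as ℤP
open import Data.Integer.Tactic.RingSolver using (solve-∀)
open import Data.List.Base using (List; []; _∷_; _++_; map; filter; cartesianProduct; length; concatMap; upTo)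
open import Data.List.Membership.Propositional using (_∈_)
open import Data.List.Membership.Propositional.Properties
open import Data.List.Membership.Propositional.Properties.WithK using (unique∧set⇒bag)
open import Data.List.Properties using (map-++; map-∘; concatMap-cong)
open import Data.List.Relation.Binary.BagAndSetEquality using (∼bag⇒↭)
open import Data.List.Relation.Binary.Permutation.Propositional as Perm using (_↭_)
open import Data.List.Relation.Unary.All as All using ([]; _∷_)
open import Data.List.Relation.Unary.AllPairs using ([]; _∷_)
open import Data.List.Relation.Unary.Any using (here; there)
open import Data.List.Relation.Unary.Unique.Propositional using (Unique)
open import Data.List.Relation.Unary.Unique.Propositional.Properties as Uniqueₚ using ()
open import Data.Nat using (ℕ; _^_; _%_; _<_)
open import Data.Nat using (_<ᵇ_)
open import Data.Nat.Base as ℕ using (zero; suc; z≤n; s≤s; _≡ᵇ_)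
open import Data.Nat.Coprimality using (Coprime; coprime-Bézout; coprime-divisor) renaming (sym to coprime-sym)
open import Data.Nat.Divisibility using (_∣_)
open import Data.Nat.Divisibility as ∣ using (_∣?_; divides; ∣-antisym)
open import Data.Nat.DivMod using (m≡m%n+[m/n]*n; m%n<n)
open import Data.Nat.GCD using (module Bézout; gcd; gcd[m,n]∣m; gcd[m,n]∣n; gcd-greatest; gcd[m,n]≡0⇒n≡0; c*gcd[m,n]≡gcd[cm,cn])
open import Data.Nat.Induction using (<-rec; <-wellFounded)
open import Data.Nat.ListAction using (sum)
open import Data.Nat.Primality using (Prime; prime⇒irreducible)
import Data.Nat.Properties as ℕP
open import Data.Nat.Tactic.RingSolver using () renaming (solve-∀ to ℕ-solve-∀)
open import Data.Product using (∃; ∃₂; _×_; _,_; proj₁; proj₂)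
open import Data.Sum using (_⊎_; inj₁; inj₂; [_,_]′)
open import Data.Unit using (⊤; tt)
open import Function using (_∘_; id)
open import Function.Bundles using (Equivalence; mk⇔)
open import Function.Definitions using (Injective)
open import Induction.WellFounded using (Acc; acc)
open import Level using (0ℓ)
open import Relation.Binary.PropositionalEquality using (_≡_; _≢_; refl; sym; trans; cong; cong₂; subst; module ≡-Reasoning)
open import Relation.Nullary using (¬_; Dec; yes; no)
open import Relation.Nullary.Decidable using (¬?; _×-dec_; False; T?; toWitnessFalse)
open import Relation.Unary using (Decidable)

-- In the theory of modular forms 3 r₁₃ = σ₁ - a compares a theta series with an Eisenstein series
-- and a cusp form with complex multiplication by ℚ(√-3), and a is multiplicative by Hecke
-- operators. Here every series is instead given a support of lattice points, and the identities
-- become bijections and sign-reversing involutions. The factor 3 has two sources. Of the fourth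
-- power of all odd squares, split into those prime to 3 and those divisible by 3, only two kinds of
-- terms have the right exponent modulo 3: all four prime to 3, which gives a + 2 r₁₃, and exactly
-- one prime to 3, which gives r₁₃. The condition that α is even when p ≡ 5 (mod 6) puts every prime
-- power p^α into the class of 1 modulo 6, so the relation holds for each factor as well as for n.
-- Multiplicativity of a is the delicate point: four independent variables show no product
-- structure. Splitting the fourth power as Euler's series times its cube leaves two variables and
-- the form x² + 3z², which is a norm.

module ℤRing = Algebra.Properties.Ring ℤP.+-*-ring

private variable
  A B : Set
  𝒫 𝒫₁ 𝒫₂ 𝒬 : A → Set

-- Finite sums

Sum : List A → (A → ℤ) → ℤ
Sum []       w = + 0
Sum (x ∷ xs) w = w x + Sum xs w

Sum-cong : (xs : List A) {w v : A → ℤ} → (∀ {x} → x ∈ xs → w x ≡ v x) → Sum xs w ≡ Sum xs v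
Sum-cong []       eq = refl
Sum-cong (x ∷ xs) eq = cong₂ _+_ (eq (here refl)) (Sum-cong xs (eq ∘ there))

Sum-++ : (xs ys : List A) (w : A → ℤ) → Sum (xs ++ ys) w ≡ Sum xs w + Sum ys w
Sum-++ []       ys w = sym (ℤP.+-identityˡ _)
Sum-++ (x ∷ xs) ys w = trans (cong (_+_ (w x)) (Sum-++ xs ys w)) (sym (ℤP.+-assoc (w x) _ _))

Sum-map : (f : A → B) (xs : List A) (w : B → ℤ) → Sum (map f xs) w ≡ Sum xs (w ∘ f)
Sum-map f []       w = refl
Sum-map f (x ∷ xs) w = cong (_+_ (w (f x))) (Sum-map f xs w)

Sum-+ : (xs : List A) (w v : A → ℤ) → Sum xs (λ x → w x + v x) ≡ Sum xs w + Sum xs v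
Sum-+ []       w v = refl
Sum-+ (x ∷ xs) w v = trans (cong (_+_ (w x + v x)) (Sum-+ xs w v)) (interchange (w x) (v x) _ _)
  where
  interchange : ∀ a b c d → (a + b) + (c + d) ≡ (a + c) + (b + d)
  interchange = solve-∀

Sum-* : (xs : List A) (c : ℤ) (w : A → ℤ) → Sum xs (λ x → c * w x) ≡ c * Sum xs w
Sum-* []       c w = sym (ℤP.*-zeroʳ c)
Sum-* (x ∷ xs) c w =
  trans (cong (_+_ (c * w x)) (Sum-* xs c w)) (sym (ℤP.*-distribˡ-+ c (w x) _))

Sum-↭ : {xs ys : List A} (w : A → ℤ) → xs ↭ ys → Sum xs w ≡ Sum ys w
Sum-↭ w Perm.refl = refl
Sum-↭ w (Perm.prep x p) = cong (_+_ (w x)) (Sum-↭ w p)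
Sum-↭ w (Perm.swap {xs} {ys} x y p) =
  trans (cong (λ s → w x + (w y + s)) (Sum-↭ w p)) (exchange (w x) (w y) (Sum ys w))
  where
  exchange : ∀ a b c → a + (b + c) ≡ b + (a + c)
  exchange = solve-∀
Sum-↭ w (Perm.trans p q) = trans (Sum-↭ w p) (Sum-↭ w q)

Sum-× : (xs : List A) (ys : List B) (w : A → ℤ) (v : B → ℤ) →
  Sum (cartesianProduct xs ys) (λ p → w (proj₁ p) * v (proj₂ p)) ≡ Sum xs w * Sum ys v
Sum-× []       ys w v = sym (ℤP.*-zeroˡ (Sum ys v))
Sum-× (x ∷ xs) ys w v = begin
  Sum (map (x ,_) ys ++ cartesianProduct xs ys) u
    ≡⟨ Sum-++ (map (x ,_) ys) _ u ⟩
  Sum (map (x ,_) ys) u + Sum (cartesianProduct xs ys) u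
    ≡⟨ cong₂ _+_ (trans (Sum-map (x ,_) ys u) (Sum-* ys (w x) v)) (Sum-× xs ys w v) ⟩
  w x * Sum ys v + Sum xs w * Sum ys v
    ≡⟨ ℤP.*-distribʳ-+ (Sum ys v) (w x) (Sum xs w) ⟨
  (w x + Sum xs w) * Sum ys v ∎
  where
  open ≡-Reasoning
  u = λ p → w (proj₁ p) * v (proj₂ p)

Sum-1 : (xs : List A) → Sum xs (λ _ → + 1) ≡ + length xs
Sum-1 []       = refl
Sum-1 (x ∷ xs) = cong (_+_ (+ 1)) (Sum-1 xs)

-- Enumerations of finite sets and reindexing of sums

map-unique : {f : A → B} {xs : List A} →
  (∀ {x y} → x ∈ xs → y ∈ xs → f x ≡ f y → x ≡ y) → Unique xs → Unique (map f xs)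
map-unique inj [] = []
map-unique {f = f} {x ∷ xs} inj (x∉xs ∷ u) =
  All.tabulate fresh ∷ map-unique (λ p q → inj (there p) (there q)) u
  where
  fresh : ∀ {z} → z ∈ map f xs → f x ≢ z
  fresh z∈ refl with y , y∈xs , eq ← ∈-map⁻ f z∈ =
    All.lookup x∉xs y∈xs (inj (here refl) (there y∈xs) eq)

-- The predicate determines the list up to permutation, so a sum depends on the predicate alone and
-- identities between sums reduce to bijections between predicates.
record Enumeration {A : Set} (𝒫 : A → Set) : Set where
  field
    elements : List A
    unique   : Unique elements
    sound    : ∀ {x} → x ∈ elements → 𝒫 x
    complete : ∀ {x} → 𝒫 x → x ∈ elements

open Enumeration

∑ : Enumeration 𝒫 → (_ → ℤ) → ℤ
∑ E w = Sum (elements E) w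

∑-cong : (E : Enumeration 𝒫) {w v : _ → ℤ} → (∀ x → 𝒫 x → w x ≡ v x) → ∑ E w ≡ ∑ E v
∑-cong E eq = Sum-cong (elements E) λ x∈ → eq _ (sound E x∈)

∑-+ : (E : Enumeration 𝒫) (w v : _ → ℤ) → ∑ E (λ x → w x + v x) ≡ ∑ E w + ∑ E v
∑-+ E = Sum-+ (elements E)

∑-* : (E : Enumeration 𝒫) (c : ℤ) (w : _ → ℤ) → ∑ E (λ x → c * w x) ≡ c * ∑ E w
∑-* E = Sum-* (elements E)

∑-zero : (E : Enumeration 𝒫) {w : _ → ℤ} → (∀ x → 𝒫 x → w x ≡ + 0) → ∑ E w ≡ + 0
∑-zero E {w} eq = trans (∑-cong E {w} {λ _ → + 0 * + 0} eq) (∑-* E (+ 0) (λ _ → + 0))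

-- Duplicate-free lists with the same members are equal as bags, hence permutations of each other.
∑-⇔ : (E : Enumeration 𝒫) (F : Enumeration 𝒬) → (∀ {x} → 𝒫 x → 𝒬 x) → (∀ {x} → 𝒬 x → 𝒫 x) →
  (w : _ → ℤ) → ∑ E w ≡ ∑ F w
∑-⇔ E F to from w = Sum-↭ w (∼bag⇒↭ (unique∧set⇒bag (unique E) (unique F)
  (mk⇔ (complete F ∘ to ∘ sound E) (complete E ∘ from ∘ sound F))))

image : (E : Enumeration 𝒫) (f : A → B) →
  (∀ x → 𝒫 x → 𝒬 (f x)) →
  (∀ x y → 𝒫 x → 𝒫 y → f x ≡ f y → x ≡ y) →
  (∀ z → 𝒬 z → ∃ λ x → 𝒫 x × f x ≡ z) →
  Enumeration 𝒬
image {𝒫 = 𝒫} {𝒬 = 𝒬} E f into inj onto = record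
  { elements = map f (elements E)
  ; unique   = map-unique (λ p q → inj _ _ (sound E p) (sound E q)) (unique E)
  ; sound    = λ z∈ → snd (∈-map⁻ f z∈)
  ; complete = λ q → cmp (onto _ q)
  }
  where
  snd : ∀ {z} → (∃ λ x → x ∈ elements E × z ≡ f x) → 𝒬 z
  snd (x , x∈ , refl) = into x (sound E x∈)
  cmp : ∀ {z} → (∃ λ x → 𝒫 x × f x ≡ z) → z ∈ map f (elements E)
  cmp (x , p , refl) = ∈-map⁺ f (complete E p)

reindex : (E : Enumeration 𝒫) (F : Enumeration 𝒬) (f : _ → _) →
  (∀ x → 𝒫 x → 𝒬 (f x)) →
  (∀ x y → 𝒫 x → 𝒫 y → f x ≡ f y → x ≡ y) →
  (∀ z → 𝒬 z → ∃ λ x → 𝒫 x × f x ≡ z) →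
  (v : _ → ℤ) → ∑ E (v ∘ f) ≡ ∑ F v
reindex E F f into inj onto v =
  trans (sym (Sum-map f (elements E) v)) (∑-⇔ (image E f into inj onto) F id id v)

restrict : Enumeration 𝒫 → Decidable 𝒬 → Enumeration (λ x → 𝒫 x × 𝒬 x)
restrict E Q? = record
  { elements = filter Q? (elements E)
  ; unique   = Uniqueₚ.filter⁺ Q? (unique E)
  ; sound    = λ x∈ → let y∈ , q = ∈-filter⁻ Q? x∈ in sound E y∈ , q
  ; complete = λ (p , q) → ∈-filter⁺ Q? (complete E p) q
  }

_⊎-enumeration_by_ : Enumeration 𝒫 → Enumeration 𝒬 → (∀ {x} → 𝒫 x → ¬ 𝒬 x) →
  Enumeration (λ x → 𝒫 x ⊎ 𝒬 x)
E ⊎-enumeration F by disjoint = record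
  { elements = elements E ++ elements F
  ; unique   = Uniqueₚ.++⁺ (unique E) (unique F) λ (p , q) → disjoint (sound E p) (sound F q)
  ; sound    = λ x∈ → [ inj₁ ∘ sound E , inj₂ ∘ sound F ]′ (∈-++⁻ (elements E) x∈)
  ; complete = [ ∈-++⁺ˡ ∘ complete E , ∈-++⁺ʳ (elements E) ∘ complete F ]′
  }

_×-enumeration_ : Enumeration 𝒫 → Enumeration 𝒬 → Enumeration (λ z → 𝒫 (proj₁ z) × 𝒬 (proj₂ z))
E ×-enumeration F = record
  { elements = cartesianProduct (elements E) (elements F)
  ; unique   = Uniqueₚ.cartesianProduct⁺ (unique E) (unique F)
  ; sound    = λ z∈ → let x∈ , y∈ = ∈-cartesianProduct⁻ (elements E) (elements F) z∈
                      in sound E x∈ , sound F y∈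
  ; complete = λ (p , q) → ∈-cartesianProduct⁺ (complete E p) (complete F q)
  }

∑-× : (E : Enumeration 𝒫) (F : Enumeration 𝒬) (w v : _ → ℤ) →
  ∑ (E ×-enumeration F) (λ z → w (proj₁ z) * v (proj₂ z)) ≡ ∑ E w * ∑ F v
∑-× E F = Sum-× (elements E) (elements F)

-- The two pieces keep their own parameters: `f₁` and `f₂` embed them as complementary parts, so
-- classifications by residue can be summed in the coordinates natural to each class.
∑-split : (E : Enumeration 𝒫) (E₁ : Enumeration 𝒫₁) (E₂ : Enumeration 𝒫₂)
  (f₁ : _ → _) (f₂ : _ → _) →
  (∀ x → 𝒫₁ x → 𝒫 (f₁ x)) → (∀ x → 𝒫₂ x → 𝒫 (f₂ x)) →
  (∀ x y → 𝒫₁ x → 𝒫₁ y → f₁ x ≡ f₁ y → x ≡ y) →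
  (∀ x y → 𝒫₂ x → 𝒫₂ y → f₂ x ≡ f₂ y → x ≡ y) →
  (∀ x y → 𝒫₁ x → 𝒫₂ y → f₁ x ≢ f₂ y) →
  (∀ z → 𝒫 z → (∃ λ x → 𝒫₁ x × f₁ x ≡ z) ⊎ (∃ λ x → 𝒫₂ x × f₂ x ≡ z)) →
  (w : _ → ℤ) → ∑ E w ≡ ∑ E₁ (w ∘ f₁) + ∑ E₂ (w ∘ f₂)
∑-split {𝒫 = 𝒫} {𝒫₁ = 𝒫₁} {𝒫₂ = 𝒫₂} E E₁ E₂ f₁ f₂ into₁ into₂ inj₁′ inj₂′ disjoint cover w =
  trans (∑-⇔ E (I₁ ⊎-enumeration I₂ by λ { (_ , p , refl) (_ , q , eq) → disjoint _ _ p q (sym eq) })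
            (cover _) [ (λ { (_ , p , refl) → into₁ _ p }) , (λ { (_ , p , refl) → into₂ _ p }) ]′ w)
    (trans (Sum-++ (elements I₁) (elements I₂) w)
      (cong₂ _+_ (Sum-map f₁ (elements E₁) w) (Sum-map f₂ (elements E₂) w)))
  where
  I₁ : Enumeration (λ z → ∃ λ x → 𝒫₁ x × f₁ x ≡ z)
  I₁ = image E₁ f₁ (λ x p → x , p , refl) inj₁′ (λ _ → id)
  I₂ : Enumeration (λ z → ∃ λ x → 𝒫₂ x × f₂ x ≡ z)
  I₂ = image E₂ f₂ (λ x p → x , p , refl) inj₂′ (λ _ → id)

∑-restrict : (E : Enumeration 𝒫) (Q? : Decidable 𝒬) (w : _ → ℤ) →
  ∑ E w ≡ ∑ (restrict E Q?) w + ∑ (restrict E (¬? ∘ Q?)) w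
∑-restrict {𝒫 = 𝒫} {𝒬 = 𝒬} E Q? = ∑-split E (restrict E Q?) (restrict E (¬? ∘ Q?)) id id
  (λ _ → proj₁) (λ _ → proj₁) (λ _ _ _ _ → id) (λ _ _ _ _ → id)
  (λ { _ _ (_ , q) (_ , ¬q) refl → ¬q q })
  (λ z p → decide z p (Q? z))
  where
  decide : ∀ z → 𝒫 z → Dec (𝒬 z) →
    (∃ λ x → (𝒫 x × 𝒬 x) × x ≡ z) ⊎ (∃ λ x → (𝒫 x × ¬ 𝒬 x) × x ≡ z)
  decide z p (yes q) = inj₁ (z , (p , q) , refl)
  decide z p (no ¬q) = inj₂ (z , (p , ¬q) , refl)

-- Formal power series

PowerSeries : Set
PowerSeries = ℕ → ℤ

infix 4 _≈_
_≈_ : PowerSeries → PowerSeries → Set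
c ≈ d = ∀ n → c n ≡ d n

tail : PowerSeries → PowerSeries
tail c n = c (suc n)

infix  8 ⊖_
infixl 6 _⊕_
infixl 7 _⊛_ _·_
_⊕_ _⊛_ : PowerSeries → PowerSeries → PowerSeries
(c ⊕ d) n = c n + d n
(c ⊛ d) zero    = c 0 * d 0
(c ⊛ d) (suc n) = c 0 * d (suc n) + (tail c ⊛ d) n

⊖_ : PowerSeries → PowerSeries
(⊖ c) n = - c n

_·_ : ℤ → PowerSeries → PowerSeries
(k · c) n = k * c n

𝟘 𝟙 : PowerSeries
𝟘 n = + 0
𝟙 zero    = + 1
𝟙 (suc n) = + 0

⊛-cong : ∀ {c c′ d d′} → c ≈ c′ → d ≈ d′ → c ⊛ d ≈ c′ ⊛ d′
⊛-cong p q zero    = cong₂ _*_ (p 0) (q 0)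
⊛-cong p q (suc n) = cong₂ _+_ (cong₂ _*_ (p 0) (q (suc n))) (⊛-cong (p ∘ suc) q n)

⊛-congʳ : ∀ {d d′} c → d ≈ d′ → c ⊛ d ≈ c ⊛ d′
⊛-congʳ c = ⊛-cong {c} λ _ → refl

⊕-cong : ∀ {c c′ d d′} → c ≈ c′ → d ≈ d′ → c ⊕ d ≈ c′ ⊕ d′
⊕-cong p q n = cong₂ _+_ (p n) (q n)

⊕-congʳ : ∀ {d d′} c → d ≈ d′ → c ⊕ d ≈ c ⊕ d′
⊕-congʳ c p n = cong (_+_ (c n)) (p n)

⊛-distribʳ : ∀ f c d → (c ⊕ d) ⊛ f ≈ c ⊛ f ⊕ d ⊛ f
⊛-distribʳ f c d zero    = ℤP.*-distribʳ-+ (f 0) (c 0) (d 0)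
⊛-distribʳ f c d (suc n) =
  trans (cong (_+_ ((c 0 + d 0) * f (suc n))) (⊛-distribʳ f (tail c) (tail d) n))
        (distribute (c 0) (d 0) (f (suc n)) _ _)
  where
  distribute : ∀ a b e x y → (a + b) * e + (x + y) ≡ (a * e + x) + (b * e + y)
  distribute = solve-∀

·-⊛ : ∀ k c d → (k · c) ⊛ d ≈ k · (c ⊛ d)
·-⊛ k c d zero    = ℤP.*-assoc k (c 0) (d 0)
·-⊛ k c d (suc n) =
  trans (cong (_+_ (k * c 0 * d (suc n))) (·-⊛ k (tail c) d n))
        (factor k (c 0) (d (suc n)) _)
  where
  factor : ∀ k a b x → k * a * b + k * x ≡ k * (a * b + x)
  factor = solve-∀

-- The definition of `_⊛_` peels off the first coefficient of the left factor; commutativity also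
-- needs the last one.
⊛-suc : ∀ c d n → (c ⊛ d) (suc n) ≡ (c ⊛ tail d) n + c (suc n) * d 0
⊛-suc c d zero    = refl
⊛-suc c d (suc n) =
  trans (cong (_+_ (c 0 * d (suc (suc n)))) (⊛-suc (tail c) d n))
        (sym (ℤP.+-assoc (c 0 * d (suc (suc n))) _ _))

⊛-comm : ∀ c d → c ⊛ d ≈ d ⊛ c
⊛-comm c d zero    = ℤP.*-comm (c 0) (d 0)
⊛-comm c d (suc n) = begin
  c 0 * d (suc n) + (tail c ⊛ d) n  ≡⟨ cong₂ _+_ (ℤP.*-comm (c 0) _) (⊛-comm (tail c) d n) ⟩
  d (suc n) * c 0 + (d ⊛ tail c) n  ≡⟨ ℤP.+-comm _ ((d ⊛ tail c) n) ⟩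
  (d ⊛ tail c) n + d (suc n) * c 0  ≡⟨ ⊛-suc d c n ⟨
  (d ⊛ c) (suc n)  ∎
  where open ≡-Reasoning

⊛-assoc : ∀ c d f → (c ⊛ d) ⊛ f ≈ c ⊛ (d ⊛ f)
⊛-assoc c d f zero    = ℤP.*-assoc (c 0) (d 0) (f 0)
⊛-assoc c d f (suc n) = begin
  c 0 * d 0 * f (suc n) + (tail (c ⊛ d) ⊛ f) n
    ≡⟨ cong (_+_ (c 0 * d 0 * f (suc n))) (trans (⊛-distribʳ f (c 0 · tail d) (tail c ⊛ d) n)
         (cong₂ _+_ (·-⊛ (c 0) (tail d) f n) (⊛-assoc (tail c) d f n))) ⟩
  c 0 * d 0 * f (suc n) + (c 0 * (tail d ⊛ f) n + (tail c ⊛ (d ⊛ f)) n)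
    ≡⟨ factor (c 0) (d 0) (f (suc n)) _ _ ⟩
  c 0 * (d 0 * f (suc n) + (tail d ⊛ f) n) + (tail c ⊛ (d ⊛ f)) n ∎
  where
  open ≡-Reasoning
  factor : ∀ a b e x y → a * b * e + (a * x + y) ≡ a * (b * e + x) + y
  factor = solve-∀

𝟘-⊛ : ∀ c → 𝟘 ⊛ c ≈ 𝟘
𝟘-⊛ c zero    = refl
𝟘-⊛ c (suc n) = trans (ℤP.+-identityˡ _) (𝟘-⊛ c n)

⊛-identityˡ : ∀ c → 𝟙 ⊛ c ≈ c
⊛-identityˡ c zero    = ℤP.*-identityˡ (c 0)
⊛-identityˡ c (suc n) = trans (cong₂ _+_ (ℤP.*-identityˡ (c (suc n))) (𝟘-⊛ c n)) (ℤP.+-identityʳ _)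

powerSeriesRing : CommutativeRing 0ℓ 0ℓ
powerSeriesRing = record
  { Carrier = PowerSeries ; _≈_ = _≈_ ; _+_ = _⊕_ ; _*_ = _⊛_ ; -_ = ⊖_ ; 0# = 𝟘 ; 1# = 𝟙
  ; isCommutativeRing = record
    { isRing = record
      { +-isAbelianGroup = record
        { isGroup = record
          { isMonoid = record
            { isSemigroup = record
              { isMagma = record
                { isEquivalence = record
                  { refl = λ _ → refl ; sym = λ p n → sym (p n) ; trans = λ p q n → trans (p n) (q n) }
                ; ∙-cong = λ p q n → cong₂ _+_ (p n) (q n) }
              ; assoc = λ c d f n → ℤP.+-assoc (c n) (d n) (f n) }
            ; identity = (λ c n → ℤP.+-identityˡ (c n)) , (λ c n → ℤP.+-identityʳ (c n)) }
          ; inverse = (λ c n → ℤP.+-inverseˡ (c n)) , (λ c n → ℤP.+-inverseʳ (c n))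
          ; ⁻¹-cong = λ p n → cong -_ (p n) }
        ; comm = λ c d n → ℤP.+-comm (c n) (d n) }
      ; *-cong = ⊛-cong
      ; *-assoc = ⊛-assoc
      ; *-identity = ⊛-identityˡ , λ c n → trans (⊛-comm c 𝟙 n) (⊛-identityˡ c n)
      ; distrib = (λ f c d n → trans (⊛-comm f (c ⊕ d) n) (trans (⊛-distribʳ f c d n)
                    (cong₂ _+_ (⊛-comm c f n) (⊛-comm d f n)))) , ⊛-distribʳ }
    ; *-comm = ⊛-comm } }

open import Algebra.Solver.Ring.NaturalCoefficients.Default
  (CommutativeRing.commutativeSemiring powerSeriesRing) using (solve; _:+_; _:*_; _:=_; con)
open import Algebra.Properties.Ring (CommutativeRing.ring powerSeriesRing) using (-‿distribˡ-*; -‿distribʳ-*; -1*x≈-x)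
open CommutativeRing powerSeriesRing using (setoid; distribˡ) renaming (refl to ≈-refl; sym to ≈-sym; trans to ≈-trans)
import Relation.Binary.Reasoning.Setoid setoid as ≈-Reasoning

-- The derivation q d/dq and the characterisation of powers

D : PowerSeries → PowerSeries
D c n = + n * c n

tail-D : ∀ c → tail (D c) ≈ D (tail c) ⊕ tail c
tail-D c n = trans (ℤP.*-distribʳ-+ (c (suc n)) (+ 1) (+ n))
  (trans (cong (_+ (+ n * c (suc n))) (ℤP.*-identityˡ (c (suc n)))) (ℤP.+-comm (c (suc n)) _))

D-⊛ : ∀ c d → D (c ⊛ d) ≈ D c ⊛ d ⊕ c ⊛ D d
D-⊛ c d zero    = base (c 0) (d 0)
  where
  base : ∀ x y → + 0 * (x * y) ≡ + 0 * x * y + x * (+ 0 * y)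
  base = solve-∀
D-⊛ c d (suc n) = begin
  + suc n * (c 0 * d (suc n) + (tail c ⊛ d) n)
    ≡⟨ expand (+ n) (c 0) (d (suc n)) _ ⟩
  c 0 * (+ suc n * d (suc n)) + (+ n * (tail c ⊛ d) n + (tail c ⊛ d) n)
    ≡⟨ cong (λ s → c 0 * (+ suc n * d (suc n)) + (s + (tail c ⊛ d) n)) (D-⊛ (tail c) d n) ⟩
  c 0 * (+ suc n * d (suc n)) + ((D (tail c) ⊛ d) n + (tail c ⊛ D d) n + (tail c ⊛ d) n)
    ≡⟨ regroup (c 0) (+ suc n * d (suc n)) (D c 0) (d (suc n)) ((D (tail c) ⊛ d) n) _ _ refl ⟩
  D c 0 * d (suc n) + ((D (tail c) ⊛ d) n + (tail c ⊛ d) n) + (c 0 * (+ suc n * d (suc n)) + (tail c ⊛ D d) n)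
    ≡⟨ cong (λ s → D c 0 * d (suc n) + s + (c 0 * (+ suc n * d (suc n)) + (tail c ⊛ D d) n))
         (trans (⊛-cong (tail-D c) ≈-refl n) (⊛-distribʳ d (D (tail c)) (tail c) n)) ⟨
  D c 0 * d (suc n) + (tail (D c) ⊛ d) n + (c 0 * (+ suc n * d (suc n)) + (tail c ⊛ D d) n) ∎
  where
  open ≡-Reasoning
  expand : ∀ m a b x → (+ 1 + m) * (a * b + x) ≡ a * ((+ 1 + m) * b) + (m * x + x)
  expand = solve-∀
  regroup : ∀ a b z e x y w → z ≡ + 0 * a → a * b + (x + y + w) ≡ z * e + (x + w) + (a * b + y)
  regroup a b _ e x y w refl = lemma a b e x y w
    where
    lemma : ∀ a b e x y w → a * b + (x + y + w) ≡ + 0 * a * e + (x + w) + (a * b + y)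
    lemma = solve-∀

-- D(c³)/c³ = 3 D(c)/c with the denominators cleared.
D-cube : ∀ c → c ⊛ D (c ⊛ (c ⊛ c)) ≈ + 3 · (c ⊛ (c ⊛ c) ⊛ D c)
D-cube c = begin
  c ⊛ D (c ⊛ (c ⊛ c))
    ≈⟨ ⊛-congʳ c (≈-trans (D-⊛ c (c ⊛ c)) (⊕-congʳ (D c ⊛ (c ⊛ c)) (⊛-congʳ c (D-⊛ c c)))) ⟩
  c ⊛ (D c ⊛ (c ⊛ c) ⊕ c ⊛ (D c ⊛ c ⊕ c ⊛ D c))
    ≈⟨ solve 2 (λ x y → x :* (y :* (x :* x) :+ x :* (y :* x :+ x :* y)) :=
         (x :* (x :* x) :* y :+ x :* (x :* x) :* y :+ x :* (x :* x) :* y)) ≈-refl c (D c) ⟩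
  t ⊕ t ⊕ t
    ≈⟨ (λ n → thrice (t n)) ⟩
  + 3 · t ∎
  where
  open ≈-Reasoning
  t = c ⊛ (c ⊛ c) ⊛ D c
  thrice : ∀ x → x + x + x ≡ + 3 * x
  thrice = solve-∀

D-fourth : ∀ c → c ⊛ D (c ⊛ (c ⊛ (c ⊛ c))) ≈ + 4 · (c ⊛ (c ⊛ (c ⊛ c)) ⊛ D c)
D-fourth c = begin
  c ⊛ D (c ⊛ (c ⊛ (c ⊛ c)))
    ≈⟨ ⊛-congʳ c (≈-trans (D-⊛ c (c ⊛ (c ⊛ c))) (⊕-congʳ (D c ⊛ (c ⊛ (c ⊛ c))) (D-cube c))) ⟩
  c ⊛ (D c ⊛ (c ⊛ (c ⊛ c)) ⊕ + 3 · t)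
    ≈⟨ ⊛-congʳ c (⊕-congʳ (D c ⊛ (c ⊛ (c ⊛ c))) (λ n → thrice (t n))) ⟩
  c ⊛ (D c ⊛ (c ⊛ (c ⊛ c)) ⊕ (t ⊕ t ⊕ t))
    ≈⟨ solve 2 (λ x y → let z = x :* (x :* x) :* y ; w = x :* (x :* (x :* x)) :* y in
         x :* (y :* (x :* (x :* x)) :+ (z :+ z :+ z)) := (w :+ w :+ w :+ w)) ≈-refl c (D c) ⟩
  u ⊕ u ⊕ u ⊕ u
    ≈⟨ (λ n → fourfold (u n)) ⟩
  + 4 · u ∎
  where
  open ≈-Reasoning
  t = c ⊛ (c ⊛ c) ⊛ D c
  u = c ⊛ (c ⊛ (c ⊛ c)) ⊛ D c
  thrice : ∀ x → + 3 * x ≡ x + x + x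
  thrice = solve-∀
  fourfold : ∀ x → x + x + x + x ≡ + 4 * x
  fourfold = solve-∀

-- Every term of the Cauchy sum except the last contains some c i with i < n.
⊛-vanishing : ∀ c d n → (∀ i → i ℕ.< n → c i ≡ + 0) → (c ⊛ d) n ≡ c n * d 0
⊛-vanishing c d zero    z = refl
⊛-vanishing c d (suc n) z = trans
  (cong₂ _+_ (cong (_* d (suc n)) (z 0 (ℕ.s≤s ℕ.z≤n))) (⊛-vanishing (tail c) d n λ i i<n → z (suc i) (ℕ.s≤s i<n)))
  (trans (cong (_+ (c (suc n) * d 0)) (ℤP.*-zeroˡ (d (suc n)))) (ℤP.+-identityˡ _))

-- c ⊛ D f = k (f ⊛ D c) is the equation satisfied by f = c ^ k; it determines n f(n) from the lower coefficients.
power-unique : ∀ k c f g → c 0 ≡ + 1 → f 0 ≡ g 0 →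
  c ⊛ D f ≈ k · (f ⊛ D c) → c ⊛ D g ≈ k · (g ⊛ D c) → f ≈ g
power-unique k c f g c₀ f₀ eqf eqg n = ℤP.i-j≡0⇒i≡j (f n) (g n) (vanish n)
  where
  open ≡-Reasoning
  h : PowerSeries
  h n = f n - g n
  linear : ∀ x → x ⊛ D h ≈ x ⊛ D f ⊕ ⊖ (x ⊛ D g)
  linear x = ≈-trans (⊛-congʳ x (λ n → minus (+ n) (f n) (g n)))
    (≈-trans (distribˡ x (D f) (⊖ D g)) (⊕-congʳ (x ⊛ D f) (≈-sym (-‿distribʳ-* x (D g)))))
    where
    minus : ∀ m x y → m * (x - y) ≡ m * x + - (m * y)
    minus = solve-∀
  eqh : c ⊛ D h ≈ k · (h ⊛ D c)
  eqh n = begin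
    (c ⊛ D h) n  ≡⟨ linear c n ⟩
    (c ⊛ D f) n + - (c ⊛ D g) n  ≡⟨ cong₂ (λ x y → x + - y) (eqf n) (eqg n) ⟩
    k * (f ⊛ D c) n + - (k * (g ⊛ D c) n)  ≡⟨ factor k _ _ ⟩
    k * ((f ⊛ D c) n + - (g ⊛ D c) n)  ≡⟨ cong (_*_ k) (≈-trans (⊛-distribʳ (D c) f (⊖ g)) (⊕-congʳ (f ⊛ D c) (≈-sym (-‿distribˡ-* g (D c)))) n) ⟨
    k * (h ⊛ D c) n  ∎
    where
    factor : ∀ k x y → k * x + - (k * y) ≡ k * (x + - y)
    factor = solve-∀
  step : ∀ n → (∀ {i} → i ℕ.< n → h i ≡ + 0) → h n ≡ + 0
  step zero    _  = ℤP.i≡j⇒i-j≡0 f₀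
  -- With the lower coefficients of h gone, the left side is (n+1) h(n+1) c(0), and the right side
  -- is a multiple of the constant term of D c, which is zero.
  step (suc n) ih = ℤP.*-cancelˡ-≡ (+ suc n) (h (suc n)) (+ 0) (begin
    + suc n * h (suc n)  ≡⟨ ℤP.*-identityʳ _ ⟨
    + suc n * h (suc n) * + 1  ≡⟨ cong (_*_ (+ suc n * h (suc n))) c₀ ⟨
    D h (suc n) * c 0  ≡⟨ ⊛-vanishing (D h) c (suc n) (λ i i< → trans (cong (_*_ (+ i)) (ih i<)) (ℤP.*-zeroʳ (+ i))) ⟨
    (D h ⊛ c) (suc n)  ≡⟨ ⊛-comm (D h) c (suc n) ⟩
    (c ⊛ D h) (suc n)  ≡⟨ eqh (suc n) ⟩
    k * (h ⊛ D c) (suc n)  ≡⟨ cong (_*_ k) (⊛-vanishing h (D c) (suc n) λ i → ih) ⟩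
    k * (h (suc n) * (+ 0 * c 0))  ≡⟨ annihilate k (h (suc n)) (c 0) ⟩
    + 0  ≡⟨ ℤP.*-zeroʳ (+ suc n) ⟨
    + suc n * + 0  ∎)
    where
    annihilate : ∀ k x y → k * (x * (+ 0 * y)) ≡ + 0
    annihilate = solve-∀
  vanish : ∀ n → h n ≡ + 0
  vanish = <-rec (λ n → h n ≡ + 0) step

-- Graded families and their generating series

-- The interval from -n to n, grown by its two new ends: this is how the terms of the pentagonal sum
-- arrive in Shanks' argument.
ints : ℕ → List ℤ
ints zero    = + 0 ∷ []
ints (suc n) = + suc n ∷ -[1+ n ] ∷ ints n

∈-ints⁻ : ∀ {k} n → k ∈ ints n → ∣ k ∣ ℕ.≤ n
∈-ints⁻ zero    (here refl)         = z≤n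
∈-ints⁻ (suc n) (here refl)         = ℕP.≤-refl
∈-ints⁻ (suc n) (there (here refl)) = ℕP.≤-refl
∈-ints⁻ (suc n) (there (there k∈))  = ℕP.m≤n⇒m≤1+n (∈-ints⁻ n k∈)

∈-ints⁺ : ∀ k n → ∣ k ∣ ℕ.≤ n → k ∈ ints n
∈-ints⁺ (+ zero)    zero    _ = here refl
∈-ints⁺ k           (suc n) ∣k∣≤ with ℕP.m≤n⇒m<n∨m≡n ∣k∣≤
∈-ints⁺ k           (suc n) ∣k∣≤ | inj₁ (s≤s ∣k∣≤n) = there (there (∈-ints⁺ k n ∣k∣≤n))
∈-ints⁺ (+ _)       (suc n) ∣k∣≤ | inj₂ refl = here refl
∈-ints⁺ -[1+ _ ]    (suc n) ∣k∣≤ | inj₂ refl = there (here refl)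

ints-unique : ∀ n → Unique (ints n)
ints-unique zero    = [] ∷ []
ints-unique (suc n) =
  ((λ ()) ∷ All.tabulate (λ k∈ → λ { refl → ℕP.n≮n n (∈-ints⁻ n k∈) }))
  ∷ All.tabulate (λ k∈ → λ { refl → ℕP.n≮n n (∈-ints⁻ n k∈) })
  ∷ ints-unique n

enumerateℤ : {P : ℤ → Set} → Decidable P → ∀ n → (∀ k → P k → ∣ k ∣ ℕ.≤ n) → Enumeration P
enumerateℤ P? n bound = record
  { elements = filter P? (ints n)
  ; unique   = Uniqueₚ.filter⁺ P? (ints-unique n)
  ; sound    = λ k∈ → proj₂ (∈-filter⁻ P? {xs = ints n} k∈)
  ; complete = λ p → ∈-filter⁺ P? (∈-ints⁺ _ n (bound _ p)) p
  }

enumerateℤ² : {P : ℤ × ℤ → Set} → Decidable P → ∀ n →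
  (∀ x y → P (x , y) → ∣ x ∣ ℕ.≤ n × ∣ y ∣ ℕ.≤ n) → Enumeration P
enumerateℤ² P? n bound = record
  { elements = filter P? (cartesianProduct (ints n) (ints n))
  ; unique   = Uniqueₚ.filter⁺ P? (Uniqueₚ.cartesianProduct⁺ (ints-unique n) (ints-unique n))
  ; sound    = λ z∈ → proj₂ (∈-filter⁻ P? {xs = cartesianProduct (ints n) (ints n)} z∈)
  ; complete = λ {z} p → let b₁ , b₂ = bound (proj₁ z) (proj₂ z) p in
      ∈-filter⁺ P? (∈-cartesianProduct⁺ (∈-ints⁺ _ n b₁) (∈-ints⁺ _ n b₂)) p
  }

-- A set graded by a nonnegative exponent with finite levels: the support of a theta-like series.
record Family (A : Set) : Set₁ where
  field
    member   : A → Set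
    exponent : A → ℤ
    nonneg   : ∀ {x} → member x → ∃ λ n → exponent x ≡ + n
    level    : ∀ n → Enumeration (λ x → member x × exponent x ≡ + n)

open Family

coeff : Family A → (A → ℤ) → PowerSeries
coeff F w n = ∑ (level F n) w

coeff-cong : (F : Family A) {w v : A → ℤ} → (∀ x → w x ≡ v x) → coeff F w ≈ coeff F v
coeff-cong F eq n = ∑-cong (level F n) λ x _ → eq x

D-coeff : (F : Family A) (w : A → ℤ) → D (coeff F w) ≈ coeff F (λ x → exponent F x * w x)
D-coeff F w n = trans (sym (∑-* (level F n) (+ n) w))
  (∑-cong (level F n) λ { x (_ , eq) → cong (_* w x) (sym eq) })

-- Follows the recursion of `_⊛_`, so that sums over it become Cauchy products by the same
-- induction.
pairs : (ℕ → List A) → (ℕ → List B) → ℕ → List (A × B)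
pairs xs ys zero    = cartesianProduct (xs 0) (ys 0)
pairs xs ys (suc n) = cartesianProduct (xs 0) (ys (suc n)) ++ pairs (xs ∘ suc) ys n

Sum-pairs : (xs : ℕ → List A) (ys : ℕ → List B) (w : A → ℤ) (v : B → ℤ) → ∀ n →
  Sum (pairs xs ys n) (λ z → w (proj₁ z) * v (proj₂ z)) ≡ ((λ i → Sum (xs i) w) ⊛ (λ i → Sum (ys i) v)) n
Sum-pairs xs ys w v zero    = Sum-× (xs 0) (ys 0) w v
Sum-pairs xs ys w v (suc n) = trans (Sum-++ (cartesianProduct (xs 0) (ys (suc n))) _ _)
  (cong₂ _+_ (Sum-× (xs 0) (ys (suc n)) w v) (Sum-pairs (xs ∘ suc) ys w v n))

∈-pairs⁻ : (xs : ℕ → List A) (ys : ℕ → List B) → ∀ n {z} → z ∈ pairs xs ys n →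
  ∃₂ λ i j → i ℕ.+ j ≡ n × proj₁ z ∈ xs i × proj₂ z ∈ ys j
∈-pairs⁻ xs ys zero    z∈ = 0 , 0 , refl , ∈-cartesianProduct⁻ (xs 0) (ys 0) z∈
∈-pairs⁻ xs ys (suc n) z∈ with ∈-++⁻ (cartesianProduct (xs 0) (ys (suc n))) z∈
... | inj₁ z∈′ = 0 , suc n , refl , ∈-cartesianProduct⁻ (xs 0) (ys (suc n)) z∈′
... | inj₂ z∈′ with i , j , refl , p ← ∈-pairs⁻ (xs ∘ suc) ys n z∈′ = suc i , j , refl , p

∈-pairs⁺ : (xs : ℕ → List A) (ys : ℕ → List B) → ∀ i j {x y} → x ∈ xs i → y ∈ ys j →
  (x , y) ∈ pairs xs ys (i ℕ.+ j)
∈-pairs⁺ xs ys zero    zero    x∈ y∈ = ∈-cartesianProduct⁺ x∈ y∈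
∈-pairs⁺ xs ys zero    (suc j) x∈ y∈ = ∈-++⁺ˡ (∈-cartesianProduct⁺ x∈ y∈)
∈-pairs⁺ xs ys (suc i) j       x∈ y∈ = ∈-++⁺ʳ (cartesianProduct (xs 0) (ys (suc i ℕ.+ j)))
  (∈-pairs⁺ (xs ∘ suc) ys i j x∈ y∈)

pairs-unique : (xs : ℕ → List A) (ys : ℕ → List B) → (∀ i → Unique (xs i)) → (∀ j → Unique (ys j)) →
  (∀ {x} i j → x ∈ xs i → x ∈ xs j → i ≡ j) → ∀ n → Unique (pairs xs ys n)
pairs-unique xs ys ux uy disjoint zero    = Uniqueₚ.cartesianProduct⁺ (ux 0) (uy 0)
pairs-unique xs ys ux uy disjoint (suc n) =
  Uniqueₚ.++⁺ (Uniqueₚ.cartesianProduct⁺ (ux 0) (uy (suc n)))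
    (pairs-unique (xs ∘ suc) ys (ux ∘ suc) uy (λ i j p q → ℕP.suc-injective (disjoint (suc i) (suc j) p q)) n)
    λ (p , q) → separate (∈-cartesianProduct⁻ (xs 0) (ys (suc n)) p) (∈-pairs⁻ (xs ∘ suc) ys n q)
  where
  separate : ∀ {x y} → x ∈ xs 0 × y ∈ ys (suc n) → (∃₂ λ i j → i ℕ.+ j ≡ n × x ∈ xs (suc i) × y ∈ ys j) → ⊥
  separate (p , _) (i , _ , _ , q , _) with () ← disjoint 0 (suc i) p q

infixr 6 _⊗_
-- Completeness of the levels rests on `nonneg`: an element of exponent n must split as n = i + j
-- with natural i and j, the only splittings that a Cauchy product sees.
_⊗_ : Family A → Family B → Family (A × B)
F ⊗ G = record
  { member   = λ z → member F (proj₁ z) × member G (proj₂ z)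
  ; exponent = λ z → exponent F (proj₁ z) + exponent G (proj₂ z)
  ; nonneg   = λ (p , q) → let i , eq = nonneg F p ; j , eq′ = nonneg G q in
      i ℕ.+ j , cong₂ _+_ eq eq′
  ; level    = λ n → record
    { elements = pairs xs ys n
    ; unique   = pairs-unique xs ys (unique ∘ level F) (unique ∘ level G)
        (λ i j p q → ℤP.+-injective (trans (sym (proj₂ (sound (level F i) p))) (proj₂ (sound (level F j) q)))) n
    ; sound    = λ z∈ → from n (∈-pairs⁻ xs ys n z∈)
    ; complete = λ ((p , q) , eq) → to n p q eq (nonneg F p) (nonneg G q)
    }
  }
  where
  xs = elements ∘ level F
  ys = elements ∘ level G
  from : ∀ n {z} → (∃₂ λ i j → i ℕ.+ j ≡ n × proj₁ z ∈ xs i × proj₂ z ∈ ys j) →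
    (member F (proj₁ z) × member G (proj₂ z)) × exponent F (proj₁ z) + exponent G (proj₂ z) ≡ + n
  from n (i , j , refl , x∈ , y∈) with p , eq ← sound (level F i) x∈ | q , eq′ ← sound (level G j) y∈ =
    (p , q) , cong₂ _+_ eq eq′
  to : ∀ n {x y} → member F x → member G y → exponent F x + exponent G y ≡ + n →
    (∃ λ i → exponent F x ≡ + i) → (∃ λ j → exponent G y ≡ + j) → (x , y) ∈ pairs xs ys n
  to n {x} {y} p q eq (i , eq₁) (j , eq₂) = subst (λ m → (x , y) ∈ pairs xs ys m)
    (ℤP.+-injective (trans (sym (cong₂ _+_ eq₁ eq₂)) eq))
    (∈-pairs⁺ xs ys i j (complete (level F i) (p , eq₁)) (complete (level G j) (q , eq₂)))

coeff-⊗ : (F : Family A) (G : Family B) (w : A → ℤ) (v : B → ℤ) →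
  coeff (F ⊗ G) (λ z → w (proj₁ z) * v (proj₂ z)) ≈ coeff F w ⊛ coeff G v
coeff-⊗ F G w v = Sum-pairs (elements ∘ level F) (elements ∘ level G) w v

pronic : ℤ → ℕ
pronic (+ m)    = m ℕ.* m ℕ.+ m
pronic -[1+ m ] = suc m ℕ.* m

+pronic : ∀ k → k * k + k ≡ + pronic k
+pronic (+ m)    = cong (_+ (+ m)) (sym (ℤP.pos-* m m))
+pronic -[1+ m ] = trans (factor (+ m)) (sym (ℤP.pos-* (suc m) m))
  where
  factor : ∀ x → - (+ 1 + x) * - (+ 1 + x) + - (+ 1 + x) ≡ (+ 1 + x) * x
  factor = solve-∀

+square : ∀ k → k * k ≡ + (∣ k ∣ ℕ.* ∣ k ∣)
+square (+ m)    = sym (ℤP.pos-* m m)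
+square -[1+ m ] = refl

∣k∣≤1+pronic : ∀ k → ∣ k ∣ ℕ.≤ suc (pronic k)
∣k∣≤1+pronic (+ m)    = ℕP.m≤n⇒m≤1+n (ℕP.m≤n+m m (m ℕ.* m))
∣k∣≤1+pronic -[1+ m ] = s≤s (ℕP.m≤m+n m (m ℕ.* m))

-- Both k² and k² + k are nonnegative on the integers, so this form shows the sign of the exponent;
-- b ≠ 0 bounds k, because |k| ≤ k² + k + 1.
quadratic : (a b c : ℕ) → .{{_ : ℕ.NonZero b}} → ℤ → ℤ
quadratic a b c k = + a * (k * k) + + b * (k * k + k) + + c

quadratic≥0 : ∀ a b c .{{_ : ℕ.NonZero b}} k →
  quadratic a b c k ≡ + (a ℕ.* (∣ k ∣ ℕ.* ∣ k ∣) ℕ.+ b ℕ.* pronic k ℕ.+ c)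
quadratic≥0 a b c k = cong (_+ (+ c)) (cong₂ _+_
  (trans (cong (_*_ (+ a)) (+square k)) (sym (ℤP.pos-* a _)))
  (trans (cong (_*_ (+ b)) (+pronic k)) (sym (ℤP.pos-* b _))))

quadratic-bound : ∀ a b c .{{_ : ℕ.NonZero b}} k n → quadratic a b c k ≡ + n → ∣ k ∣ ℕ.≤ suc n
quadratic-bound a b c k n eq = ℕP.≤-trans (∣k∣≤1+pronic k) (s≤s (begin
  pronic k  ≤⟨ ℕP.m≤n*m (pronic k) b ⟩
  b ℕ.* pronic k  ≤⟨ ℕP.m≤n+m _ (a ℕ.* (∣ k ∣ ℕ.* ∣ k ∣)) ⟩
  a ℕ.* (∣ k ∣ ℕ.* ∣ k ∣) ℕ.+ b ℕ.* pronic k  ≤⟨ ℕP.m≤m+n _ c ⟩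
  a ℕ.* (∣ k ∣ ℕ.* ∣ k ∣) ℕ.+ b ℕ.* pronic k ℕ.+ c  ≡⟨ ℤP.+-injective (trans (sym (quadratic≥0 a b c k)) eq) ⟩
  n  ∎))
  where open ℕP.≤-Reasoning

quadraticFamily : (a b c : ℕ) → .{{_ : ℕ.NonZero b}} → Family ℤ
quadraticFamily a b c = record
  { member   = λ _ → ⊤
  ; exponent = quadratic a b c
  ; nonneg   = λ {k} _ → _ , quadratic≥0 a b c k
  ; level    = λ n → enumerateℤ (λ k → yes tt ×-dec quadratic a b c k ℤP.≟ + n) (suc n)
      λ k (_ , eq) → quadratic-bound a b c k n eq
  }

-- Odd squares enter as (y² - 1)/4: when four of them add up to 4n, or when x² + 3z² = 4n, the
-- exponents add up to n - 1. The missing 1 is the factor q in front of the eta product.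
pentagonal oddSquares′ oddSquares thirdsOddSquares thirdsOddSquares′ cubeFamily oneModThree : Family ℤ
-- ((6k+1)² - 1) / 4
pentagonal = quadraticFamily 6 3 0
-- (3(4l+1)² - 3) / 4
cubeFamily = quadraticFamily 6 6 0
-- ((4k+1)² - 1) / 4
oddSquares = quadraticFamily 2 2 0
-- ((2k+1)² - 1) / 4
oddSquares′ = quadraticFamily 0 1 0
-- (9(4k+1)² - 1) / 4
thirdsOddSquares = quadraticFamily 18 18 2
-- (9(2k+1)² - 1) / 4
thirdsOddSquares′ = quadraticFamily 0 9 2
-- (3k+1)²
oneModThree = quadraticFamily 3 6 1

-- Euler's pentagonal number theorem

shift : ℕ → PowerSeries → PowerSeries
shift zero    c n       = c n
shift (suc m) c zero    = + 0
shift (suc m) c (suc n) = shift m c n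

q^ : ℕ → PowerSeries
q^ m = shift m 𝟙

shift-⊛ : ∀ m c d → shift m c ⊛ d ≈ shift m (c ⊛ d)
shift-⊛ zero    c d n       = ⊛-cong {shift 0 c} {c} {d} {d} (λ _ → refl) (λ _ → refl) n
shift-⊛ (suc m) c d zero    = ℤP.*-zeroˡ (d 0)
shift-⊛ (suc m) c d (suc n) =
  trans (cong (_+ ((shift m c ⊛ d) n)) (ℤP.*-zeroˡ (d (suc n)))) (trans (ℤP.+-identityˡ _) (shift-⊛ m c d n))

shift-cong : ∀ m {c d} → c ≈ d → shift m c ≈ shift m d
shift-cong zero    eq n       = eq n
shift-cong (suc m) eq zero    = refl
shift-cong (suc m) eq (suc n) = shift-cong m eq n

shift-+ : ∀ m n c → shift m (shift n c) ≈ shift (m ℕ.+ n) c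
shift-+ zero    n c i       = refl
shift-+ (suc m) n c zero    = refl
shift-+ (suc m) n c (suc i) = shift-+ m n c i

q^-⊛ : ∀ m c → q^ m ⊛ c ≈ shift m c
q^-⊛ m c = ≈-trans (shift-⊛ m 𝟙 c) (shift-cong m (⊛-identityˡ c))

q^-+ : ∀ m n → q^ m ⊛ q^ n ≈ q^ (m ℕ.+ n)
q^-+ m n = ≈-trans (q^-⊛ m (q^ n)) (shift-+ m n 𝟙)

q^-≡ : ∀ {m n} → m ≡ n → q^ m ≈ q^ n
q^-≡ refl _ = refl

shift-< : ∀ m c {n} → n ℕ.< m → shift m c n ≡ + 0
shift-< (suc m) c {zero}  _         = refl
shift-< (suc m) c {suc n} (s≤s n<m) = shift-< m c n<m

shift-value : ∀ m c n → shift m c n ≡ (if n <ᵇ m then + 0 else c (n ℕ.∸ m))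
shift-value zero    c n       = refl
shift-value (suc m) c zero    = refl
shift-value (suc m) c (suc n) = shift-value m c n

q^-value : ∀ m {n} → m ≡ n → q^ m n ≡ + 1
q^-value zero    refl = refl
q^-value (suc m) refl = q^-value m refl

q^-other : ∀ m n → m ≢ n → q^ m n ≡ + 0
q^-other zero    zero    m≢n = ⊥-elim (m≢n refl)
q^-other zero    (suc n) _   = refl
q^-other (suc m) zero    _   = refl
q^-other (suc m) (suc n) m≢n = q^-other m n (m≢n ∘ cong suc)

-- The solver for series works over semirings, so minus one is handed to it as an opaque series;
-- cancellation is done by hand with `-𝟙-cancel`.
-𝟙 : PowerSeries
-𝟙 = ⊖ 𝟙

1-q^ : ℕ → PowerSeries
1-q^ m = 𝟙 ⊕ -𝟙 ⊛ q^ m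

mulOneMinus-⊛ : ∀ m c → mulOneMinus m c ≈ 1-q^ m ⊛ c
mulOneMinus-⊛ m c n = trans (branch (n <ᵇ m))
  (sym (trans (⊛-distribʳ c 𝟙 (-𝟙 ⊛ q^ m) n) (cong₂ _+_ (⊛-identityˡ c n)
    (trans (⊛-assoc -𝟙 (q^ m) c n) (trans (-1*x≈-x (q^ m ⊛ c) n)
      (cong -_ (trans (q^-⊛ m c n) (shift-value m c n))))))))
  where
  branch : ∀ b → (if b then c n else c n - c (n ℕ.∸ m)) ≡ c n + - (if b then + 0 else c (n ℕ.∸ m))
  branch true  = sym (ℤP.+-identityʳ (c n))
  branch false = refl

-- ∏_{s < t ≤ s + j} (1 - q^(6t))
partialProduct : (s j : ℕ) → PowerSeries
partialProduct s zero    = 𝟙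
partialProduct s (suc j) = 1-q^ (6 ℕ.* suc s) ⊛ partialProduct (suc s) j

-- The definition splits off the first factor; the telescoping needs the last one too.
partialProduct-suc : ∀ s j → partialProduct s (suc j) ≈ partialProduct s j ⊛ 1-q^ (6 ℕ.* (s ℕ.+ suc j))
partialProduct-suc s zero n = trans (⊛-comm (1-q^ (6 ℕ.* suc s)) 𝟙 n)
  (cong (λ t → (𝟙 ⊛ 1-q^ (6 ℕ.* t)) n) (ℕP.+-comm 1 s))
partialProduct-suc s (suc j) = ≈-trans (⊛-congʳ x (partialProduct-suc (suc s) j))
  (≈-trans (≈-sym (⊛-assoc x (partialProduct (suc s) j) _))
    (λ n → cong (λ t → (x ⊛ partialProduct (suc s) j ⊛ 1-q^ (6 ℕ.* t)) n) (sym (ℕP.+-suc s (suc j)))))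
  where x = 1-q^ (6 ℕ.* suc s)

etaProd-⊛ : ∀ N → let P = partialProduct 0 N in etaProd N ≈ P ⊛ (P ⊛ (P ⊛ P))
etaProd-⊛ zero n = trans (one n) (sym (≈-trans (⊛-identityˡ (𝟙 ⊛ (𝟙 ⊛ 𝟙)))
    (≈-trans (⊛-identityˡ (𝟙 ⊛ 𝟙)) (⊛-identityˡ 𝟙)) n))
  where
  one : ∀ n → (if n ≡ᵇ 0 then + 1 else + 0) ≡ 𝟙 n
  one zero    = refl
  one (suc n) = refl
etaProd-⊛ (suc N) = ≈-trans (step _) (≈-trans (⊛-congʳ x (≈-trans (step _) (⊛-congʳ x
    (≈-trans (step _) (⊛-congʳ x (≈-trans (step _) (⊛-congʳ x (etaProd-⊛ N))))))))
    (≈-trans (solve 2 (λ x p → x :* (x :* (x :* (x :* (p :* (p :* (p :* p)))))) :=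
                (p :* x) :* ((p :* x) :* ((p :* x) :* (p :* x)))) ≈-refl x P)
      (⊛-cong e (⊛-cong e (⊛-cong e e)))))
  where
  x = 1-q^ (6 ℕ.* suc N)
  P = partialProduct 0 N
  step = mulOneMinus-⊛ (6 ℕ.* suc N)
  e = ≈-sym (partialProduct-suc 0 N)

triangular : ℕ → ℕ
triangular zero    = 0
triangular (suc n) = suc n ℕ.+ triangular n

sgnℕ : ℕ → ℤ
sgnℕ zero    = + 1
sgnℕ (suc n) = - sgnℕ n

sgn : ℤ → ℤ
sgn k = sgnℕ ∣ k ∣

ε : ℕ → PowerSeries
ε zero    = 𝟙
ε (suc s) = -𝟙 ⊛ ε s

ε-⊛ : ∀ s c → ε s ⊛ c ≈ sgnℕ s · c
ε-⊛ zero    c n = trans (⊛-identityˡ c n) (sym (ℤP.*-identityˡ (c n)))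
ε-⊛ (suc s) c n = trans (⊛-assoc -𝟙 (ε s) c n) (trans (-1*x≈-x (ε s ⊛ c) n)
  (trans (cong -_ (ε-⊛ s c n)) (ℤP.neg-distribˡ-* (sgnℕ s) (c n))))

-- Shanks: the sums F n = Σ_{s ≤ n} (-1)^s ∏_{s < t ≤ n} (1 - q^t) · q^(s n + s(s+1)/2) satisfy
-- F n - F (n-1) = (-1)^n (q^(n(3n-1)/2) + q^(n(3n+1)/2)), and modulo q^(n+1) only the term s = 0 survives.
shanksTerm : (n s : ℕ) → PowerSeries
shanksTerm n s = ε s ⊛ (partialProduct s (n ℕ.∸ s) ⊛ q^ (6 ℕ.* (s ℕ.* n ℕ.+ triangular s)))

partialSum : (ℕ → PowerSeries) → ℕ → PowerSeries
partialSum f zero    = f 0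
partialSum f (suc k) = partialSum f k ⊕ f (suc k)

-𝟙-cancel : ∀ c → c ⊕ -𝟙 ⊛ c ≈ 𝟘
-𝟙-cancel c n = trans (cong (_+_ (c n)) (-1*x≈-x c n)) (ℤP.+-inverseʳ (c n))

-- Stopping the sums at k leaves a single error term. Adding the next term of F (m+1), with 1 -
-- q^(6(m+1)) split off its product, turns the error for k into the error for k + 1. Writing m = k +
-- r resolves the truncated subtraction in `shanksTerm`.
shanks-telescope : ∀ k r → let m = k ℕ.+ r in
  partialSum (shanksTerm (suc m)) k ≈
  partialSum (shanksTerm m) k ⊕
    ε (suc k) ⊛ (partialProduct k r ⊛ q^ (6 ℕ.* (suc k ℕ.* suc m ℕ.+ triangular k)))
shanks-telescope zero r = begin
  𝟙 ⊛ (partialProduct 0 (suc r) ⊛ q^ 0)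
    ≈⟨ ⊛-congʳ 𝟙 (⊛-cong (partialProduct-suc 0 r) ≈-refl) ⟩
  𝟙 ⊛ (P ⊛ (𝟙 ⊕ -𝟙 ⊛ q^ (6 ℕ.* suc r)) ⊛ q^ 0)
    ≈⟨ solve 4 (λ u p x z → con 1 :* (p :* (con 1 :+ u :* x) :* z) :=
         con 1 :* (p :* z) :+ (u :* con 1) :* (p :* (x :* z))) ≈-refl -𝟙 P (q^ (6 ℕ.* suc r)) (q^ 0) ⟩
  𝟙 ⊛ (P ⊛ q^ 0) ⊕ -𝟙 ⊛ 𝟙 ⊛ (P ⊛ (q^ (6 ℕ.* suc r) ⊛ q^ 0))
    ≈⟨ ⊕-congʳ (𝟙 ⊛ (P ⊛ q^ 0)) (⊛-congʳ (-𝟙 ⊛ 𝟙) (⊛-congʳ P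
         (≈-trans (q^-+ (6 ℕ.* suc r) 0) (q^-≡ (exponent-eq r))))) ⟩
  𝟙 ⊛ (P ⊛ q^ 0) ⊕ -𝟙 ⊛ 𝟙 ⊛ (P ⊛ q^ (6 ℕ.* (1 ℕ.* suc r ℕ.+ 0))) ∎
  where
  open ≈-Reasoning
  P = partialProduct 0 r
  exponent-eq : ∀ r → 6 ℕ.* suc r ℕ.+ 0 ≡ 6 ℕ.* (1 ℕ.* suc r ℕ.+ 0)
  exponent-eq = ℕ-solve-∀
shanks-telescope (suc k) r = begin
  partialSum (shanksTerm (suc m)) k ⊕ shanksTerm (suc m) (suc k)
    ≈⟨ ⊕-cong {partialSum (shanksTerm (suc m)) k} {S ⊕ e ⊛ (1-q^ x ⊛ W ⊛ V)} ih upper ⟩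
  (S ⊕ e ⊛ (1-q^ x ⊛ W ⊛ V)) ⊕ e ⊛ (W ⊛ 1-q^ y ⊛ (q^ x ⊛ V))
    -- Since u stands for minus one without the solver knowing it, the two terms with q^x that
    -- cancel remain as z + u z and are removed afterwards.
    ≈⟨ solve 7 (λ s e u x y w t →
         (s :+ e :* ((con 1 :+ u :* x) :* w :* t)) :+ e :* (w :* (con 1 :+ u :* y) :* (x :* t)) :=
         (s :+ e :* (w :* t)) :+ (u :* e) :* (w :* (y :* (x :* t)))
           :+ (e :* (w :* (x :* t)) :+ u :* (e :* (w :* (x :* t))))) ≈-refl S e -𝟙 (q^ x) (q^ y) W V ⟩
  (S ⊕ e ⊛ (W ⊛ V)) ⊕ (-𝟙 ⊛ e) ⊛ (W ⊛ (q^ y ⊛ (q^ x ⊛ V))) ⊕ (z ⊕ -𝟙 ⊛ z)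
    ≈⟨ (λ n → trans (cong (_+_ (((S ⊕ e ⊛ (W ⊛ V)) ⊕ (-𝟙 ⊛ e) ⊛ (W ⊛ (q^ y ⊛ (q^ x ⊛ V)))) n)) (-𝟙-cancel z n)) (ℤP.+-identityʳ _)) ⟩
  (S ⊕ e ⊛ (W ⊛ V)) ⊕ (-𝟙 ⊛ e) ⊛ (W ⊛ (q^ y ⊛ (q^ x ⊛ V)))
    ≈⟨ ⊕-cong {S ⊕ e ⊛ (W ⊛ V)} (⊕-congʳ S lower) (⊛-congʳ (-𝟙 ⊛ e) (⊛-congʳ W rest)) ⟩
  (S ⊕ shanksTerm m (suc k)) ⊕ ε (suc (suc k)) ⊛ (W ⊛ q^ (6 ℕ.* (suc (suc k) ℕ.* suc m ℕ.+ triangular (suc k)))) ∎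
  where
  open ≈-Reasoning
  m = suc k ℕ.+ r
  x = 6 ℕ.* suc k
  y = 6 ℕ.* suc m
  e = ε (suc k)
  S = partialSum (shanksTerm m) k
  W = partialProduct (suc k) r
  V = q^ (6 ℕ.* (suc k ℕ.* m ℕ.+ triangular (suc k)))
  z = e ⊛ (W ⊛ (q^ x ⊛ V))
  eq₁ : ∀ k m t → 6 ℕ.* (suc k ℕ.* suc m ℕ.+ t) ≡ 6 ℕ.* (suc k ℕ.* m ℕ.+ (suc k ℕ.+ t))
  eq₁ = ℕ-solve-∀
  eq₂ : ∀ k m t → 6 ℕ.* suc k ℕ.+ 6 ℕ.* (suc k ℕ.* m ℕ.+ t) ≡ 6 ℕ.* (suc k ℕ.* suc m ℕ.+ t)
  eq₂ = ℕ-solve-∀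
  eq₃ : ∀ k m t → 6 ℕ.* suc m ℕ.+ 6 ℕ.* (suc k ℕ.* suc m ℕ.+ t) ≡ 6 ℕ.* (suc (suc k) ℕ.* suc m ℕ.+ t)
  eq₃ = ℕ-solve-∀
  ih : partialSum (shanksTerm (suc m)) k ≈ S ⊕ e ⊛ (1-q^ x ⊛ W ⊛ V)
  ih n = trans (subst (λ m → partialSum (shanksTerm (suc m)) k n ≡ (partialSum (shanksTerm m) k ⊕
           e ⊛ (1-q^ x ⊛ W ⊛ q^ (6 ℕ.* (suc k ℕ.* suc m ℕ.+ triangular k)))) n)
           (ℕP.+-suc k r) (shanks-telescope k (suc r) n))
         (cong (λ i → (S ⊕ e ⊛ (1-q^ x ⊛ W ⊛ q^ i)) n) (eq₁ k m (triangular k)))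
  m∸k : m ℕ.∸ k ≡ suc r
  m∸k = trans (cong (ℕ._∸ k) (sym (ℕP.+-suc k r))) (ℕP.m+n∸m≡n k (suc r))
  aT : q^ x ⊛ V ≈ q^ (6 ℕ.* (suc k ℕ.* suc m ℕ.+ triangular (suc k)))
  aT = ≈-trans (q^-+ x _) (q^-≡ (eq₂ k m (triangular (suc k))))
  upper : shanksTerm (suc m) (suc k) ≈ e ⊛ (W ⊛ 1-q^ y ⊛ (q^ x ⊛ V))
  upper n = trans (cong (λ j → (e ⊛ (partialProduct (suc k) j ⊛ q^ (6 ℕ.* (suc k ℕ.* suc m ℕ.+ triangular (suc k))))) n) m∸k)
    (⊛-congʳ e (⊛-cong
      (λ i → trans (partialProduct-suc (suc k) r i) (cong (λ t → (W ⊛ 1-q^ (6 ℕ.* suc t)) i) (ℕP.+-suc k r)))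
      (≈-sym aT)) n)
  lower : e ⊛ (W ⊛ V) ≈ shanksTerm m (suc k)
  lower n = cong (λ j → (e ⊛ (partialProduct (suc k) j ⊛ V)) n) (sym (ℕP.m+n∸m≡n k r))
  rest : q^ y ⊛ (q^ x ⊛ V) ≈ q^ (6 ℕ.* (suc (suc k) ℕ.* suc m ℕ.+ triangular (suc k)))
  rest = ≈-trans (⊛-congʳ (q^ y) aT) (≈-trans (q^-+ y _) (q^-≡ (eq₃ k m (triangular (suc k)))))

-- Literally the natural number in `quadratic≥0 6 3 0`, with its trailing zero, so that the two
-- agree by computation.
pentagonalℕ : ℤ → ℕ
pentagonalℕ k = 6 ℕ.* (∣ k ∣ ℕ.* ∣ k ∣) ℕ.+ 3 ℕ.* pronic k ℕ.+ 0

pentagonalSum : ℕ → PowerSeries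
pentagonalSum n i = Sum (ints n) (λ k → sgn k * q^ (pentagonalℕ k) i)

2*triangular : ∀ n → 2 ℕ.* triangular n ≡ n ℕ.* suc n
2*triangular zero    = refl
2*triangular (suc n) = trans (ℕP.*-distribˡ-+ 2 (suc n) (triangular n))
  (trans (cong (2 ℕ.* suc n ℕ.+_) (2*triangular n)) (factor n))
  where
  factor : ∀ n → 2 ℕ.* suc n ℕ.+ n ℕ.* suc n ≡ suc n ℕ.* suc (suc n)
  factor = ℕ-solve-∀

sixfold-triangular : ∀ x n → 6 ℕ.* (x ℕ.+ triangular n) ≡ 6 ℕ.* x ℕ.+ 3 ℕ.* (n ℕ.* suc n)
sixfold-triangular x n = trans (expand x (triangular n)) (cong (λ t → 6 ℕ.* x ℕ.+ 3 ℕ.* t) (2*triangular n))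
  where
  expand : ∀ x t → 6 ℕ.* (x ℕ.+ t) ≡ 6 ℕ.* x ℕ.+ 3 ℕ.* (2 ℕ.* t)
  expand = ℕ-solve-∀

-- From m to m + 1, the error term of the telescoping contributes the index -(m+1) and the new last
-- term the index m + 1; in both the remaining product is empty.
shanks : ∀ n → partialSum (shanksTerm n) n ≈ pentagonalSum n
shanks zero i = trans (⊛-identityˡ (𝟙 ⊛ q^ 0) i) (trans (⊛-identityˡ (q^ 0) i)
  (sym (trans (ℤP.+-identityʳ _) (ℤP.*-identityˡ (q^ 0 i)))))
shanks (suc m) = begin
  partialSum (shanksTerm (suc m)) m ⊕ shanksTerm (suc m) (suc m)
    ≈⟨ ⊕-cong {partialSum (shanksTerm (suc m)) m} before last ⟩
  (pentagonalSum m ⊕ σ · q^ (pentagonalℕ -[1+ m ])) ⊕ σ · q^ (pentagonalℕ (+ suc m))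
    ≈⟨ (λ i → rotate (pentagonalSum m i) (σ * q^ (pentagonalℕ -[1+ m ]) i) _) ⟩
  pentagonalSum (suc m) ∎
  where
  open ≈-Reasoning
  σ = sgnℕ (suc m)
  rotate : ∀ x y z → x + y + z ≡ z + (y + x)
  rotate = solve-∀
  eq₁ : ∀ m → 6 ℕ.* (suc m ℕ.* suc m) ℕ.+ 3 ℕ.* (m ℕ.* suc m) ≡ 6 ℕ.* (suc m ℕ.* suc m) ℕ.+ 3 ℕ.* (suc m ℕ.* m) ℕ.+ 0
  eq₁ = ℕ-solve-∀
  eq₂ : ∀ m → 6 ℕ.* (suc m ℕ.* suc m) ℕ.+ 3 ℕ.* (suc m ℕ.* suc (suc m)) ≡ 6 ℕ.* (suc m ℕ.* suc m) ℕ.+ 3 ℕ.* (suc m ℕ.* suc m ℕ.+ suc m) ℕ.+ 0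
  eq₂ = ℕ-solve-∀
  signed : ∀ {x y} → x ≡ y → ε (suc m) ⊛ (𝟙 ⊛ q^ x) ≈ σ · q^ y
  signed {x} refl i = trans (⊛-congʳ (ε (suc m)) (⊛-identityˡ (q^ x)) i) (ε-⊛ (suc m) (q^ x) i)
  before : partialSum (shanksTerm (suc m)) m ≈ pentagonalSum m ⊕ σ · q^ (pentagonalℕ -[1+ m ])
  before i = trans (subst (λ x → partialSum (shanksTerm (suc x)) m i ≡ (partialSum (shanksTerm x) m ⊕
      ε (suc m) ⊛ (𝟙 ⊛ q^ (6 ℕ.* (suc m ℕ.* suc x ℕ.+ triangular m)))) i) (ℕP.+-identityʳ m) (shanks-telescope m 0 i))
    (cong₂ _+_ (shanks m i) (signed (trans (sixfold-triangular (suc m ℕ.* suc m) m) (eq₁ m)) i))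
  last : shanksTerm (suc m) (suc m) ≈ σ · q^ (pentagonalℕ (+ suc m))
  last i = trans (cong (λ j → (ε (suc m) ⊛ (partialProduct (suc m) j ⊛ q^ (6 ℕ.* (suc m ℕ.* suc m ℕ.+ triangular (suc m))))) i) (ℕP.n∸n≡0 m))
    (signed (trans (sixfold-triangular (suc m ℕ.* suc m) (suc m)) (eq₂ m)) i)

partialSum-head : ∀ f i k → (∀ s → f (suc s) i ≡ + 0) → partialSum f k i ≡ f 0 i
partialSum-head f i zero    z = refl
partialSum-head f i (suc k) z = trans (cong₂ _+_ (partialSum-head f i k z) (z k)) (ℤP.+-identityʳ _)

shanksTerm-high : ∀ n s {i} → i ℕ.≤ n → shanksTerm (suc n) (suc s) i ≡ + 0
shanksTerm-high n s {i} i≤n = trans (ε-⊛ (suc s) _ i) (trans (cong (_*_ (sgnℕ (suc s)))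
    (trans (⊛-comm (partialProduct (suc s) (n ℕ.∸ s)) (q^ x) i)
      (trans (q^-⊛ x (partialProduct (suc s) (n ℕ.∸ s)) i) (shift-< x _ i<x)))) (ℤP.*-zeroʳ (sgnℕ (suc s))))
  where
  x = 6 ℕ.* (suc s ℕ.* suc n ℕ.+ triangular (suc s))
  i<x : i ℕ.< x
  i<x = begin-strict
    i  <⟨ s≤s i≤n ⟩
    suc n  ≤⟨ ℕP.m≤m+n (suc n) _ ⟩
    suc s ℕ.* suc n  ≤⟨ ℕP.m≤m+n _ (triangular (suc s)) ⟩
    suc s ℕ.* suc n ℕ.+ triangular (suc s)  ≤⟨ ℕP.m≤n*m _ 6 ⟩
    x  ∎
    where open ℕP.≤-Reasoning

partialProduct-low : ∀ n {i} → i ℕ.≤ n → partialProduct 0 (suc n) i ≡ pentagonalSum (suc n) i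
partialProduct-low n {i} i≤n = begin
  partialProduct 0 (suc n) i
    ≡⟨ trans (⊛-identityˡ (partialProduct 0 (suc n) ⊛ q^ 0) i)
         (trans (⊛-comm (partialProduct 0 (suc n)) (q^ 0) i) (⊛-identityˡ (partialProduct 0 (suc n)) i)) ⟨
  shanksTerm (suc n) 0 i
    ≡⟨ partialSum-head (shanksTerm (suc n)) i (suc n) (λ s → shanksTerm-high n s i≤n) ⟨
  partialSum (shanksTerm (suc n)) (suc n) i
    ≡⟨ shanks (suc n) i ⟩
  pentagonalSum (suc n) i ∎
  where open ≡-Reasoning

Sum-filter : {P : A → Set} (P? : Decidable P) (xs : List A) (w v : A → ℤ) →
  (∀ x → P x → v x ≡ w x) → (∀ x → ¬ P x → v x ≡ + 0) → Sum (filter P? xs) w ≡ Sum xs v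
Sum-filter P? []       w v yes′ no′ = refl
Sum-filter P? (x ∷ xs) w v yes′ no′ with P? x
... | yes p = cong₂ _+_ (sym (yes′ x p)) (Sum-filter P? xs w v yes′ no′)
... | no ¬p = trans (sym (ℤP.+-identityˡ _)) (cong₂ _+_ (sym (no′ x ¬p)) (Sum-filter P? xs w v yes′ no′))

eulerSeries : PowerSeries
eulerSeries = coeff pentagonal sgn

-- An index k of exponent i satisfies |k| ≤ i + 1 ≤ n + 1, so the finite range misses none.
pentagonalSum-coeff : ∀ n {i} → i ℕ.≤ n → pentagonalSum (suc n) i ≡ eulerSeries i
pentagonalSum-coeff n {i} i≤n = trans
  (sym (Sum-filter P? (ints (suc n)) sgn (λ k → sgn k * q^ (pentagonalℕ k) i)
    (λ k eq → trans (cong (_*_ (sgn k)) (q^-value (pentagonalℕ k) eq)) (ℤP.*-identityʳ (sgn k)))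
    (λ k ne → trans (cong (_*_ (sgn k)) (q^-other (pentagonalℕ k) i ne)) (ℤP.*-zeroʳ (sgn k)))))
  (∑-⇔ (enumerateℤ P? (suc n) (λ k eq → ℕP.≤-trans
         (quadratic-bound 6 3 0 k i (trans (quadratic≥0 6 3 0 k) (cong +_ eq))) (s≤s i≤n)))
       (level pentagonal i)
       (λ {k} eq → tt , trans (quadratic≥0 6 3 0 k) (cong +_ eq))
       (λ {k} (_ , eq) → ℤP.+-injective (trans (sym (quadratic≥0 6 3 0 k)) eq)) sgn)
  where
  P? : Decidable (λ k → pentagonalℕ k ≡ i)
  P? k = pentagonalℕ k ℕP.≟ i

⊛-low : ∀ {c c′ d d′ : PowerSeries} n → (∀ {i} → i ℕ.≤ n → c i ≡ c′ i) → (∀ {i} → i ℕ.≤ n → d i ≡ d′ i) →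
  ∀ {i} → i ℕ.≤ n → (c ⊛ d) i ≡ (c′ ⊛ d′) i
⊛-low n p q {zero}  i≤ = cong₂ _*_ (p i≤) (q i≤)
⊛-low (suc n) p q {suc i} (s≤s i≤) = cong₂ _+_ (cong₂ _*_ (p z≤n) (q (s≤s i≤)))
  (⊛-low n (p ∘ s≤s) (q ∘ ℕP.m≤n⇒m≤1+n) i≤)

-- The truncated product is compared with Euler's series in degrees up to l only; a Cauchy product
-- in degree l looks at nothing higher.
a-euler : ∀ l → a (suc l) ≡ (eulerSeries ⊛ (eulerSeries ⊛ (eulerSeries ⊛ eulerSeries))) l
a-euler l = trans (etaProd-⊛ (suc l) l)
  (⊛-low l low (⊛-low l low (⊛-low l low low)) ℕP.≤-refl)
  where
  low : ∀ {i} → i ℕ.≤ l → partialProduct 0 (suc l) i ≡ eulerSeries i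
  low i≤l = trans (partialProduct-low l i≤l) (pentagonalSum-coeff l i≤l)

-- Jacobi's identity for the cube of the Euler product

no-half : ∀ t → t + t ≢ + 1
no-half (+ zero)  ()
no-half (+ suc n) eq with () ← ℕP.m+1+n≢0 n (ℕP.suc-injective (ℤP.+-injective eq))

even≢odd : ∀ g h → g + g ≢ + 1 + (h + h)
even≢odd g h eq = no-half (g - h) (trans (rearrange g h) (trans (cong (_- (h + h)) eq) (cancel h)))
  where
  rearrange : ∀ g h → (g - h) + (g - h) ≡ (g + g) - (h + h)
  rearrange = solve-∀
  cancel : ∀ h → + 1 + (h + h) - (h + h) ≡ + 1
  cancel = solve-∀

double-injective : ∀ g h → g + g ≡ h + h → g ≡ h
double-injective g h eq = ℤP.*-cancelˡ-≡ (+ 2) g h (trans (double g) (trans eq (sym (double h))))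
  where
  double : ∀ g → + 2 * g ≡ g + g
  double = solve-∀

Parity : ℤ → Set
Parity x = (∃ λ h → x ≡ h + h) ⊎ (∃ λ h → x ≡ + 1 + (h + h))

parity : ∀ x → Parity x
parity (+ zero)        = inj₁ (+ 0 , refl)
parity (+ suc zero)    = inj₂ (+ 0 , refl)
parity (+ suc (suc n)) with parity (+ n)
... | inj₁ (h , eq) = inj₁ (+ 1 + h , trans (cong (_+_ (+ 2)) eq) (up h))
  where
  up : ∀ h → + 2 + (h + h) ≡ (+ 1 + h) + (+ 1 + h)
  up = solve-∀
... | inj₂ (h , eq) = inj₂ (+ 1 + h , trans (cong (_+_ (+ 2)) eq) (up h))
  where
  up : ∀ h → + 2 + (+ 1 + (h + h)) ≡ + 1 + ((+ 1 + h) + (+ 1 + h))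
  up = solve-∀
parity -[1+ zero ]        = inj₂ (-[1+ 0 ] , refl)
parity -[1+ suc zero ]    = inj₁ (-[1+ 0 ] , refl)
parity -[1+ suc (suc n) ] with parity -[1+ n ]
... | inj₁ (h , eq) = inj₁ (-[1+ 0 ] + h , trans (cong (_+_ -[1+ 1 ]) eq) (down h))
  where
  down : ∀ h → -[1+ 1 ] + (h + h) ≡ (-[1+ 0 ] + h) + (-[1+ 0 ] + h)
  down = solve-∀
... | inj₂ (h , eq) = inj₂ (-[1+ 0 ] + h , trans (cong (_+_ -[1+ 1 ]) eq) (down h))
  where
  down : ∀ h → -[1+ 1 ] + (+ 1 + (h + h)) ≡ + 1 + ((-[1+ 0 ] + h) + (-[1+ 0 ] + h))
  down = solve-∀

-- `parity` does not reduce at an open term h + h, so such functions are used only through the two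
-- equations that follow.
byParity : (ℤ → A) → (ℤ → A) → ℤ → A
byParity f g k = [ f ∘ proj₁ , g ∘ proj₁ ]′ (parity k)

byParity-even : (f g : ℤ → A) → ∀ h → byParity f g (h + h) ≡ f h
byParity-even f g h with parity (h + h)
... | inj₁ (h′ , eq) = cong f (sym (double-injective h h′ eq))
... | inj₂ (h′ , eq) = ⊥-elim (even≢odd h h′ eq)

byParity-odd : (f g : ℤ → A) → ∀ h → byParity f g (+ 1 + (h + h)) ≡ g h
byParity-odd f g h with parity (+ 1 + (h + h))
... | inj₁ (h′ , eq) = ⊥-elim (even≢odd h′ h (sym eq))
... | inj₂ (h′ , eq) = cong g (sym (double-injective h h′ (ℤRing.+-cancelˡ (+ 1) (h + h) (h′ + h′) eq)))

sgnℕ-double : ∀ n → sgnℕ (n ℕ.+ n) ≡ + 1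
sgnℕ-double zero    = refl
sgnℕ-double (suc n) = trans (cong (λ m → - sgnℕ m) (ℕP.+-suc n n))
  (trans (ℤP.neg-involutive _) (sgnℕ-double n))

sgn-even : ∀ h → sgn (h + h) ≡ + 1
sgn-even (+ n)    = sgnℕ-double n
sgn-even -[1+ n ] = trans (ℤP.neg-involutive _) (sgnℕ-double n)

sgn-odd : ∀ h → sgn (+ 1 + (h + h)) ≡ -[1+ 0 ]
sgn-odd (+ n)    = cong -_ (sgnℕ-double n)
sgn-odd -[1+ n ] = cong -_ (sgnℕ-double n)

self-negative : ∀ {x} → x ≡ - x → x ≡ + 0
self-negative {+ zero} _ = refl

-- Fixed points of the involution need no separate care: the whole sum equals its own negative.
∑-antisymmetric : {P : A → Set} (E : Enumeration P) (ι : A → A) (w : A → ℤ) →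
  (∀ x → P x → P (ι x)) → (∀ x → ι (ι x) ≡ x) → (∀ x → w (ι x) ≡ - w x) → ∑ E w ≡ + 0
∑-antisymmetric E ι w into involutive odd = self-negative (begin
  ∑ E w  ≡⟨ reindex E E ι into
        (λ x y _ _ eq → trans (sym (involutive x)) (trans (cong ι eq) (involutive y)))
        (λ z p → ι z , into z p , involutive z) w ⟨
  ∑ E (w ∘ ι)  ≡⟨ ∑-cong E (λ x _ → trans (odd x) (sym (ℤP.-1*i≡-i (w x)))) ⟩
  ∑ E (λ x → -[1+ 0 ] * w x)  ≡⟨ ∑-* E -[1+ 0 ] w ⟩
  -[1+ 0 ] * ∑ E w  ≡⟨ ℤP.-1*i≡-i (∑ E w) ⟩
  - ∑ E w  ∎)
  where open ≡-Reasoning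

-- The value (-1)^m (2m+1) of Jacobi's series, where m ≥ 0 is 2l or -2l - 1: one index over all
-- integers absorbs the sign.
jacobiWeight : ℤ → ℤ
jacobiWeight l = + 4 * l + + 1

jacobiSeries : PowerSeries
jacobiSeries = coeff cubeFamily jacobiWeight

-- With x = 6k+1 and z = ±(4l+1), the sign chosen so that x ≡ z (mod 4), the pair (6g+3y+1, y) is
-- ((x+3z)/4, (z-x)/4): multiplication of (x + z√-3)/2 by a sixth root of unity.
rotate : ℤ × ℤ → ℤ × ℤ
rotate (k , l) = k , byParity (λ h → l - + 3 * h) (λ h → - l - + 3 * h - + 2) k

rotate-even : ∀ h l → rotate (h + h , l) ≡ (h + h , l - + 3 * h)
rotate-even h l = cong (h + h ,_) (byParity-even (λ h → l - + 3 * h) (λ h → - l - + 3 * h - + 2) h)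

rotate-odd : ∀ h l → rotate (+ 1 + (h + h) , l) ≡ (+ 1 + (h + h) , - l - + 3 * h - + 2)
rotate-odd h l = cong (+ 1 + (h + h) ,_) (byParity-odd (λ h → l - + 3 * h) (λ h → - l - + 3 * h - + 2) h)

-- For each parity of the first coordinate both a point and its image are polynomial, so claims
-- about them are left to the ring solver.
rotate-cases : (R : ℤ × ℤ → ℤ × ℤ → Set) →
  (∀ h l → R (h + h , l) (h + h , l - + 3 * h)) →
  (∀ h l → R (+ 1 + (h + h) , l) (+ 1 + (h + h) , - l - + 3 * h - + 2)) →
  ∀ z → R z (rotate z)
rotate-cases R even odd (k , l) = go (parity k)
  where
  go : Parity k → R (k , l) (rotate (k , l))
  go (inj₁ (h , refl)) = subst (R (h + h , l)) (sym (rotate-even h l)) (even h l)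
  go (inj₂ (h , refl)) = subst (R (+ 1 + (h + h) , l)) (sym (rotate-odd h l)) (odd h l)

-- X² + 3y² for X = 6g + 3y + 1, which parametrises the X ≡ 1 (mod 3) with X + y odd.
hexNorm : ℤ × ℤ → ℤ
hexNorm (g , y) = (+ 6 * g + + 3 * y + + 1) * (+ 6 * g + + 3 * y + + 1) + + 3 * (y * y)

HexPoint : ℕ → ℤ × ℤ → Set
HexPoint j z = hexNorm z ≡ + suc j

rotate-norm : ∀ z → hexNorm (rotate z) ≡ + 1 + exponent (pentagonal ⊗ cubeFamily) z
rotate-norm = rotate-cases (λ z w → hexNorm w ≡ + 1 + exponent (pentagonal ⊗ cubeFamily) z) even odd
  where
  even : ∀ h l → (+ 6 * (h + h) + + 3 * (l - + 3 * h) + + 1) * (+ 6 * (h + h) + + 3 * (l - + 3 * h) + + 1)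
    + + 3 * ((l - + 3 * h) * (l - + 3 * h))
    ≡ + 1 + ((+ 6 * ((h + h) * (h + h)) + + 3 * ((h + h) * (h + h) + (h + h)) + + 0) + (+ 6 * (l * l) + + 6 * (l * l + l) + + 0))
  even = solve-∀
  odd : ∀ h l → (+ 6 * (+ 1 + (h + h)) + + 3 * (- l - + 3 * h - + 2) + + 1) * (+ 6 * (+ 1 + (h + h)) + + 3 * (- l - + 3 * h - + 2) + + 1)
    + + 3 * ((- l - + 3 * h - + 2) * (- l - + 3 * h - + 2))
    ≡ + 1 + ((+ 6 * ((+ 1 + (h + h)) * (+ 1 + (h + h))) + + 3 * ((+ 1 + (h + h)) * (+ 1 + (h + h)) + (+ 1 + (h + h))) + + 0) + (+ 6 * (l * l) + + 6 * (l * l + l) + + 0))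
  odd = solve-∀

unrotate : ℤ × ℤ → ℤ × ℤ
unrotate (g , y) = g , byParity (λ h → y + + 3 * h) (λ h → - y - + 3 * h - + 2) g

unrotate-rotate : ∀ z → unrotate (rotate z) ≡ z
unrotate-rotate = rotate-cases (λ z w → unrotate w ≡ z)
  (λ h l → cong (h + h ,_) (trans (byParity-even _ _ h) (even h l)))
  (λ h l → cong (+ 1 + (h + h) ,_) (trans (byParity-odd _ _ h) (odd h l)))
  where
  even : ∀ h l → l - + 3 * h + + 3 * h ≡ l
  even = solve-∀
  odd : ∀ h l → - (- l - + 3 * h - + 2) - + 3 * h - + 2 ≡ l
  odd = solve-∀

rotate-unrotate : ∀ z → rotate (unrotate z) ≡ z
rotate-unrotate (g , y) = go (parity g)
  where
  even : ∀ h y → y + + 3 * h - + 3 * h ≡ y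
  even = solve-∀
  odd : ∀ h y → - (- y - + 3 * h - + 2) - + 3 * h - + 2 ≡ y
  odd = solve-∀
  go : Parity g → rotate (unrotate (g , y)) ≡ (g , y)
  go (inj₁ (h , refl)) = trans (cong (λ l → rotate (h + h , l)) (byParity-even _ _ h))
    (trans (rotate-even h (y + + 3 * h)) (cong (h + h ,_) (even h y)))
  go (inj₂ (h , refl)) = trans (cong (λ l → rotate (+ 1 + (h + h) , l)) (byParity-odd _ _ h))
    (trans (rotate-odd h (- y - + 3 * h - + 2)) (cong (+ 1 + (h + h) ,_) (odd h y)))

hexPoints : ∀ j → Enumeration (HexPoint j)
hexPoints j = image (level (pentagonal ⊗ cubeFamily) j) rotate
  (λ z (_ , eq) → trans (rotate-norm z) (cong (_+_ (+ 1)) eq))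
  (λ z w _ _ eq → trans (sym (unrotate-rotate z)) (trans (cong unrotate eq) (unrotate-rotate w)))
  (λ z p → unrotate z , ((tt , tt) , ℤRing.+-cancelˡ (+ 1) _ (+ j) (trans (sym (rotate-norm (unrotate z)))
    (trans (cong hexNorm (rotate-unrotate z)) p))) , rotate-unrotate z)

∑-hexPoints : ∀ j w → ∑ (hexPoints j) w ≡ coeff (pentagonal ⊗ cubeFamily) (w ∘ rotate) j
∑-hexPoints j w = Sum-map rotate (elements (level (pentagonal ⊗ cubeFamily) j)) w

-- The signed weight z = ±(4l+1) becomes X + y after the rotation, where X = 6g + 3y + 1.
euler⊛jacobi : ∀ j → (eulerSeries ⊛ jacobiSeries) j ≡ ∑ (hexPoints j) (λ (g , y) → + 6 * g + + 4 * y + + 1)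
euler⊛jacobi j = sym (trans (∑-hexPoints j _) (trans
  (coeff-cong (pentagonal ⊗ cubeFamily) weight j) (coeff-⊗ pentagonal cubeFamily sgn jacobiWeight j)))
  where
  even : ∀ h l → + 6 * (h + h) + + 4 * (l - + 3 * h) + + 1 ≡ + 1 * (+ 4 * l + + 1)
  even = solve-∀
  odd : ∀ h l → + 6 * (+ 1 + (h + h)) + + 4 * (- l - + 3 * h - + 2) + + 1 ≡ -[1+ 0 ] * (+ 4 * l + + 1)
  odd = solve-∀
  weight = rotate-cases (λ (k , l) (g , y) → + 6 * g + + 4 * y + + 1 ≡ sgn k * (+ 4 * l + + 1))
    (λ h l → trans (even h l) (cong (_* (+ 4 * l + + 1)) (sym (sgn-even h))))
    (λ h l → trans (odd h l) (cong (_* (+ 4 * l + + 1)) (sym (sgn-odd h))))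

-- Up to a constant, the imaginary part of the cube of a point of norm 4(j+1).
cubeWeight : ℤ × ℤ → ℤ
cubeWeight (g , y) = + 6 * y * ((+ 6 * g + + 3 * y + + 1) * (+ 6 * g + + 3 * y + + 1) - y * y)

-- Complex conjugation: (g , y) ↦ (g + y , -y) fixes X = 6g + 3y + 1 and negates y.
∑-cubeWeight : ∀ j → ∑ (hexPoints j) cubeWeight ≡ + 0
∑-cubeWeight j = ∑-antisymmetric (hexPoints j) (λ (g , y) → g + y , - y) cubeWeight
  (λ (g , y) p → trans (norm g y) p) (λ (g , y) → cong₂ _,_ (first g y) (ℤP.neg-involutive y))
  (λ (g , y) → negates g y)
  where
  norm : ∀ g y → (+ 6 * (g + y) + + 3 * (- y) + + 1) * (+ 6 * (g + y) + + 3 * (- y) + + 1) + + 3 * (- y * - y)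
    ≡ (+ 6 * g + + 3 * y + + 1) * (+ 6 * g + + 3 * y + + 1) + + 3 * (y * y)
  norm = solve-∀
  first : ∀ g y → g + y + - y ≡ g
  first = solve-∀
  negates : ∀ g y → + 6 * (- y) * ((+ 6 * (g + y) + + 3 * (- y) + + 1) * (+ 6 * (g + y) + + 3 * (- y) + + 1) - (- y) * (- y))
    ≡ - (+ 6 * y * ((+ 6 * g + + 3 * y + + 1) * (+ 6 * g + + 3 * y + + 1) - y * y))
  negates = solve-∀

-- The weights of the two sides differ by 3z(z² - x²)/4. The rotation gives z = X + y and x = X -
-- 3y, so this is 6y(X² - y²), whose sum vanishes by conjugation.
jacobi-equation : eulerSeries ⊛ D jacobiSeries ≈ + 3 · (jacobiSeries ⊛ D eulerSeries)
jacobi-equation j = begin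
  (eulerSeries ⊛ D jacobiSeries) j
    ≡⟨ trans (⊛-congʳ eulerSeries (D-coeff cubeFamily jacobiWeight) j)
         (sym (coeff-⊗ pentagonal cubeFamily sgn (λ l → exponent cubeFamily l * jacobiWeight l) j)) ⟩
  coeff F (λ (k , l) → sgn k * (exponent cubeFamily l * jacobiWeight l)) j
    ≡⟨ trans (coeff-cong F (λ z → weight z) j) (∑-+ (level F j) (cubeWeight ∘ rotate) (λ z → + 3 * v z)) ⟩
  coeff F (cubeWeight ∘ rotate) j + coeff F (λ z → + 3 * v z) j
    ≡⟨ cong₂ _+_ (trans (sym (∑-hexPoints j cubeWeight)) (∑-cubeWeight j)) (∑-* (level F j) (+ 3) v) ⟩
  + 0 + + 3 * coeff F v j
    ≡⟨ trans (ℤP.+-identityˡ _) (cong (_*_ (+ 3)) (trans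
         (coeff-⊗ pentagonal cubeFamily (λ k → exponent pentagonal k * sgn k) jacobiWeight j)
         (trans (⊛-comm _ jacobiSeries j) (sym (⊛-congʳ jacobiSeries (D-coeff pentagonal sgn) j))))) ⟩
  + 3 * (jacobiSeries ⊛ D eulerSeries) j ∎
  where
  open ≡-Reasoning
  F = pentagonal ⊗ cubeFamily
  v : ℤ × ℤ → ℤ
  v (k , l) = exponent pentagonal k * sgn k * jacobiWeight l
  even : ∀ h l → + 1 * ((+ 6 * (l * l) + + 6 * (l * l + l) + + 0) * (+ 4 * l + + 1)) ≡
    + 6 * (l - + 3 * h) * ((+ 6 * (h + h) + + 3 * (l - + 3 * h) + + 1) * (+ 6 * (h + h) + + 3 * (l - + 3 * h) + + 1)
      - (l - + 3 * h) * (l - + 3 * h))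
    + + 3 * ((+ 6 * ((h + h) * (h + h)) + + 3 * ((h + h) * (h + h) + (h + h)) + + 0) * + 1 * (+ 4 * l + + 1))
  even = solve-∀
  odd : ∀ h l → -[1+ 0 ] * ((+ 6 * (l * l) + + 6 * (l * l + l) + + 0) * (+ 4 * l + + 1)) ≡
    + 6 * (- l - + 3 * h - + 2) * ((+ 6 * (+ 1 + (h + h)) + + 3 * (- l - + 3 * h - + 2) + + 1) * (+ 6 * (+ 1 + (h + h)) + + 3 * (- l - + 3 * h - + 2) + + 1)
      - (- l - + 3 * h - + 2) * (- l - + 3 * h - + 2))
    + + 3 * ((+ 6 * ((+ 1 + (h + h)) * (+ 1 + (h + h))) + + 3 * ((+ 1 + (h + h)) * (+ 1 + (h + h)) + (+ 1 + (h + h))) + + 0) * -[1+ 0 ] * (+ 4 * l + + 1))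
  odd = solve-∀
  R : ℤ × ℤ → ℤ → ℤ × ℤ → Set
  R (k , l) s w = s * (exponent cubeFamily l * jacobiWeight l) ≡
    cubeWeight w + + 3 * (exponent pentagonal k * s * jacobiWeight l)
  weight = rotate-cases (λ z → R z (sgn (proj₁ z)))
    (λ h l → subst (λ s → R (h + h , l) s (h + h , l - + 3 * h)) (sym (sgn-even h)) (even h l))
    (λ h l → subst (λ s → R (+ 1 + (h + h) , l) s (+ 1 + (h + h) , - l - + 3 * h - + 2)) (sym (sgn-odd h)) (odd h l))

jacobi : eulerSeries ⊛ (eulerSeries ⊛ eulerSeries) ≈ jacobiSeries
jacobi = power-unique (+ 3) eulerSeries _ jacobiSeries refl refl (D-cube eulerSeries) jacobi-equation

a-hexPoints : ∀ j → a (suc j) ≡ ∑ (hexPoints j) (λ (g , y) → + 6 * g + + 4 * y + + 1)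
a-hexPoints j = trans (a-euler j) (trans (⊛-congʳ eulerSeries jacobi j) (euler⊛jacobi j))

-- Coefficients of η(6τ)⁴ as sums over x² + 3y²

NormPoint : ℕ → ℤ × ℤ → Set
NormPoint n (t , y) = (+ 3 * t + + 1) * (+ 3 * t + + 1) + + 3 * (y * y) ≡ + n

Odd : ℕ → Set
Odd n = ∃ λ h → + n ≡ + 1 + (h + h)

-- If X² + 3y² is odd then so is X + y. For odd n the parity condition built into the hexagonal
-- coordinates is therefore automatic, and the coordinates (t , y), which suit multiplication,
-- describe the same points.
normPoint-parity : ∀ {n} → Odd n → ∀ t y → NormPoint n (t , y) → ∃ λ g → t ≡ + 2 * g + y
normPoint-parity {n} (h , odd) t y p with parity (t - y)
... | inj₁ (g , eq) = g , trans (restore t y) (trans (cong (_+ y) eq) (double g y))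
  where
  restore : ∀ t y → t ≡ t - y + y
  restore = solve-∀
  double : ∀ g y → g + g + y ≡ + 2 * g + y
  double = solve-∀
... | inj₂ (s , eq) = ⊥-elim (even≢odd (half s y) h (trans (sym (even s y)) (trans (cong (λ t → (+ 3 * t + + 1) * (+ 3 * t + + 1) + + 3 * (y * y))
    (trans (cong (_+_ y) (sym eq)) (restore t y))) (trans p odd))))
  where
  restore : ∀ t y → y + (t - y) ≡ t
  restore = solve-∀
  half : ℤ → ℤ → ℤ
  half s y = + 6 * (y * y) + + 3 * y * (+ 4 + + 6 * s) + (+ 4 + + 6 * s) * (+ 2 + + 3 * s)
  even : ∀ s y → (+ 3 * (y + (+ 1 + (s + s))) + + 1) * (+ 3 * (y + (+ 1 + (s + s))) + + 1) + + 3 * (y * y) ≡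
    (+ 6 * (y * y) + + 3 * y * (+ 4 + + 6 * s) + (+ 4 + + 6 * s) * (+ 2 + + 3 * s)) +
    (+ 6 * (y * y) + + 3 * y * (+ 4 + + 6 * s) + (+ 4 + + 6 * s) * (+ 2 + + 3 * s))
  even = solve-∀

normPoints : ∀ j → Odd (suc j) → Enumeration (NormPoint (suc j))
normPoints j odd = image (hexPoints j) hexToNorm
  (λ (g , y) p → trans (norm g y) p)
  (λ (g , y) (g′ , y′) _ _ eq → injective g g′ (cong proj₂ eq) (cong proj₁ eq))
  (λ (t , y) p → onto t y p (normPoint-parity odd t y p))
  where
  hexToNorm : ℤ × ℤ → ℤ × ℤ
  hexToNorm (g , y) = + 2 * g + y , y
  norm : ∀ g y → (+ 3 * (+ 2 * g + y) + + 1) * (+ 3 * (+ 2 * g + y) + + 1) + + 3 * (y * y) ≡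
    (+ 6 * g + + 3 * y + + 1) * (+ 6 * g + + 3 * y + + 1) + + 3 * (y * y)
  norm = solve-∀
  injective : ∀ g g′ {y y′} → y ≡ y′ → + 2 * g + y ≡ + 2 * g′ + y′ → (g , y) ≡ (g′ , y′)
  injective g g′ {y} refl eq = cong (_, y) (ℤP.*-cancelˡ-≡ (+ 2) g g′ (ℤRing.+-cancelʳ y _ _ eq))
  onto : ∀ t y → NormPoint (suc j) (t , y) → (∃ λ g → t ≡ + 2 * g + y) →
    ∃ λ z → HexPoint j z × hexToNorm z ≡ (t , y)
  onto t y p (g , refl) = (g , y) , trans (sym (norm g y)) p , refl

∑-second : ∀ {n} (E : Enumeration (NormPoint n)) → ∑ E proj₂ ≡ + 0
∑-second E = ∑-antisymmetric E (λ (t , y) → t , - y) proj₂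
  (λ (t , y) p → trans (norm t y) p) (λ (t , y) → cong (t ,_) (ℤP.neg-involutive y)) (λ _ → refl)
  where
  norm : ∀ t y → (+ 3 * t + + 1) * (+ 3 * t + + 1) + + 3 * (- y * - y) ≡ (+ 3 * t + + 1) * (+ 3 * t + + 1) + + 3 * (y * y)
  norm = solve-∀

a-normPoints : ∀ j (odd : Odd (suc j)) → a (suc j) ≡ ∑ (normPoints j odd) (λ (t , y) → + 3 * t + + 1)
a-normPoints j odd = begin
  a (suc j)
    ≡⟨ a-hexPoints j ⟩
  ∑ (hexPoints j) (λ (g , y) → + 6 * g + + 4 * y + + 1)
    ≡⟨ ∑-cong (hexPoints j) (λ (g , y) _ → rewriteWeight g y) ⟩
  ∑ (hexPoints j) (λ (g , y) → + 3 * (+ 2 * g + y) + + 1 + y)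
    ≡⟨ Sum-map _ (elements (hexPoints j)) (λ (t , y) → + 3 * t + + 1 + y) ⟨
  ∑ (normPoints j odd) (λ (t , y) → + 3 * t + + 1 + y)
    ≡⟨ ∑-+ (normPoints j odd) (λ (t , y) → + 3 * t + + 1) proj₂ ⟩
  ∑ (normPoints j odd) (λ (t , y) → + 3 * t + + 1) + ∑ (normPoints j odd) proj₂
    ≡⟨ cong (_+_ (∑ (normPoints j odd) (λ (t , y) → + 3 * t + + 1))) (∑-second (normPoints j odd)) ⟩
  ∑ (normPoints j odd) (λ (t , y) → + 3 * t + + 1) + + 0
    ≡⟨ ℤP.+-identityʳ _ ⟩
  ∑ (normPoints j odd) (λ (t , y) → + 3 * t + + 1) ∎
  where
  open ≡-Reasoning
  rewriteWeight : ∀ g y → + 6 * g + + 4 * y + + 1 ≡ + 3 * (+ 2 * g + y) + + 1 + y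
  rewriteWeight = solve-∀

-- Eisenstein integers

rounding : ∀ u d .{{_ : ℕ.NonZero d}} → ∃₂ λ k r → u ≡ r + k * + d × 2 ℕ.* ∣ r ∣ ℕ.≤ d
rounding u d with 2 ℕ.* (u %ℕ d) ℕP.≤? d
... | yes small = u /ℕ d , + (u %ℕ d) , a≡a%ℕn+[a/ℕn]*n u d , small
... | no large = + 1 + u /ℕ d , + (u %ℕ d) - + d ,
    trans (a≡a%ℕn+[a/ℕn]*n u d) (carry (+ (u %ℕ d)) (u /ℕ d) (+ d)) , bound
  where
  carry : ∀ r q d → r + q * d ≡ r - d + (+ 1 + q) * d
  carry = solve-∀
  open ℕP.≤-Reasoning
  ρ = u %ℕ d
  bound : 2 ℕ.* ∣ + ρ - + d ∣ ℕ.≤ d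
  bound = begin
    2 ℕ.* ∣ + ρ - + d ∣  ≡⟨ cong (λ i → 2 ℕ.* ∣ i ∣) (ℤP.m-n≡m⊖n ρ d) ⟩
    2 ℕ.* ∣ ρ ℤ.⊖ d ∣  ≡⟨ cong (2 ℕ.*_) (ℤP.∣⊖∣-≤ (ℕP.<⇒≤ (n%ℕd<d u d))) ⟩
    2 ℕ.* (d ℕ.∸ ρ)  ≡⟨ ℕP.*-distribˡ-∸ 2 d ρ ⟩
    2 ℕ.* d ℕ.∸ 2 ℕ.* ρ  ≤⟨ ℕP.m≤n+o⇒m∸n≤o (2 ℕ.* d) (2 ℕ.* ρ) (begin
      2 ℕ.* d  ≡⟨ cong (d ℕ.+_) (ℕP.+-identityʳ d) ⟩
      d ℕ.+ d  ≤⟨ ℕP.+-monoˡ-≤ d (ℕP.<⇒≤ (ℕP.≰⇒> large)) ⟩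
      2 ℕ.* ρ ℕ.+ d  ∎) ⟩
    d  ∎

-- The Eisenstein integer p + qω, where ω² + ω + 1 = 0, is the pair (p , q).
infixl 7 _∙_
_∙_ : ℤ × ℤ → ℤ × ℤ → ℤ × ℤ
(p , q) ∙ (r , s) = p * r - q * s , p * s + q * r - q * s

infixl 6 _∔_
_∔_ : ℤ × ℤ → ℤ × ℤ → ℤ × ℤ
(p , q) ∔ (r , s) = p + r , q + s

neg : ℤ × ℤ → ℤ × ℤ
neg (p , q) = - p , - q

𝟎 𝟏 : ℤ × ℤ
𝟎 = + 0 , + 0
𝟏 = + 1 , + 0

∙-comm : ∀ x y → x ∙ y ≡ y ∙ x
∙-comm (p , q) (r , s) = cong₂ _,_ (first p q r s) (second p q r s)
  where
  first : ∀ p q r s → p * r - q * s ≡ r * p - s * q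
  first = solve-∀
  second : ∀ p q r s → p * s + q * r - q * s ≡ r * q + s * p - s * q
  second = solve-∀

∙-assoc : ∀ x y z → (x ∙ y) ∙ z ≡ x ∙ (y ∙ z)
∙-assoc (p , q) (r , s) (t , u) = cong₂ _,_ (first p q r s t u) (second p q r s t u)
  where
  first : ∀ p q r s t u → (p * r - q * s) * t - (p * s + q * r - q * s) * u ≡
    p * (r * t - s * u) - q * (r * u + s * t - s * u)
  first = solve-∀
  second : ∀ p q r s t u → (p * r - q * s) * u + (p * s + q * r - q * s) * t - (p * s + q * r - q * s) * u ≡
    p * (r * u + s * t - s * u) + q * (r * t - s * u) - q * (r * u + s * t - s * u)
  second = solve-∀

∙-distribʳ : ∀ x y z → (y ∔ z) ∙ x ≡ y ∙ x ∔ z ∙ x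
∙-distribʳ (p , q) (r , s) (t , u) = cong₂ _,_ (first p q r s t u) (second p q r s t u)
  where
  first : ∀ p q r s t u → (r + t) * p - (s + u) * q ≡ r * p - s * q + (t * p - u * q)
  first = solve-∀
  second : ∀ p q r s t u → (r + t) * q + (s + u) * p - (s + u) * q ≡ r * q + s * p - s * q + (t * q + u * p - u * q)
  second = solve-∀

∙-identityˡ : ∀ x → 𝟏 ∙ x ≡ x
∙-identityˡ (p , q) = cong₂ _,_ (first p q) (second p q)
  where
  first : ∀ p q → + 1 * p - + 0 * q ≡ p
  first = solve-∀
  second : ∀ p q → + 1 * q + + 0 * p - + 0 * q ≡ q
  second = solve-∀

∙-distribˡ : ∀ x y z → x ∙ (y ∔ z) ≡ x ∙ y ∔ x ∙ z
∙-distribˡ x y z = trans (∙-comm x (y ∔ z)) (trans (∙-distribʳ x y z) (cong₂ _∔_ (∙-comm y x) (∙-comm z x)))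

∙-zeroʳ : ∀ x → x ∙ 𝟎 ≡ 𝟎
∙-zeroʳ (p , q) = cong₂ _,_ (first p q) (second p q)
  where
  first : ∀ p q → p * + 0 - q * + 0 ≡ + 0
  first = solve-∀
  second : ∀ p q → p * + 0 + q * + 0 - q * + 0 ≡ + 0
  second = solve-∀

neg-∙ : ∀ x y → neg x ∙ y ≡ neg (x ∙ y)
neg-∙ (p , q) (r , s) = cong₂ _,_ (first p q r s) (second p q r s)
  where
  first : ∀ p q r s → - p * r - - q * s ≡ - (p * r - q * s)
  first = solve-∀
  second : ∀ p q r s → - p * s + - q * r - - q * s ≡ - (p * s + q * r - q * s)
  second = solve-∀

N : ℤ × ℤ → ℤ
N (p , q) = p * p - p * q + q * q

N-∙ : ∀ x y → N (x ∙ y) ≡ N x * N y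
N-∙ (p , q) (r , s) = identity p q r s
  where
  identity : ∀ p q r s → (p * r - q * s) * (p * r - q * s) - (p * r - q * s) * (p * s + q * r - q * s)
    + (p * s + q * r - q * s) * (p * s + q * r - q * s) ≡ (p * p - p * q + q * q) * (r * r - r * s + s * s)
  identity = solve-∀

-- Completing the square makes the norm visibly positive definite.
4N : ∀ x → + 4 * N x ≡ + (∣ + 2 * proj₁ x - proj₂ x ∣ ℕ.* ∣ + 2 * proj₁ x - proj₂ x ∣ ℕ.+ 3 ℕ.* (∣ proj₂ x ∣ ℕ.* ∣ proj₂ x ∣))
4N (p , q) = trans (identity p q) (cong₂ _+_ (+square (+ 2 * p - q))
  (trans (cong (_*_ (+ 3)) (+square q)) (sym (ℤP.pos-* 3 (∣ q ∣ ℕ.* ∣ q ∣)))))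
  where
  identity : ∀ p q → + 4 * (p * p - p * q + q * q) ≡ (+ 2 * p - q) * (+ 2 * p - q) + + 3 * (q * q)
  identity = solve-∀

N-nonneg : ∀ x → N x ≡ + ∣ N x ∣
N-nonneg x with N x | 4N x
... | + n | _ = refl

N-zero : ∀ x → ∣ N x ∣ ≡ 0 → x ≡ (+ 0 , + 0)
N-zero x@(p , q) eq = cong₂ _,_ p≡0 q≡0
  where
  open ≡-Reasoning
  sum≡0 : ∣ + 2 * p - q ∣ ℕ.* ∣ + 2 * p - q ∣ ℕ.+ 3 ℕ.* (∣ q ∣ ℕ.* ∣ q ∣) ≡ 0
  sum≡0 = ℤP.+-injective (trans (sym (4N x)) (cong (_*_ (+ 4)) (ℤP.∣i∣≡0⇒i≡0 eq)))
  square≡0 : ∀ i → ∣ i ∣ ℕ.* ∣ i ∣ ≡ 0 → i ≡ + 0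
  square≡0 i eq = ℤP.∣i∣≡0⇒i≡0 ([ id , id ]′ (ℕP.m*n≡0⇒m≡0∨n≡0 ∣ i ∣ eq))
  q≡0 : q ≡ + 0
  q≡0 = square≡0 q ([ (λ ()) , id ]′ (ℕP.m*n≡0⇒m≡0∨n≡0 3 (ℕP.m+n≡0⇒n≡0 (∣ + 2 * p - q ∣ ℕ.* ∣ + 2 * p - q ∣) sum≡0)))
  p≡0 : p ≡ + 0
  p≡0 = ℤP.*-cancelˡ-≡ (+ 2) p (+ 0) (begin
    + 2 * p  ≡⟨ ℤP.+-identityʳ (+ 2 * p) ⟨
    + 2 * p - + 0  ≡⟨ cong (λ q → + 2 * p - q) q≡0 ⟨
    + 2 * p - q  ≡⟨ square≡0 (+ 2 * p - q) (ℕP.m+n≡0⇒m≡0 _ sum≡0) ⟩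
    + 0  ∎)

-- Rounding errors of at most 1/2 in each coordinate have norm at most 1/4 + 1/4 + 1/4 < 1, which is
-- why these integers are Euclidean.
norm-bound : ∀ r s n → 2 ℕ.* ∣ r ∣ ℕ.≤ n → 2 ℕ.* ∣ s ∣ ℕ.≤ n → 4 ℕ.* ∣ N (r , s) ∣ ℕ.≤ 3 ℕ.* (n ℕ.* n)
norm-bound r s n r≤ s≤ = begin
  4 ℕ.* ∣ r * r - r * s + s * s ∣
    ≤⟨ ℕP.*-monoʳ-≤ 4 (ℕP.≤-trans (ℤP.∣i+j∣≤∣i∣+∣j∣ (r * r - r * s) (s * s))
         (ℕP.+-monoˡ-≤ ∣ s * s ∣ (ℤP.∣i-j∣≤∣i∣+∣j∣ (r * r) (r * s)))) ⟩
  4 ℕ.* (∣ r * r ∣ ℕ.+ ∣ r * s ∣ ℕ.+ ∣ s * s ∣)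
    ≡⟨ cong (4 ℕ.*_) (cong₂ ℕ._+_ (cong₂ ℕ._+_ (ℤP.abs-* r r) (ℤP.abs-* r s)) (ℤP.abs-* s s)) ⟩
  4 ℕ.* (∣ r ∣ ℕ.* ∣ r ∣ ℕ.+ ∣ r ∣ ℕ.* ∣ s ∣ ℕ.+ ∣ s ∣ ℕ.* ∣ s ∣)
    ≡⟨ distribute ∣ r ∣ ∣ s ∣ ⟩
  2 ℕ.* ∣ r ∣ ℕ.* (2 ℕ.* ∣ r ∣) ℕ.+ 2 ℕ.* ∣ r ∣ ℕ.* (2 ℕ.* ∣ s ∣) ℕ.+ 2 ℕ.* ∣ s ∣ ℕ.* (2 ℕ.* ∣ s ∣)
    ≤⟨ ℕP.+-mono-≤ (ℕP.+-mono-≤ (ℕP.*-mono-≤ r≤ r≤) (ℕP.*-mono-≤ r≤ s≤)) (ℕP.*-mono-≤ s≤ s≤) ⟩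
  n ℕ.* n ℕ.+ n ℕ.* n ℕ.+ n ℕ.* n
    ≡⟨ collect (n ℕ.* n) ⟩
  3 ℕ.* (n ℕ.* n) ∎
  where
  open ℕP.≤-Reasoning
  distribute : ∀ A B → 4 ℕ.* (A ℕ.* A ℕ.+ A ℕ.* B ℕ.+ B ℕ.* B) ≡
    2 ℕ.* A ℕ.* (2 ℕ.* A) ℕ.+ 2 ℕ.* A ℕ.* (2 ℕ.* B) ℕ.+ 2 ℕ.* B ℕ.* (2 ℕ.* B)
  distribute = ℕ-solve-∀
  collect : ∀ x → x ℕ.+ x ℕ.+ x ≡ 3 ℕ.* x
  collect = ℕ-solve-∀

conj : ℤ × ℤ → ℤ × ℤ
conj (p , q) = p - q , - q

N-conj : ∀ x → N (conj x) ≡ N x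
N-conj (p , q) = identity p q
  where
  identity : ∀ p q → (p - q) * (p - q) - (p - q) * - q + - q * - q ≡ p * p - p * q + q * q
  identity = solve-∀

∙-conj : ∀ x → x ∙ conj x ≡ (N x , + 0)
∙-conj (p , q) = cong₂ _,_ (first p q) (second p q)
  where
  first : ∀ p q → p * (p - q) - q * - q ≡ p * p - p * q + q * q
  first = solve-∀
  second : ∀ p q → p * - q + q * (p - q) - q * - q ≡ + 0
  second = solve-∀

-- k is the quotient x / y = x ȳ / N y rounded in both coordinates.
remainder : ∀ x y → ∣ N y ∣ ≢ 0 → ∃₂ λ k r → x ≡ r ∔ k ∙ y × ∣ N r ∣ ℕ.< ∣ N y ∣
remainder x y Ny≢0 = division (rounding (proj₁ (x ∙ conj y)) n) (rounding (proj₂ (x ∙ conj y)) n)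
  where
  open ≡-Reasoning
  n = ∣ N y ∣
  instance
    n≢0 : ℕ.NonZero n
    n≢0 = ℕ.≢-nonZero Ny≢0
  division : (∃₂ λ k r → proj₁ (x ∙ conj y) ≡ r + k * + n × 2 ℕ.* ∣ r ∣ ℕ.≤ n) →
    (∃₂ λ k r → proj₂ (x ∙ conj y) ≡ r + k * + n × 2 ℕ.* ∣ r ∣ ℕ.≤ n) →
    ∃₂ λ k r → x ≡ r ∔ k ∙ y × ∣ N r ∣ ℕ.< ∣ N y ∣
  division (k₁ , r₁ , eq₁ , small₁) (k₂ , r₂ , eq₂ , small₂) = k , ρ , restore x (k ∙ y) ,
    -- Since ρ ȳ = (r₁ , r₂), one has 4 N(ρ) n ≤ 3 n² < 4 n², and 4 and n cancel.
    ℕP.*-cancelʳ-< n ∣ N ρ ∣ n (ℕP.*-cancelˡ-< 4 (∣ N ρ ∣ ℕ.* n) (n ℕ.* n) (ℕP.≤-<-trans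
      (subst (λ i → 4 ℕ.* i ℕ.≤ 3 ℕ.* (n ℕ.* n)) (sym norm) (norm-bound r₁ r₂ n small₁ small₂))
      (ℕP.*-monoˡ-< (n ℕ.* n) {{ℕP.m*n≢0 n n}} (ℕP.n<1+n 3))))
    where
    k = k₁ , k₂
    ρ = x ∔ neg (k ∙ y)
    restore : ∀ x z → x ≡ x ∔ neg z ∔ z
    restore (p , q) (r , s) = cong₂ _,_ (component p r) (component q s)
      where
      component : ∀ a b → a ≡ a + - b + b
      component = solve-∀
    subtract : ∀ r z → r + z + - z ≡ r
    subtract = solve-∀
    scalar : ∀ k e → k ∙ (e , + 0) ≡ (proj₁ k * e , proj₂ k * e)
    scalar (k , l) e = cong₂ _,_ (first k l e) (second k l e)
      where
      first : ∀ k l e → k * e - l * + 0 ≡ k * e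
      first = solve-∀
      second : ∀ k l e → k * + 0 + l * e - l * + 0 ≡ l * e
      second = solve-∀
    reduced : ρ ∙ conj y ≡ (r₁ , r₂)
    reduced = begin
      ρ ∙ conj y  ≡⟨ ∙-distribʳ (conj y) x (neg (k ∙ y)) ⟩
      x ∙ conj y ∔ neg (k ∙ y) ∙ conj y  ≡⟨ cong (x ∙ conj y ∔_) (trans (neg-∙ (k ∙ y) (conj y)) (cong neg (trans (∙-assoc k y (conj y))
        (trans (cong (k ∙_) (trans (∙-conj y) (cong (_, + 0) (N-nonneg y)))) (scalar k (+ n)))))) ⟩
      x ∙ conj y ∔ (- (k₁ * + n) , - (k₂ * + n))  ≡⟨ cong₂ (λ i j → i + - (k₁ * + n) , j + - (k₂ * + n)) eq₁ eq₂ ⟩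
      r₁ + k₁ * + n + - (k₁ * + n) , r₂ + k₂ * + n + - (k₂ * + n)
        ≡⟨ cong₂ _,_ (subtract r₁ (k₁ * + n)) (subtract r₂ (k₂ * + n)) ⟩
      (r₁ , r₂)  ∎
    norm : ∣ N ρ ∣ ℕ.* n ≡ ∣ N (r₁ , r₂) ∣
    norm = begin
      ∣ N ρ ∣ ℕ.* ∣ N y ∣  ≡⟨ ℤP.abs-* (N ρ) (N y) ⟨
      ∣ N ρ * N y ∣  ≡⟨ cong (λ i → ∣ N ρ * i ∣) (N-conj y) ⟨
      ∣ N ρ * N (conj y) ∣  ≡⟨ cong ∣_∣ (trans (sym (N-∙ ρ (conj y))) (cong N reduced)) ⟩
      ∣ N (r₁ , r₂) ∣  ∎

-- ℤ[√-3] is not Euclidean, so common divisors are taken in ℤ[ω] and brought back into ℤ[√-3] by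
-- units.
IsGcd : ℤ × ℤ → ℤ × ℤ → ℤ × ℤ → Set
IsGcd x y δ = (∃₂ λ s t → δ ≡ s ∙ x ∔ t ∙ y) × (∃ λ c → x ≡ δ ∙ c) × (∃ λ c → y ≡ δ ∙ c)

gcd-zero : ∀ x y → ∣ N y ∣ ≡ 0 → ∃ (IsGcd x y)
gcd-zero x y Ny≡0 =
  x , (𝟏 , 𝟎 , sym (trans (cong (_∔ 𝟎 ∙ y) (∙-identityˡ x)) (trans (cong (x ∔_) (trans (∙-comm 𝟎 y) (∙-zeroʳ y))) (∔-identityʳ x)))) ,
  (𝟏 , sym (trans (∙-comm x 𝟏) (∙-identityˡ x))) , (𝟎 , trans (N-zero y Ny≡0) (sym (∙-zeroʳ x)))
  where
  ∔-identityʳ : ∀ x → x ∔ 𝟎 ≡ x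
  ∔-identityʳ (p , q) = cong₂ _,_ (ℤP.+-identityʳ p) (ℤP.+-identityʳ q)

gcd-step : ∀ y r k → ∃ (IsGcd y r) → ∃ (IsGcd (r ∔ k ∙ y) y)
gcd-step y r k (δ , (s , t , δ≡) , (c , y≡) , (e , r≡)) =
  δ , (t , s ∔ neg (t ∙ k) , trans δ≡ combine) , (e ∔ k ∙ c , factor) , (c , y≡)
  where
  open ≡-Reasoning
  exchange : ∀ a b c → a ∔ b ≡ b ∔ c ∔ (a ∔ neg c)
  exchange (p , q) (r , s) (t , u) = cong₂ _,_ (component p r t) (component q s u)
    where
    component : ∀ a b c → a + b ≡ b + c + (a + - c)
    component = solve-∀
  combine : s ∙ y ∔ t ∙ r ≡ t ∙ (r ∔ k ∙ y) ∔ (s ∔ neg (t ∙ k)) ∙ y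
  combine = begin
    s ∙ y ∔ t ∙ r  ≡⟨ exchange (s ∙ y) (t ∙ r) ((t ∙ k) ∙ y) ⟩
    t ∙ r ∔ (t ∙ k) ∙ y ∔ (s ∙ y ∔ neg ((t ∙ k) ∙ y))  ≡⟨ cong₂ (λ i j → t ∙ r ∔ i ∔ (s ∙ y ∔ j)) (∙-assoc t k y) (sym (neg-∙ (t ∙ k) y)) ⟩
    t ∙ r ∔ t ∙ (k ∙ y) ∔ (s ∙ y ∔ neg (t ∙ k) ∙ y)  ≡⟨ cong₂ _∔_ (∙-distribˡ t r (k ∙ y)) (∙-distribʳ y s (neg (t ∙ k))) ⟨
    t ∙ (r ∔ k ∙ y) ∔ (s ∔ neg (t ∙ k)) ∙ y  ∎
  factor : r ∔ k ∙ y ≡ δ ∙ (e ∔ k ∙ c)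
  factor = begin
    r ∔ k ∙ y  ≡⟨ cong₂ (λ r y → r ∔ k ∙ y) r≡ y≡ ⟩
    δ ∙ e ∔ k ∙ (δ ∙ c)  ≡⟨ cong (δ ∙ e ∔_) (trans (sym (∙-assoc k δ c)) (trans (cong (_∙ c) (∙-comm k δ)) (∙-assoc δ k c))) ⟩
    δ ∙ e ∔ δ ∙ (k ∙ c)  ≡⟨ ∙-distribˡ δ e (k ∙ c) ⟨
    δ ∙ (e ∔ k ∙ c)  ∎

gcd-exists : ∀ x y → ∃ (IsGcd x y)
gcd-exists x y = euclid x y (<-wellFounded ∣ N y ∣)
  where
  euclid : ∀ x y → Acc ℕ._<_ ∣ N y ∣ → ∃ (IsGcd x y)
  euclid x y (acc rs) with ∣ N y ∣ ℕP.≟ 0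
  ... | yes Ny≡0 = gcd-zero x y Ny≡0
  ... | no Ny≢0 = let k , r , x≡ , Nr<Ny = remainder x y Ny≢0 in
    subst (λ x → ∃ (IsGcd x y)) (sym x≡) (gcd-step y r k (euclid y r (rs Nr<Ny)))

-- Factorisation along coprime norms

bezout : ∀ {m n} → Coprime m n → ∃₂ λ x y → x * + m + y * + n ≡ + 1
bezout {m} {n} c with coprime-Bézout c
... | Bézout.+- x y eq = + x , - + y , (begin
  + x * + m + - + y * + n  ≡⟨ cong (_+ (- + y * + n)) (trans (sym (ℤP.pos-* x m)) (trans (cong +_ (sym eq)) (cong (_+_ (+ 1)) (ℤP.pos-* y n)))) ⟩
  + 1 + + y * + n + - + y * + n  ≡⟨ cancel (+ y) (+ n) ⟩
  + 1  ∎)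
  where
  open ≡-Reasoning
  cancel : ∀ y n → + 1 + y * n + - y * n ≡ + 1
  cancel = solve-∀
... | Bézout.-+ x y eq = - + x , + y , (begin
  - + x * + m + + y * + n  ≡⟨ cong (_+_ (- + x * + m)) (trans (sym (ℤP.pos-* y n)) (trans (cong +_ (sym eq)) (cong (_+_ (+ 1)) (ℤP.pos-* x m)))) ⟩
  - + x * + m + (+ 1 + + x * + m)  ≡⟨ cancel (+ x) (+ m) ⟩
  + 1  ∎)
  where
  open ≡-Reasoning
  cancel : ∀ x m → - x * m + (+ 1 + x * m) ≡ + 1
  cancel = solve-∀

-- δ is the gcd of x and m: its norm divides gcd(m n , m²) = m, and m divides it.
divisor-of-norm : ∀ m n → Coprime m n → ∀ x → N x ≡ + m * + n → ∃₂ λ δ κ → N δ ≡ + m × x ≡ δ ∙ κ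
divisor-of-norm m n coprime x Nx = by (gcd-exists x (+ m , + 0)) (bezout coprime)
  where
  by : ∃ (IsGcd x (+ m , + 0)) → (∃₂ λ u v → u * + m + v * + n ≡ + 1) → ∃₂ λ δ κ → N δ ≡ + m × x ≡ δ ∙ κ
  by (δ , (s , t , δ≡) , (κ , x≡) , (μ , m≡)) (u , v , uv) = δ , κ , norm , x≡
    where
    open ≡-Reasoning
    p = proj₁ (s ∙ x)
    q = proj₂ (s ∙ x)
    t₁ = proj₁ t
    t₂ = proj₂ t
    -- N(s x + t m) = N(s x) + m e: the cross terms and N(t m), with m taken out.
    e = + 2 * p * t₁ - p * t₂ - q * t₁ + + 2 * q * t₂ + + m * N t
    c = N s * + n + e
    expand : ∀ p q t₁ t₂ m → (p + (t₁ * m - t₂ * + 0)) * (p + (t₁ * m - t₂ * + 0))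
      - (p + (t₁ * m - t₂ * + 0)) * (q + (t₁ * + 0 + t₂ * m - t₂ * + 0))
      + (q + (t₁ * + 0 + t₂ * m - t₂ * + 0)) * (q + (t₁ * + 0 + t₂ * m - t₂ * + 0)) ≡
      (p * p - p * q + q * q) + m * (+ 2 * p * t₁ - p * t₂ - q * t₁ + + 2 * q * t₂ + m * (t₁ * t₁ - t₁ * t₂ + t₂ * t₂))
    expand = solve-∀
    collect : ∀ s m n r → s * (m * n) + m * r ≡ m * (s * n + r)
    collect = solve-∀
    Nδ≡mc : N δ ≡ + m * c
    Nδ≡mc = begin
      N δ  ≡⟨ trans (cong N δ≡) (expand p q t₁ t₂ (+ m)) ⟩
      N (s ∙ x) + + m * e  ≡⟨ cong (_+ (+ m * e)) (trans (N-∙ s x) (cong (_*_ (N s)) Nx)) ⟩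
      N s * (+ m * + n) + + m * e  ≡⟨ collect (N s) (+ m) (+ n) e ⟩
      + m * c  ∎
    -- m = u m² + v m n = u N(m) + v N(x), and N δ divides both norms.
    d = u * N μ + v * N κ
    square : ∀ m → m * m - m * + 0 + + 0 * + 0 ≡ m * m
    square = solve-∀
    spread : ∀ u v m n → (u * m + v * n) * m ≡ u * (m * m) + v * (m * n)
    spread = solve-∀
    gather : ∀ e u v x y → u * (e * x) + v * (e * y) ≡ e * (u * x + v * y)
    gather = solve-∀
    m≡Nδd : + m ≡ N δ * d
    m≡Nδd = begin
      + m  ≡⟨ trans (cong (_* + m) uv) (ℤP.*-identityˡ (+ m)) ⟨
      (u * + m + v * + n) * + m  ≡⟨ spread u v (+ m) (+ n) ⟩
      u * (+ m * + m) + v * (+ m * + n)  ≡⟨ cong₂ (λ i j → u * i + v * j)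
        (trans (sym (square (+ m))) (trans (cong N m≡) (N-∙ δ μ))) (trans (sym Nx) (trans (cong N x≡) (N-∙ δ κ))) ⟩
      u * (N δ * N μ) + v * (N δ * N κ)  ≡⟨ gather (N δ) u v (N μ) (N κ) ⟩
      N δ * d  ∎
    norm : N δ ≡ + m
    norm = trans (N-nonneg δ) (cong +_ (∣-antisym
      (divides ∣ d ∣ (trans (cong ∣_∣ m≡Nδd) (trans (ℤP.abs-* (N δ) d) (ℕP.*-comm ∣ N δ ∣ ∣ d ∣))))
      (divides ∣ c ∣ (trans (cong ∣_∣ Nδ≡mc) (trans (ℤP.abs-* (+ m) c) (ℕP.*-comm m ∣ c ∣))))))

-- Residues are taken up to sign because the unit -1 is what normalises a real part to 1 modulo 3.
Thirds : ℤ → Set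
Thirds x = (∃ λ t → x ≡ + 3 * t) ⊎ (∃ λ t → x ≡ + 3 * t + + 1) ⊎ (∃ λ t → x ≡ - (+ 3 * t + + 1))

thirds : ∀ x → Thirds x
thirds x with x %ℕ 3 | a≡a%ℕn+[a/ℕn]*n x 3 | n%ℕd<d x 3
... | 0 | eq | _ = inj₁ (x /ℕ 3 , trans eq (shape (x /ℕ 3)))
  where
  shape : ∀ q → + 0 + q * + 3 ≡ + 3 * q
  shape = solve-∀
... | 1 | eq | _ = inj₂ (inj₁ (x /ℕ 3 , trans eq (shape (x /ℕ 3))))
  where
  shape : ∀ q → + 1 + q * + 3 ≡ + 3 * q + + 1
  shape = solve-∀
... | 2 | eq | _ = inj₂ (inj₂ (- (x /ℕ 3) - + 1 , trans eq (shape (x /ℕ 3))))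
  where
  shape : ∀ q → + 2 + q * + 3 ≡ - (+ 3 * (- q - + 1) + + 1)
  shape = solve-∀
... | suc (suc (suc _)) | _ | s≤s (s≤s (s≤s ()))

-- One of δ, ωδ, ω²δ lies in ℤ[√-3].
even-associate : ∀ δ κ → ∃₂ λ δ′ κ′ → (∃ λ h → proj₂ δ′ ≡ h + h) × N δ′ ≡ N δ × δ′ ∙ κ′ ≡ δ ∙ κ
even-associate δ@(p , q) κ@(r , s) = by (parity p) (parity q)
  where
  f₁ : ∀ p q → (q - p) * (q - p) - (q - p) * - p + - p * - p ≡ p * p - p * q + q * q
  f₁ = solve-∀
  f₂ : ∀ p q r s → (q - p) * - s - - p * (r - s) ≡ p * r - q * s
  f₂ = solve-∀
  f₃ : ∀ p q r s → (q - p) * (r - s) + - p * - s - - p * (r - s) ≡ p * s + q * r - q * s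
  f₃ = solve-∀
  g₁ : ∀ p q → - q * - q - - q * (p - q) + (p - q) * (p - q) ≡ p * p - p * q + q * q
  g₁ = solve-∀
  g₂ : ∀ p q r s → - q * (s - r) - (p - q) * - r ≡ p * r - q * s
  g₂ = solve-∀
  g₃ : ∀ p q r s → - q * - r + (p - q) * (s - r) - (p - q) * - r ≡ p * s + q * r - q * s
  g₃ = solve-∀
  negated : ∀ g → - (g + g) ≡ - g + - g
  negated = solve-∀
  difference : ∀ g h → + 1 + (g + g) - (+ 1 + (h + h)) ≡ (g - h) + (g - h)
  difference = solve-∀
  by : Parity p → Parity q →
    ∃₂ λ δ′ κ′ → (∃ λ h → proj₂ δ′ ≡ h + h) × N δ′ ≡ N δ × δ′ ∙ κ′ ≡ δ ∙ κ
  by _ (inj₁ even) = δ , κ , even , refl , refl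
  -- Here the new pair is ω²δ, ωκ; when p and q are both odd it is ωδ, ω²κ. The product is kept as
  -- ω³ = 1.
  by (inj₁ (g , p≡)) (inj₂ _) = (q - p , - p) , (- s , r - s) ,
    (- g , trans (cong -_ p≡) (negated g)) , f₁ p q , cong₂ _,_ (f₂ p q r s) (f₃ p q r s)
  by (inj₂ (g , p≡)) (inj₂ (h , q≡)) = (- q , p - q) , (s - r , - r) ,
    (g - h , trans (cong₂ _-_ p≡ q≡) (difference g h)) , g₁ p q , cong₂ _,_ (g₂ p q r s) (g₃ p q r s)

-- In the basis 1, ω, the element 3t + 1 + y√-3 that (t , y) stands for.
element : ℤ × ℤ → ℤ × ℤ
element (t , y) = + 3 * t + + 1 + y , y + y

NotThird : ℕ → Set
NotThird m = ∀ c → + m ≢ + 3 * c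

-- p + 2hω is p - h + h√-3. Its real part is not divisible by 3, since m is not, so after a change
-- of sign in both factors it is 1 modulo 3.
normalise : ∀ m → NotThird m → ∀ p q κ → (∃ λ h → q ≡ h + h) → N (p , q) ≡ + m →
  ∃₂ λ z κ′ → NormPoint m z × element z ∙ κ′ ≡ (p , q) ∙ κ
normalise m notThird p _ κ@(r , s) (h , refl) norm = by (thirds (p - h))
  where
  form : ∀ p h → p * p - p * (h + h) + (h + h) * (h + h) ≡ (p - h) * (p - h) + + 3 * (h * h)
  form = solve-∀
  norm′ : (p - h) * (p - h) + + 3 * (h * h) ≡ + m
  norm′ = trans (sym (form p h)) norm
  factor : ∀ t h → + 3 * t * (+ 3 * t) + + 3 * (h * h) ≡ + 3 * (+ 3 * (t * t) + h * h)
  factor = solve-∀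
  restore : ∀ p h → p - h + h ≡ p
  restore = solve-∀
  negate : ∀ x h → - x * - x + + 3 * (h * h) ≡ x * x + + 3 * (- h * - h)
  negate = solve-∀
  restore′ : ∀ x h → x + - h ≡ - (- x + h)
  restore′ = solve-∀
  e₁ : ∀ p h r s → - p * - r - (- h + - h) * - s ≡ p * r - (h + h) * s
  e₁ = solve-∀
  e₂ : ∀ p h r s → - p * - s + (- h + - h) * - r - (- h + - h) * - s ≡ p * s + (h + h) * r - (h + h) * s
  e₂ = solve-∀
  by : Thirds (p - h) →
    ∃₂ λ z κ′ → NormPoint m z × element z ∙ κ′ ≡ (p , h + h) ∙ κ
  by (inj₁ (t , eq)) = ⊥-elim (notThird (+ 3 * (t * t) + h * h) (trans (sym norm′)
    (trans (cong (λ x → x * x + + 3 * (h * h)) eq) (factor t h))))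
  by (inj₂ (inj₁ (t , eq))) = (t , h) , κ ,
    trans (cong (λ x → x * x + + 3 * (h * h)) (sym eq)) norm′ ,
    cong (λ x → (x , h + h) ∙ κ) (trans (cong (_+ h) (sym eq)) (restore p h))
  by (inj₂ (inj₂ (t , eq))) = (t , - h) , neg κ ,
    trans (sym (negate (+ 3 * t + + 1) h)) (trans (cong (λ x → x * x + + 3 * (h * h)) (sym eq)) norm′) ,
    trans (cong (λ x → (x , - h + - h) ∙ neg κ) (trans (restore′ (+ 3 * t + + 1) h)
        (cong -_ (trans (cong (_+ h) (sym eq)) (restore p h)))))
      (cong₂ _,_ (e₁ p h r s) (e₂ p h r s))

-- The product (3t₁ + 1 + y₁√-3)(3t₂ + 1 + y₂√-3): real parts congruent to 1 modulo 3 are closed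
-- under multiplication, so they select one of ± each element consistently.
multiply : (ℤ × ℤ) × (ℤ × ℤ) → ℤ × ℤ
multiply ((t₁ , y₁) , (t₂ , y₂)) =
  + 3 * (t₁ * t₂) + t₁ + t₂ - y₁ * y₂ , (+ 3 * t₁ + + 1) * y₂ + y₁ * (+ 3 * t₂ + + 1)

normForm : ℤ × ℤ → ℤ
normForm (t , y) = (+ 3 * t + + 1) * (+ 3 * t + + 1) + + 3 * (y * y)

multiply-norm : ∀ z w → normForm (multiply (z , w)) ≡ normForm z * normForm w
multiply-norm (t , y) (u , x) = identity t y u x
  where
  identity : ∀ t y u x → (+ 3 * (+ 3 * (t * u) + t + u - y * x) + + 1) * (+ 3 * (+ 3 * (t * u) + t + u - y * x) + + 1)
    + + 3 * (((+ 3 * t + + 1) * x + y * (+ 3 * u + + 1)) * ((+ 3 * t + + 1) * x + y * (+ 3 * u + + 1))) ≡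
    ((+ 3 * t + + 1) * (+ 3 * t + + 1) + + 3 * (y * y)) * ((+ 3 * u + + 1) * (+ 3 * u + + 1) + + 3 * (x * x))
  identity = solve-∀

multiply-into : ∀ {m n} z w → NormPoint m z → NormPoint n w → NormPoint (m ℕ.* n) (multiply (z , w))
multiply-into {m} {n} z w p q = trans (multiply-norm z w) (trans (cong₂ _*_ p q) (sym (ℤP.pos-* m n)))

odd-norm : ∀ {m} → Odd m → ∀ t y → NormPoint m (t , y) → ∃ λ h → + 3 * t + + 1 + y ≡ + 1 + (h + h)
odd-norm odd t y p with g , refl ← normPoint-parity odd t y p = + 3 * g + + 2 * y , shape g y
  where
  shape : ∀ g y → + 3 * (+ 2 * g + y) + + 1 + y ≡ + 1 + ((+ 3 * g + + 2 * y) + (+ 3 * g + + 2 * y))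
  shape = solve-∀

module _ {m n} .{{_ : ℕ.NonZero m}} (odd : Odd m) (notThird : NotThird m) (coprime : Coprime m n)
  (t y : ℤ) (p : NormPoint (m ℕ.* n) (t , y)) where

  open ≡-Reasoning

  Factorisation : Set
  Factorisation = ∃ λ zw → (NormPoint m (proj₁ zw) × NormPoint n (proj₂ zw)) × multiply zw ≡ (t , y)

  real-quotient : ∀ t₁ y₁ r h → NormPoint m (t₁ , y₁) → element (t₁ , y₁) ∙ (r , h + h) ≡ element (t , y) → Factorisation
  real-quotient t₁ y₁ r h p₁ eq = ((t₁ , y₁) , (t₂ , h)) , (p₁ , p₂) , cong₂ _,_ t≡ y≡
    where
    X₁ = + 3 * t₁ + + 1
    -- Solved from 3t₂ + 1 = r - h by means of X₁(r - h) - 3y₁h = 3t + 1, where X₁ = 3t₁ + 1.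
    t₂ = t - t₁ * (r - h) + y₁ * h
    y≡′ : X₁ * h + y₁ * (r - h) ≡ y
    y≡′ = double-injective _ y (trans (e X₁ y₁ r h) (cong proj₂ eq))
      where
      e : ∀ x y r h → x * h + y * (r - h) + (x * h + y * (r - h)) ≡ (x + y) * (h + h) + (y + y) * r - (y + y) * (h + h)
      e = solve-∀
    X≡ : X₁ * (r - h) - + 3 * (y₁ * h) ≡ + 3 * t + + 1
    X≡ = begin
      X₁ * (r - h) - + 3 * (y₁ * h)  ≡⟨ e X₁ y₁ r h ⟩
      (X₁ + y₁) * r - (y₁ + y₁) * (h + h) - (X₁ * h + y₁ * (r - h))  ≡⟨ cong₂ _-_ (cong proj₁ eq) y≡′ ⟩
      + 3 * t + + 1 + y - y  ≡⟨ undo (+ 3 * t + + 1) y ⟩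
      + 3 * t + + 1  ∎
      where
      e : ∀ x y r h → x * (r - h) - + 3 * (y * h) ≡ (x + y) * r - (y + y) * (h + h) - (x * h + y * (r - h))
      e = solve-∀
      undo : ∀ x y → x + y - y ≡ x
      undo = solve-∀
    X₂≡ : + 3 * t₂ + + 1 ≡ r - h
    X₂≡ = begin
      + 3 * t₂ + + 1  ≡⟨ e t t₁ y₁ r h ⟩
      + 3 * t + + 1 + + 3 * (y₁ * h) - + 3 * t₁ * (r - h)  ≡⟨ cong (λ x → x + + 3 * (y₁ * h) - + 3 * t₁ * (r - h)) X≡ ⟨
      X₁ * (r - h) - + 3 * (y₁ * h) + + 3 * (y₁ * h) - + 3 * t₁ * (r - h)  ≡⟨ e′ t₁ y₁ r h ⟩
      r - h  ∎
      where
      e : ∀ t t₁ y₁ r h → + 3 * (t - t₁ * (r - h) + y₁ * h) + + 1 ≡ + 3 * t + + 1 + + 3 * (y₁ * h) - + 3 * t₁ * (r - h)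
      e = solve-∀
      e′ : ∀ t₁ y₁ r h → (+ 3 * t₁ + + 1) * (r - h) - + 3 * (y₁ * h) + + 3 * (y₁ * h) - + 3 * t₁ * (r - h) ≡ r - h
      e′ = solve-∀
    y≡ : X₁ * h + y₁ * (+ 3 * t₂ + + 1) ≡ y
    y≡ = trans (cong (λ x → X₁ * h + y₁ * x) X₂≡) y≡′
    t≡ : + 3 * (t₁ * t₂) + t₁ + t₂ - y₁ * h ≡ t
    t≡ = ℤP.*-cancelˡ-≡ (+ 3) _ t (ℤRing.+-cancelʳ (+ 1) _ (+ 3 * t) (begin
      + 3 * (+ 3 * (t₁ * t₂) + t₁ + t₂ - y₁ * h) + + 1  ≡⟨ e t₁ t₂ y₁ h ⟩
      X₁ * (+ 3 * t₂ + + 1) - + 3 * (y₁ * h)  ≡⟨ cong (λ x → X₁ * x - + 3 * (y₁ * h)) X₂≡ ⟩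
      X₁ * (r - h) - + 3 * (y₁ * h)  ≡⟨ X≡ ⟩
      + 3 * t + + 1  ∎))
      where
      e : ∀ t₁ t₂ y₁ h → + 3 * (+ 3 * (t₁ * t₂) + t₁ + t₂ - y₁ * h) + + 1 ≡ (+ 3 * t₁ + + 1) * (+ 3 * t₂ + + 1) - + 3 * (y₁ * h)
      e = solve-∀
    p₂ : NormPoint n (t₂ , h)
    p₂ = ℤP.*-cancelˡ-≡ (+ m) _ (+ n) (begin
      + m * normForm (t₂ , h)  ≡⟨ cong (_* normForm (t₂ , h)) p₁ ⟨
      normForm (t₁ , y₁) * normForm (t₂ , h)  ≡⟨ multiply-norm (t₁ , y₁) (t₂ , h) ⟨
      normForm (multiply ((t₁ , y₁) , (t₂ , h))) ≡⟨ cong normForm (cong₂ _,_ t≡ y≡) ⟩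
      normForm (t , y)  ≡⟨ trans p (ℤP.pos-* m n) ⟩
      + m * + n  ∎)

  -- The cofactor lies in ℤ[√-3] too: as m is odd, X₁ + y₁ is odd, so an odd s would make the second
  -- coordinate of the product odd, while it is 2y.
  quotient : ∀ t₁ y₁ r s → NormPoint m (t₁ , y₁) → element (t₁ , y₁) ∙ (r , s) ≡ element (t , y) → Factorisation
  quotient t₁ y₁ r s p₁ eq = by (parity s)
    where
    half : ℤ → ℤ → ℤ → ℤ → ℤ
    half g h y r = g + h + + 2 * (g * h) + y * r - y * (+ 1 + (h + h))
    oddness : ∀ g h y r → (+ 1 + (g + g)) * (+ 1 + (h + h)) + (y + y) * r - (y + y) * (+ 1 + (h + h)) ≡
      + 1 + ((g + h + + 2 * (g * h) + y * r - y * (+ 1 + (h + h))) + (g + h + + 2 * (g * h) + y * r - y * (+ 1 + (h + h))))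
    oddness = solve-∀
    by : Parity s → Factorisation
    by (inj₁ (h , s≡)) = real-quotient t₁ y₁ r h p₁ (trans (cong (λ s → element (t₁ , y₁) ∙ (r , s)) (sym s≡)) eq)
    by (inj₂ (h , s≡)) = let g , x≡ = odd-norm odd t₁ y₁ p₁ in
      ⊥-elim (even≢odd y (half g h y₁ r) (trans (sym (cong proj₂ eq)) (trans
        (cong₂ (λ x s → x * s + (y₁ + y₁) * r - (y₁ + y₁) * s) x≡ s≡) (oddness g h y₁ r))))

  multiply-onto : Factorisation
  multiply-onto =
    let δ , κ , Nδ , eq = divisor-of-norm m n coprime (element (t , y)) (trans (norm (+ 3 * t + + 1) y) (trans p (ℤP.pos-* m n)))
        (p′ , q′) , κ′ , even , Nδ′ , eq′ = even-associate δ κ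
        (t₁ , y₁) , (r , s) , p₁ , eq″ = normalise m notThird p′ q′ κ′ even (trans Nδ′ Nδ)
    in quotient t₁ y₁ r s p₁ (trans eq″ (trans eq′ (sym eq)))
    where
    norm : ∀ x y → (x + y) * (x + y) - (x + y) * (y + y) + (y + y) * (y + y) ≡ x * x + + 3 * (y * y)
    norm = solve-∀

unit-norm : ∀ e f → e * e + + 3 * (f * f) ≡ + 1 → (e ≡ + 1 ⊎ e ≡ -[1+ 0 ]) × f ≡ + 0
unit-norm e f eq = ℕ-unit ∣ e ∣ ∣ f ∣ refl refl (ℤP.+-injective
  (trans (sym (cong₂ _+_ (+square e) (trans (cong (_*_ (+ 3)) (+square f)) (sym (ℤP.pos-* 3 (∣ f ∣ ℕ.* ∣ f ∣)))))) eq))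
  where
  ±1 : ∀ e → ∣ e ∣ ≡ 1 → e ≡ + 1 ⊎ e ≡ -[1+ 0 ]
  ±1 (+ 1)    _ = inj₁ refl
  ±1 -[1+ 0 ] _ = inj₂ refl
  ℕ-unit : ∀ x y → ∣ e ∣ ≡ x → ∣ f ∣ ≡ y → x ℕ.* x ℕ.+ 3 ℕ.* (y ℕ.* y) ≡ 1 → (e ≡ + 1 ⊎ e ≡ -[1+ 0 ]) × f ≡ + 0
  ℕ-unit 1 zero ∣e∣ ∣f∣ _ = ±1 e ∣e∣ , ℤP.∣i∣≡0⇒i≡0 ∣f∣
  ℕ-unit zero zero _ _ ()
  ℕ-unit (suc (suc _)) zero _ _ ()
  ℕ-unit x (suc y) _ _ eq = ⊥-elim (ℕP.<⇒≢ large (sym eq))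
    where
    large : 1 ℕ.< x ℕ.* x ℕ.+ 3 ℕ.* (suc y ℕ.* suc y)
    large = ℕP.<-≤-trans (s≤s (s≤s z≤n)) (ℕP.≤-trans (ℕP.*-monoʳ-≤ 3 (s≤s (z≤n {y ℕ.+ y ℕ.* suc y}))) (ℕP.m≤n+m _ (x ℕ.* x)))

-- If αβ = α′β′ with N α = N α′ = m and N β = N β′ = n, where u m + v n = 1, then α = ε α′ for the unit
-- ε = u α ᾱ′ + v β′ β̄.
module _ {m n} .{{_ : ℕ.NonZero m}} (coprime : Coprime m n) where

  private
    Re Im : ℤ → ℤ → ℤ → ℤ → ℤ
    Re X Y U V = X * U - + 3 * (Y * V)
    Im X Y U V = X * V + Y * U

  unit-factor : ∀ X Y X′ Y′ U V U′ V′ →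
    X * X + + 3 * (Y * Y) ≡ + m → X′ * X′ + + 3 * (Y′ * Y′) ≡ + m → U * U + + 3 * (V * V) ≡ + n →
    Re X Y U V ≡ Re X′ Y′ U′ V′ → Im X Y U V ≡ Im X′ Y′ U′ V′ →
    Y ≡ Y′ × X ≡ X′ ⊎ X ≡ - X′
  unit-factor X Y X′ Y′ U V U′ V′ Nα Nα′ Nβ re im = conclude (bezout coprime)
    where
    open ≡-Reasoning
    -- Real and imaginary parts of α ᾱ′ and of β′ β̄.
    a₁ = X * X′ + + 3 * (Y * Y′)
    a₂ = Y * X′ - X * Y′
    b₁ = U * U′ + + 3 * (V * V′)
    b₂ = U * V′ - V * U′
    α₁ : ∀ X Y X′ Y′ → X′ * (X * X′ + + 3 * (Y * Y′)) - + 3 * Y′ * (Y * X′ - X * Y′) ≡ X * (X′ * X′ + + 3 * (Y′ * Y′))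
    α₁ = solve-∀
    α₂ : ∀ X Y X′ Y′ → X′ * (Y * X′ - X * Y′) + Y′ * (X * X′ + + 3 * (Y * Y′)) ≡ Y * (X′ * X′ + + 3 * (Y′ * Y′))
    α₂ = solve-∀
    β₁ : ∀ X Y U V U′ V′ → X * (U * U′ + + 3 * (V * V′)) - + 3 * Y * (U * V′ - V * U′) ≡
      U * (X * U′ - + 3 * (Y * V′)) + + 3 * V * (X * V′ + Y * U′)
    β₁ = solve-∀
    β₂ : ∀ X Y U V U′ V′ → X * (U * V′ - V * U′) + Y * (U * U′ + + 3 * (V * V′)) ≡
      U * (X * V′ + Y * U′) - V * (X * U′ - + 3 * (Y * V′))
    β₂ = solve-∀
    γ₁ : ∀ X Y U V → U * (X * U - + 3 * (Y * V)) + + 3 * V * (X * V + Y * U) ≡ X * (U * U + + 3 * (V * V))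
    γ₁ = solve-∀
    γ₂ : ∀ X Y U V → U * (X * V + Y * U) - V * (X * U - + 3 * (Y * V)) ≡ Y * (U * U + + 3 * (V * V))
    γ₂ = solve-∀
    regroup : ∀ u v x m n → u * (x * m) + v * (x * n) ≡ x * (u * m + v * n)
    regroup = solve-∀
    split₁ : ∀ u v X Y a₁ a₂ b₁ b₂ → X * (u * a₁ + v * b₁) - + 3 * Y * (u * a₂ + v * b₂) ≡
      u * (X * a₁ - + 3 * Y * a₂) + v * (X * b₁ - + 3 * Y * b₂)
    split₁ = solve-∀
    split₂ : ∀ u v X Y a₁ a₂ b₁ b₂ → X * (u * a₂ + v * b₂) + Y * (u * a₁ + v * b₁) ≡
      u * (X * a₂ + Y * a₁) + v * (X * b₂ + Y * b₁)
    split₂ = solve-∀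
    norms : ∀ X Y e f → (X * e - + 3 * Y * f) * (X * e - + 3 * Y * f) + + 3 * ((X * f + Y * e) * (X * f + Y * e)) ≡
      (X * X + + 3 * (Y * Y)) * (e * e + + 3 * (f * f))
    norms = solve-∀
    final₁ : ∀ X Y → X * + 1 - + 3 * Y * + 0 ≡ X
    final₁ = solve-∀
    final₂ : ∀ X Y → X * + 0 + Y * + 1 ≡ Y
    final₂ = solve-∀
    final₃ : ∀ X Y → X * -[1+ 0 ] - + 3 * Y * + 0 ≡ - X
    final₃ = solve-∀
    -- Real part of α′ β′ β̄ = α β β̄ = n α; `bracket₂` is the imaginary part.
    bracket₁ : X′ * b₁ - + 3 * Y′ * b₂ ≡ X * + n
    bracket₁ = begin
      X′ * b₁ - + 3 * Y′ * b₂  ≡⟨ β₁ X′ Y′ U V U′ V′ ⟩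
      U * Re X′ Y′ U′ V′ + + 3 * V * Im X′ Y′ U′ V′  ≡⟨ cong₂ (λ r i → U * r + + 3 * V * i) re im ⟨
      U * Re X Y U V + + 3 * V * Im X Y U V  ≡⟨ trans (γ₁ X Y U V) (cong (_*_ X) Nβ) ⟩
      X * + n  ∎
    bracket₂ : X′ * b₂ + Y′ * b₁ ≡ Y * + n
    bracket₂ = begin
      X′ * b₂ + Y′ * b₁  ≡⟨ β₂ X′ Y′ U V U′ V′ ⟩
      U * Im X′ Y′ U′ V′ - V * Re X′ Y′ U′ V′  ≡⟨ cong₂ (λ r i → U * i - V * r) re im ⟨
      U * Im X Y U V - V * Re X Y U V  ≡⟨ trans (γ₂ X Y U V) (cong (_*_ Y) Nβ) ⟩
      Y * + n  ∎
    conclude : (∃₂ λ u v → u * + m + v * + n ≡ + 1) → Y ≡ Y′ × X ≡ X′ ⊎ X ≡ - X′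
    conclude (u , v , uv) = by (unit-norm e f (ℤP.*-cancelˡ-≡ (+ m) _ (+ 1) (begin
        + m * (e * e + + 3 * (f * f))  ≡⟨ cong (_* (e * e + + 3 * (f * f))) Nα′ ⟨
        (X′ * X′ + + 3 * (Y′ * Y′)) * (e * e + + 3 * (f * f)) ≡⟨ norms X′ Y′ e f ⟨
        (X′ * e - + 3 * Y′ * f) * (X′ * e - + 3 * Y′ * f) + + 3 * ((X′ * f + Y′ * e) * (X′ * f + Y′ * e))
          ≡⟨ cong₂ (λ x y → x * x + + 3 * (y * y)) X≡ Y≡ ⟩
        X * X + + 3 * (Y * Y)  ≡⟨ trans Nα (sym (ℤP.*-identityʳ (+ m))) ⟩
        + m * + 1  ∎)))
      where
      e = u * a₁ + v * b₁
      f = u * a₂ + v * b₂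
      one : ∀ x → x * (u * + m + v * + n) ≡ x
      one x = trans (cong (_*_ x) uv) (ℤP.*-identityʳ x)
      X≡ : X′ * e - + 3 * Y′ * f ≡ X
      X≡ = begin
        X′ * e - + 3 * Y′ * f  ≡⟨ split₁ u v X′ Y′ a₁ a₂ b₁ b₂ ⟩
        u * (X′ * a₁ - + 3 * Y′ * a₂) + v * (X′ * b₁ - + 3 * Y′ * b₂)
          ≡⟨ cong₂ (λ i j → u * i + v * j) (trans (α₁ X Y X′ Y′) (cong (_*_ X) Nα′)) bracket₁ ⟩
        u * (X * + m) + v * (X * + n)  ≡⟨ trans (regroup u v X (+ m) (+ n)) (one X) ⟩
        X  ∎
      Y≡ : X′ * f + Y′ * e ≡ Y
      Y≡ = begin
        X′ * f + Y′ * e  ≡⟨ split₂ u v X′ Y′ a₁ a₂ b₁ b₂ ⟩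
        u * (X′ * a₂ + Y′ * a₁) + v * (X′ * b₂ + Y′ * b₁)
          ≡⟨ cong₂ (λ i j → u * i + v * j) (trans (α₂ X Y X′ Y′) (cong (_*_ Y) Nα′)) bracket₂ ⟩
        u * (Y * + m) + v * (Y * + n)  ≡⟨ trans (regroup u v Y (+ m) (+ n)) (one Y) ⟩
        Y  ∎
      by : (e ≡ + 1 ⊎ e ≡ -[1+ 0 ]) × f ≡ + 0 → Y ≡ Y′ × X ≡ X′ ⊎ X ≡ - X′
      by (inj₁ e≡1 , f≡0) = inj₁
        ( trans (sym Y≡) (trans (cong₂ (λ e f → X′ * f + Y′ * e) e≡1 f≡0) (final₂ X′ Y′))
        , trans (sym X≡) (trans (cong₂ (λ e f → X′ * e - + 3 * Y′ * f) e≡1 f≡0) (final₁ X′ Y′)))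
      by (inj₂ e≡-1 , f≡0) = inj₂
        (trans (sym X≡) (trans (cong₂ (λ e f → X′ * e - + 3 * Y′ * f) e≡-1 f≡0) (final₃ X′ Y′)))

  private
    re-multiply : ∀ t y u x → (+ 3 * t + + 1) * (+ 3 * u + + 1) - + 3 * (y * x) ≡ + 3 * (+ 3 * (t * u) + t + u - y * x) + + 1
    re-multiply = solve-∀
    affine-injective : ∀ {t t′} → + 3 * t + + 1 ≡ + 3 * t′ + + 1 → t ≡ t′
    affine-injective {t} {t′} eq = ℤP.*-cancelˡ-≡ (+ 3) t t′ (ℤRing.+-cancelʳ (+ 1) _ _ eq)

  multiply-injectiveˡ : ∀ z w z′ w′ → NormPoint m z → NormPoint m z′ → NormPoint n w →
    multiply (z , w) ≡ multiply (z′ , w′) → z ≡ z′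
  multiply-injectiveˡ (t , y) (u , x) (t′ , y′) (u′ , x′) p p′ q eq =
    by (unit-factor (+ 3 * t + + 1) y (+ 3 * t′ + + 1) y′ (+ 3 * u + + 1) x (+ 3 * u′ + + 1) x′ p p′ q
      (trans (re-multiply t y u x) (trans (cong (λ z → + 3 * proj₁ z + + 1) eq) (sym (re-multiply t′ y′ u′ x′))))
      (cong proj₂ eq))
    where
    left : ∀ t t′ → + 3 * (t + t′) ≡ + 3 * t + + 1 + + 3 * t′ - + 1
    left = solve-∀
    right : ∀ t′ → - (+ 3 * t′ + + 1) + + 3 * t′ - + 1 ≡ -[1+ 1 ]
    right = solve-∀
    not-third : ∀ c → + 3 * c ≢ -[1+ 1 ]
    not-third c eq = no-multiple ∣ c ∣ (trans (sym (ℤP.abs-* (+ 3) c)) (cong ∣_∣ eq))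
      where
      no-multiple : ∀ c → 3 ℕ.* c ≢ 2
      no-multiple (suc c) eq = ℕP.<⇒≢ (ℕP.*-monoʳ-≤ 3 (s≤s (z≤n {c}))) (sym eq)

    by : y ≡ y′ × + 3 * t + + 1 ≡ + 3 * t′ + + 1 ⊎ + 3 * t + + 1 ≡ - (+ 3 * t′ + + 1) → (t , y) ≡ (t′ , y′)
    by (inj₁ (y≡ , X≡)) = cong₂ _,_ (affine-injective X≡) y≡
    -- X = -X′ is impossible, as both are 1 modulo 3.
    by (inj₂ X≡) = ⊥-elim (not-third (t + t′)
      (trans (left t t′) (trans (cong (λ x → x + + 3 * t′ - + 1) X≡) (right t′))))

  -- Multiplying z w by the conjugate of z recovers m w.
  multiply-injectiveʳ : ∀ z w w′ → NormPoint m z → multiply (z , w) ≡ multiply (z , w′) → w ≡ w′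
  multiply-injectiveʳ z@(t , y) w w′ p eq = cong₂ _,_
    (affine-injective (scaled (λ w → + 3 * proj₁ w + + 1) (λ v → (+ 3 * t + + 1) * (+ 3 * proj₁ v + + 1) + + 3 * (y * proj₂ v))
      (λ (u , x) → recover₁ t y u x)))
    (scaled proj₂ (λ v → (+ 3 * t + + 1) * proj₂ v - y * (+ 3 * proj₁ v + + 1)) (λ (u , x) → recover₂ t y u x))
    where
    recover₁ : ∀ t y u x → ((+ 3 * t + + 1) * (+ 3 * t + + 1) + + 3 * (y * y)) * (+ 3 * u + + 1) ≡
      (+ 3 * t + + 1) * (+ 3 * (+ 3 * (t * u) + t + u - y * x) + + 1) + + 3 * (y * ((+ 3 * t + + 1) * x + y * (+ 3 * u + + 1)))
    recover₁ = solve-∀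
    recover₂ : ∀ t y u x → ((+ 3 * t + + 1) * (+ 3 * t + + 1) + + 3 * (y * y)) * x ≡
      (+ 3 * t + + 1) * ((+ 3 * t + + 1) * x + y * (+ 3 * u + + 1)) - y * (+ 3 * (+ 3 * (t * u) + t + u - y * x) + + 1)
    recover₂ = solve-∀
    scaled : (f g : ℤ × ℤ → ℤ) → (∀ w → normForm z * f w ≡ g (multiply (z , w))) → f w ≡ f w′
    scaled f g recover = ℤP.*-cancelˡ-≡ (+ m) (f w) (f w′) (trans (cong (_* f w) (sym p))
      (trans (recover w) (trans (cong g eq) (trans (sym (recover w′)) (cong (_* f w′) p)))))

-- Multiplicativity of the coefficients of η(6τ)⁴

Odd-* : ∀ {m n} → Odd m → Odd n → Odd (m ℕ.* n)
Odd-* {m} {n} (g , p) (h , q) = g + h + + 2 * (g * h) , trans (ℤP.pos-* m n) (trans (cong₂ _*_ p q) (expand g h))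
  where
  expand : ∀ g h → (+ 1 + (g + g)) * (+ 1 + (h + h)) ≡ + 1 + ((g + h + + 2 * (g * h)) + (g + h + + 2 * (g * h)))
  expand = solve-∀

-- The real part of a product is X X′ - 3 y y′. The first term sums to the product of the two sums,
-- and the second to zero by conjugation.
a-multiplicative : ∀ m n .{{_ : ℕ.NonZero m}} .{{_ : ℕ.NonZero n}} → Odd m → Odd n → NotThird m → Coprime m n →
  a (m ℕ.* n) ≡ a m * a n
a-multiplicative m@(suc i) n@(suc j) oddₘ oddₙ notThird coprime = begin
  a (m ℕ.* n)  ≡⟨ a-normPoints (j ℕ.+ i ℕ.* n) (Odd-* oddₘ oddₙ) ⟩
  ∑ G X  ≡⟨ reindex (E ×-enumeration F) G multiply
        (λ (z , w) (p , q) → multiply-into z w p q) injective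
        (λ (t , y) p → multiply-onto oddₘ notThird coprime t y p) X ⟨
  ∑ (E ×-enumeration F) (X ∘ multiply)
    ≡⟨ ∑-cong (E ×-enumeration F) (λ ((t , y) , (u , x)) _ → real t y u x) ⟩
  ∑ (E ×-enumeration F) (λ (z , w) → X z * X w + -[1+ 2 ] * (proj₂ z * proj₂ w))
    ≡⟨ ∑-+ (E ×-enumeration F) (λ (z , w) → X z * X w) (λ (z , w) → -[1+ 2 ] * (proj₂ z * proj₂ w)) ⟩
  ∑ (E ×-enumeration F) (λ (z , w) → X z * X w) + ∑ (E ×-enumeration F) (λ (z , w) → -[1+ 2 ] * (proj₂ z * proj₂ w))
    ≡⟨ cong₂ _+_ (∑-× E F X X) (trans (∑-* (E ×-enumeration F) -[1+ 2 ] (λ (z , w) → proj₂ z * proj₂ w))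
         (cong (_*_ -[1+ 2 ]) (trans (∑-× E F proj₂ proj₂) (cong (_* ∑ F proj₂) (∑-second E))))) ⟩
  ∑ E X * ∑ F X + + 0
    ≡⟨ ℤP.+-identityʳ _ ⟩
  ∑ E X * ∑ F X
    ≡⟨ cong₂ _*_ (a-normPoints i oddₘ) (a-normPoints j oddₙ) ⟨
  a m * a n ∎
  where
  open ≡-Reasoning
  E = normPoints i oddₘ
  F = normPoints j oddₙ
  G = normPoints (j ℕ.+ i ℕ.* n) (Odd-* oddₘ oddₙ)
  X : ℤ × ℤ → ℤ
  X (t , y) = + 3 * t + + 1
  real : ∀ t y u x → + 3 * (+ 3 * (t * u) + t + u - y * x) + + 1 ≡ (+ 3 * t + + 1) * (+ 3 * u + + 1) + -[1+ 2 ] * (y * x)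
  real = solve-∀
  injective : ∀ zw zw′ → NormPoint m (proj₁ zw) × NormPoint n (proj₂ zw) → NormPoint m (proj₁ zw′) × NormPoint n (proj₂ zw′) →
    multiply zw ≡ multiply zw′ → zw ≡ zw′
  injective (z , w) (z′ , w′) (p , q) (p′ , _) eq = cong₂ _,_ z≡z′
    (multiply-injectiveʳ coprime z w w′ p (trans eq (cong (λ z → multiply (z , w′)) (sym z≡z′))))
    where
    z≡z′ = multiply-injectiveˡ coprime z w z′ w′ p p′ q eq

-- Sums of four odd squares

factorExponent : ℤ × ℤ → ℤ
factorExponent (a , b) = + 4 * (a * b) + + 2 * a + + 2 * b

factorExponentℕ : ∀ a b → factorExponent (+ a , + b) ≡ + (4 ℕ.* (a ℕ.* b) ℕ.+ 2 ℕ.* a ℕ.+ 2 ℕ.* b)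
factorExponentℕ a b = cong₂ _+_ (cong₂ _+_ (trans (cong (_*_ (+ 4)) (sym (ℤP.pos-* a b))) (sym (ℤP.pos-* 4 (a ℕ.* b))))
  (sym (ℤP.pos-* 2 a))) (sym (ℤP.pos-* 2 b))

Nonneg² : ℤ × ℤ → Set
Nonneg² (a , b) = + 0 ℤ.≤ a × + 0 ℤ.≤ b

-- (2a+1)(2b+1) - 1, for factorisations of an odd number.
factorisations : Family (ℤ × ℤ)
factorisations = record
  { member   = Nonneg²
  ; exponent = factorExponent
  ; nonneg   = λ { {+ a , + b} _ → _ , factorExponentℕ a b }
  ; level    = λ n → enumerateℤ²
      (λ z → (+ 0 ℤP.≤? proj₁ z ×-dec + 0 ℤP.≤? proj₂ z) ×-dec factorExponent z ℤP.≟ + n) n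
      λ { (+ a) (+ b) (_ , eq) → bound a b n (ℤP.+-injective (trans (sym (factorExponentℕ a b)) eq))
        ; (+ _) -[1+ _ ] ((_ , ()) , _)
        ; -[1+ _ ] _ ((() , _) , _) }
  }
  where
  bound : ∀ a b n → 4 ℕ.* (a ℕ.* b) ℕ.+ 2 ℕ.* a ℕ.+ 2 ℕ.* b ≡ n → a ℕ.≤ n × b ℕ.≤ n
  bound a b _ refl =
    ℕP.≤-trans (ℕP.m≤n*m a 2) (ℕP.≤-trans (ℕP.m≤n+m (2 ℕ.* a) (4 ℕ.* (a ℕ.* b))) (ℕP.m≤m+n _ (2 ℕ.* b))) ,
    ℕP.≤-trans (ℕP.m≤n*m b 2) (ℕP.m≤n+m (2 ℕ.* b) (4 ℕ.* (a ℕ.* b) ℕ.+ 2 ℕ.* a))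

firstFactor : ℤ × ℤ → ℤ
firstFactor (a , b) = + 2 * a + + 1

one : A → ℤ
one _ = + 1

divisorSeries oddSeries oddSeries′ : PowerSeries
divisorSeries = coeff factorisations firstFactor
oddSeries  = coeff oddSquares one
oddSeries′ = coeff oddSquares′ one

-- Each odd square comes from both signs of its root: 2k′ + 1 is 4k + 1 for k′ = 2k and -(4k + 1)
-- for k′ = -(2k + 1).
coeff-halves : (F F′ : Family ℤ) → (∀ x → member F x) → (∀ x → member F′ x) →
  (∀ k → exponent F′ (k + k) ≡ exponent F k) → (∀ k → exponent F′ (- (+ 1 + (k + k))) ≡ exponent F k) →
  coeff F′ one ≈ + 2 · coeff F one
coeff-halves F F′ all all′ even odd n = trans
  (∑-split (level F′ n) (level F n) (level F n) (λ k → k + k) (λ k → - (+ 1 + (k + k)))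
    (λ k (_ , eq) → all′ _ , trans (even k) eq) (λ k (_ , eq) → all′ _ , trans (odd k) eq)
    (λ k l _ _ → double-injective k l)
    (λ k l _ _ eq → double-injective k l (ℤRing.+-cancelˡ (+ 1) _ _ (ℤP.neg-injective eq)))
    (λ k l _ _ eq → even≢odd k (- l - + 1) (trans eq (flip l)))
    cover one)
  (double (coeff F one n))
  where
  flip : ∀ l → - (+ 1 + (l + l)) ≡ + 1 + ((- l - + 1) + (- l - + 1))
  flip = solve-∀
  flip′ : ∀ h → - (+ 1 + ((- h - + 1) + (- h - + 1))) ≡ + 1 + (h + h)
  flip′ = solve-∀
  double : ∀ x → x + x ≡ + 2 * x
  double = solve-∀
  cover : ∀ z → member F′ z × exponent F′ z ≡ + n →
    (∃ λ k → (member F k × exponent F k ≡ + n) × k + k ≡ z) ⊎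
    (∃ λ k → (member F k × exponent F k ≡ + n) × - (+ 1 + (k + k)) ≡ z)
  cover z (_ , eq) with parity z
  ... | inj₁ (h , refl) = inj₁ (h , (all h , trans (sym (even h)) eq) , refl)
  ... | inj₂ (h , refl) = inj₂ (- h - + 1 , (all _ , trans (sym (odd (- h - + 1))) (trans (cong (exponent F′) (flip′ h)) eq)) , flip′ h)

oddSeries′≈ : oddSeries′ ≈ + 2 · oddSeries
oddSeries′≈ = coeff-halves oddSquares oddSquares′ (λ _ → tt) (λ _ → tt) even odd
  where
  even : ∀ k → + 0 * ((k + k) * (k + k)) + + 1 * ((k + k) * (k + k) + (k + k)) + + 0 ≡ + 2 * (k * k) + + 2 * (k * k + k) + + 0
  even = solve-∀
  odd : ∀ k → + 0 * (- (+ 1 + (k + k)) * - (+ 1 + (k + k))) + + 1 * (- (+ 1 + (k + k)) * - (+ 1 + (k + k)) + - (+ 1 + (k + k))) + + 0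
    ≡ + 2 * (k * k) + + 2 * (k * k + k) + + 0
  odd = solve-∀

-- With x = 2c+1, y = 2a+1, z = 2b+1 the points of level n of this family are the solutions of
-- x² + 4yz = 4n + 5, on which we use Zagier's windmill maps.
windmill : Family (ℤ × (ℤ × ℤ))
windmill = oddSquares′ ⊗ factorisations

Windmill : ℕ → ℤ × (ℤ × ℤ) → Set
Windmill n z = member windmill z × exponent windmill z ≡ + n

-- y > x + z
Wide : ℤ × (ℤ × ℤ) → Set
Wide (c , (a , b)) = + 1 ℤ.≤ a - b - c

wide? : Decidable Wide
wide? (c , (a , b)) = + 1 ℤP.≤? a - b - c

-- (x , y , z) ↦ (-x , z , y)
flip-swap : ℤ × (ℤ × ℤ) → ℤ × (ℤ × ℤ)
flip-swap (c , (a , b)) = - + 1 - c , (b , a)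

flip-swap-involutive : ∀ z → flip-swap (flip-swap z) ≡ z
flip-swap-involutive (c , ab) = cong (_, ab) (identity c)
  where
  identity : ∀ c → - + 1 - (- + 1 - c) ≡ c
  identity = solve-∀

flip-swap-windmill : ∀ {n} z → Windmill n z → Windmill n (flip-swap z)
flip-swap-windmill (c , (a , b)) ((_ , (p , q)) , eq) = (tt , (q , p)) , trans (identity c a b) eq
  where
  identity : ∀ c a b → + 0 * ((- + 1 - c) * (- + 1 - c)) + + 1 * ((- + 1 - c) * (- + 1 - c) + (- + 1 - c)) + + 0 + (+ 4 * (b * a) + + 2 * b + + 2 * a)
    ≡ + 0 * (c * c) + + 1 * (c * c + c) + + 0 + (+ 4 * (a * b) + + 2 * a + + 2 * b)
  identity = solve-∀

-- For odd x, y, z the number y - x - z is odd, hence not zero, and the flip negates it. So exactly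
-- one of a point and its flip is wide.
complement : ∀ a b c → b - a - (- + 1 - c) ≡ + 1 - (a - b - c)
complement = solve-∀

wide⇒narrow : ∀ z → Wide z → ¬ Wide (flip-swap z)
wide⇒narrow (c , (a , b)) wide wide′ = 1≰0 (ℤP.≤-trans (subst (+ 1 ℤ.≤_) (complement a b c) wide′)
  (ℤP.+-monoʳ-≤ (+ 1) (ℤP.neg-mono-≤ wide)))
  where
  1≰0 : ¬ (+ 1 ℤ.≤ + 0)
  1≰0 (ℤ.+≤+ ())

narrow⇒wide : ∀ z → ¬ Wide z → Wide (flip-swap z)
narrow⇒wide (c , (a , b)) narrow = subst (+ 1 ℤ.≤_) (sym (complement a b c))
  (ℤP.+-monoʳ-≤ (+ 1) (ℤP.neg-mono-≤ nonpositive))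
  where
  nonpositive : a - b - c ℤ.≤ + 0
  nonpositive = ℤP.≮⇒≥ (narrow ∘ ℤP.i<j⇒suc[i]≤j)

∑-windmill : ∀ n w → ∑ (level windmill n) w ≡ ∑ (restrict (level windmill n) wide?) (λ z → w z + w (flip-swap z))
∑-windmill n w = begin
  ∑ E w
    ≡⟨ ∑-restrict E wide? w ⟩
  ∑ W w + ∑ (restrict E (¬? ∘ wide?)) w
    ≡⟨ cong (_+_ (∑ W w)) (reindex W (restrict E (¬? ∘ wide?)) flip-swap
         (λ z (p , wide) → flip-swap-windmill z p , wide⇒narrow z wide)
         (λ z z′ _ _ eq → trans (sym (flip-swap-involutive z)) (trans (cong flip-swap eq) (flip-swap-involutive z′)))
         (λ z (p , narrow) → flip-swap z , (flip-swap-windmill z p , narrow⇒wide z narrow) , flip-swap-involutive z) w) ⟨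
  ∑ W w + ∑ W (w ∘ flip-swap)
    ≡⟨ ∑-+ W w (w ∘ flip-swap) ⟨
  ∑ W (λ z → w z + w (flip-swap z)) ∎
  where
  open ≡-Reasoning
  E = level windmill n
  W = restrict E wide?

-- (x , y , z) ↦ (-x-2z , y-x-z , z)
turn : ℤ × (ℤ × ℤ) → ℤ × (ℤ × ℤ)
turn (c , (a , b)) = - c - + 2 * b - + 2 , (a - b - c - + 1 , b)

-- The wide condition says that the new coordinate a - b - c - 1 is nonnegative, and the image has
-- width 1 + a, which is at least 1.
turn-wide : ∀ {n} z → Windmill n z × Wide z → Windmill n (turn z) × Wide (turn z)
turn-wide (c , (a , b)) (((_ , (p , q)) , eq) , wide) =
  ((tt , (ℤP.i≤j⇒0≤j-i wide , q)) , trans (identity c a b) eq) ,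
  subst (+ 1 ℤ.≤_) (sym (widths a b c)) (ℤP.+-monoʳ-≤ (+ 1) p)
  where
  widths : ∀ a b c → a - b - c - + 1 - b - (- c - + 2 * b - + 2) ≡ + 1 + a
  widths = solve-∀
  identity : ∀ c a b → + 0 * ((- c - + 2 * b - + 2) * (- c - + 2 * b - + 2)) + + 1 * ((- c - + 2 * b - + 2) * (- c - + 2 * b - + 2) + (- c - + 2 * b - + 2)) + + 0
    + (+ 4 * ((a - b - c - + 1) * b) + + 2 * (a - b - c - + 1) + + 2 * b)
    ≡ + 0 * (c * c) + + 1 * (c * c + c) + + 0 + (+ 4 * (a * b) + + 2 * a + + 2 * b)
  identity = solve-∀

turn-involutive : ∀ z → turn (turn z) ≡ z
turn-involutive (c , (a , b)) = cong₂ (λ c a → c , (a , b)) (first c b) (second a b c)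
  where
  first : ∀ c b → - (- c - + 2 * b - + 2) - + 2 * b - + 2 ≡ c
  first = solve-∀
  second : ∀ a b c → a - b - c - + 1 - b - (- c - + 2 * b - + 2) - + 1 ≡ a
  second = solve-∀

-- y (yz - x²) and x (y² - z²): the second is odd in x, and added to the first it makes the windmill sum
-- antisymmetric under turn.
mainWeight balance : ℤ × (ℤ × ℤ) → ℤ
mainWeight (c , (a , b)) = (+ 2 * a + + 1) * ((+ 2 * a + + 1) * (+ 2 * b + + 1) - (+ 2 * c + + 1) * (+ 2 * c + + 1))
balance (c , (a , b)) = (+ 2 * c + + 1) * ((+ 2 * a + + 1) * (+ 2 * a + + 1) - (+ 2 * b + + 1) * (+ 2 * b + + 1))

∑-mainWeight : ∀ n → ∑ (level windmill n) mainWeight ≡ + 0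
∑-mainWeight n = ℤP.*-cancelˡ-≡ (+ 2) _ (+ 0) (begin
  + 2 * ∑ E mainWeight  ≡⟨ ℤP.+-identityʳ (+ 2 * ∑ E mainWeight) ⟨
  + 2 * ∑ E mainWeight + + 0  ≡⟨ cong₂ _+_ (∑-* E (+ 2) mainWeight) balanced ⟨
  ∑ E (λ z → + 2 * mainWeight z) + ∑ E balance  ≡⟨ ∑-+ E (λ z → + 2 * mainWeight z) balance ⟨
  ∑ E w  ≡⟨ ∑-windmill n w ⟩
  ∑ (restrict E wide?) (λ z → w z + w (flip-swap z))
    ≡⟨ ∑-antisymmetric (restrict E wide?) turn (λ z → w z + w (flip-swap z)) turn-wide turn-involutive (λ (c , (a , b)) → negates c a b) ⟩
  + 0  ∎)
  where
  open ≡-Reasoning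
  E = level windmill n
  w : ℤ × (ℤ × ℤ) → ℤ
  w z = + 2 * mainWeight z + balance z
  balanced : ∑ E balance ≡ + 0
  balanced = ∑-antisymmetric E (λ (c , ab) → - + 1 - c , ab) balance
    (λ (c , (a , b)) ((_ , m) , eq) → (tt , m) , trans (cong (_+ factorExponent (a , b)) (even c)) eq)
    (λ (c , ab) → cong (_, ab) (involutive c)) (λ (c , (a , b)) → odd c ((+ 2 * a + + 1) * (+ 2 * a + + 1) - (+ 2 * b + + 1) * (+ 2 * b + + 1)))
    where
    even : ∀ c → + 0 * ((- + 1 - c) * (- + 1 - c)) + + 1 * ((- + 1 - c) * (- + 1 - c) + (- + 1 - c)) + + 0 ≡ + 0 * (c * c) + + 1 * (c * c + c) + + 0
    even = solve-∀
    involutive : ∀ c → - + 1 - (- + 1 - c) ≡ c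
    involutive = solve-∀
    odd : ∀ c e → (+ 2 * (- + 1 - c) + + 1) * e ≡ - ((+ 2 * c + + 1) * e)
    odd = solve-∀
  -- W x y z = 2(x + z)(y - x)(y + z). Turning negates x + z and exchanges y - x with y + z.
  W : ℤ → ℤ → ℤ → ℤ
  W x y z = + 2 * (y * (y * z - x * x)) + x * (y * y - z * z) + (+ 2 * (z * (z * y - x * x)) + - x * (z * z - y * y))
  negation : ∀ x y z → + 2 * ((y - x - z) * ((y - x - z) * z - (- x - + 2 * z) * (- x - + 2 * z))) + (- x - + 2 * z) * ((y - x - z) * (y - x - z) - z * z)
    + (+ 2 * (z * (z * (y - x - z) - (- x - + 2 * z) * (- x - + 2 * z))) + - (- x - + 2 * z) * (z * z - (y - x - z) * (y - x - z)))
    ≡ - (+ 2 * (y * (y * z - x * x)) + x * (y * y - z * z) + (+ 2 * (z * (z * y - x * x)) + - x * (z * z - y * y)))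
  negation = solve-∀
  flipped : ∀ c → + 2 * (- + 1 - c) + + 1 ≡ - (+ 2 * c + + 1)
  flipped = solve-∀
  square : ∀ x → - x * - x ≡ x * x
  square = solve-∀
  inW : ∀ c a b → w (c , (a , b)) + w (flip-swap (c , (a , b))) ≡ W (+ 2 * c + + 1) (+ 2 * a + + 1) (+ 2 * b + + 1)
  inW c a b = cong (_+_ (w (c , (a , b)))) (trans
    (cong (λ x → + 2 * (z * (z * y - x * x)) + x * (z * z - y * y)) (flipped c))
    (cong (λ s → + 2 * (z * (z * y - s)) + - (+ 2 * c + + 1) * (z * z - y * y)) (square (+ 2 * c + + 1))))
    where
    y = + 2 * a + + 1
    z = + 2 * b + + 1
  turned₁ : ∀ b c → + 2 * (- c - + 2 * b - + 2) + + 1 ≡ - (+ 2 * c + + 1) - + 2 * (+ 2 * b + + 1)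
  turned₁ = solve-∀
  turned₂ : ∀ a b c → + 2 * (a - b - c - + 1) + + 1 ≡ + 2 * a + + 1 - (+ 2 * c + + 1) - (+ 2 * b + + 1)
  turned₂ = solve-∀
  negates : ∀ c a b → w (turn (c , (a , b))) + w (flip-swap (turn (c , (a , b)))) ≡ - (w (c , (a , b)) + w (flip-swap (c , (a , b))))
  negates c a b = begin
    w (turn (c , (a , b))) + w (flip-swap (turn (c , (a , b))))
      ≡⟨ inW (- c - + 2 * b - + 2) (a - b - c - + 1) b ⟩
    W (+ 2 * (- c - + 2 * b - + 2) + + 1) (+ 2 * (a - b - c - + 1) + + 1) z
      ≡⟨ cong₂ (λ x y → W x y z) (turned₁ b c) (turned₂ a b c) ⟩
    W (- x - + 2 * z) (y - x - z) z
      ≡⟨ negation x y z ⟩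
    - W x y z
      ≡⟨ cong -_ (inW c a b) ⟨
    - (w (c , (a , b)) + w (flip-swap (c , (a , b)))) ∎
    where
    x = + 2 * c + + 1
    y = + 2 * a + + 1
    z = + 2 * b + + 1

-- The exponents are yz - 1 and (x² - 1)/4, so the two sides differ by the weight y(yz - 1) - y(x² -
-- 1) = y(yz - x²), which is `mainWeight`.
windmill-equation : oddSeries′ ⊛ D divisorSeries ≈ + 4 · (divisorSeries ⊛ D oddSeries′)
windmill-equation n = begin
  (oddSeries′ ⊛ D divisorSeries) n
    ≡⟨ trans (⊛-congʳ oddSeries′ (D-coeff factorisations firstFactor) n)
         (sym (coeff-⊗ oddSquares′ factorisations one (λ z → factorExponent z * firstFactor z) n)) ⟩
  ∑ E (λ (c , ab) → + 1 * (factorExponent ab * firstFactor ab))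
    ≡⟨ trans (∑-cong E (λ (c , (a , b)) _ → weight c a b)) (∑-+ E mainWeight (λ z → + 4 * v z)) ⟩
  ∑ E mainWeight + ∑ E (λ z → + 4 * v z)
    ≡⟨ cong₂ _+_ (∑-mainWeight n) (∑-* E (+ 4) v) ⟩
  + 0 + + 4 * ∑ E v
    ≡⟨ trans (ℤP.+-identityˡ _) (cong (_*_ (+ 4)) (trans
         (coeff-⊗ oddSquares′ factorisations (λ c → exponent oddSquares′ c * + 1) firstFactor n)
         (trans (⊛-comm _ divisorSeries n) (sym (⊛-congʳ divisorSeries (D-coeff oddSquares′ one) n))))) ⟩
  + 4 * (divisorSeries ⊛ D oddSeries′) n ∎
  where
  open ≡-Reasoning
  E = level windmill n
  v : ℤ × (ℤ × ℤ) → ℤ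
  v (c , ab) = exponent oddSquares′ c * + 1 * firstFactor ab
  weight : ∀ c a b → + 1 * ((+ 4 * (a * b) + + 2 * a + + 2 * b) * (+ 2 * a + + 1)) ≡
    (+ 2 * a + + 1) * ((+ 2 * a + + 1) * (+ 2 * b + + 1) - (+ 2 * c + + 1) * (+ 2 * c + + 1))
    + + 4 * ((+ 0 * (c * c) + + 1 * (c * c + c) + + 0) * + 1 * (+ 2 * a + + 1))
  weight = solve-∀

-- The windmill maps need x of both signs, which doubles the series of odd squares; the equation is
-- linear in that series, so the factor 2 cancels.
divisor-equation : oddSeries ⊛ D divisorSeries ≈ + 4 · (divisorSeries ⊛ D oddSeries)
divisor-equation n = ℤP.*-cancelˡ-≡ (+ 2) _ _ (begin
  + 2 * (oddSeries ⊛ D divisorSeries) n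
    ≡⟨ trans (⊛-cong {d = D divisorSeries} oddSeries′≈ (λ _ → refl) n) (·-⊛ (+ 2) oddSeries (D divisorSeries) n) ⟨
  (oddSeries′ ⊛ D divisorSeries) n
    ≡⟨ windmill-equation n ⟩
  + 4 * (divisorSeries ⊛ D oddSeries′) n
    ≡⟨ cong (_*_ (+ 4)) (trans (⊛-congʳ {D oddSeries′} {+ 2 · D oddSeries} divisorSeries (λ i → trans (cong (_*_ (+ i)) (oddSeries′≈ i)) (commute (+ i) (oddSeries i))) n)
         (trans (⊛-comm divisorSeries (+ 2 · D oddSeries) n) (trans (·-⊛ (+ 2) (D oddSeries) divisorSeries n)
           (cong (_*_ (+ 2)) (⊛-comm (D oddSeries) divisorSeries n))))) ⟩
  + 4 * (+ 2 * (divisorSeries ⊛ D oddSeries) n)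
    ≡⟨ commute (+ 4) ((divisorSeries ⊛ D oddSeries) n) ⟩
  + 2 * (+ 4 * (divisorSeries ⊛ D oddSeries) n) ∎)
  where
  open ≡-Reasoning
  commute : ∀ i x → i * (+ 2 * x) ≡ + 2 * (i * x)
  commute = solve-∀

four-odd-squares : oddSeries ⊛ (oddSeries ⊛ (oddSeries ⊛ oddSeries)) ≈ divisorSeries
four-odd-squares = power-unique (+ 4) oddSeries _ divisorSeries refl refl (D-fourth oddSeries) divisor-equation

-- The list is the one inside `σ₁`, so that summing over it gives `σ₁` by unfolding.
divisors : ∀ m .{{_ : ℕ.NonZero m}} → Enumeration (_∣ m)
divisors m = record
  { elements = filter (_∣? m) (map suc (upTo m))
  ; unique   = Uniqueₚ.filter⁺ (_∣? m) (Uniqueₚ.map⁺ ℕP.suc-injective (Uniqueₚ.upTo⁺ m))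
  ; sound    = λ d∈ → proj₂ (∈-filter⁻ (_∣? m) {xs = map suc (upTo m)} d∈)
  ; complete = λ d∣m → ∈-filter⁺ (_∣? m) (candidate _ d∣m (∣.∣⇒≤ d∣m)) d∣m
  }
  where
  candidate : ∀ d → d ∣ m → d ℕ.≤ m → d ∈ map suc (upTo m)
  candidate zero    0∣m _   = ⊥-elim (ℕ.≢-nonZero⁻¹ m (∣.0∣⇒≡0 0∣m))
  candidate (suc d) _   d≤m = ∈-map⁺ suc (∈-upTo⁺ d≤m)

Sum-ℕ : ∀ xs → Sum xs (λ d → + d) ≡ + sum xs
Sum-ℕ []       = refl
Sum-ℕ (x ∷ xs) = cong (_+_ (+ x)) (Sum-ℕ xs)

∑-divisors : ∀ m .{{_ : ℕ.NonZero m}} → ∑ (divisors m) (λ d → + d) ≡ + σ₁ m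
∑-divisors m = Sum-ℕ (elements (divisors m))

odd-divisor : ∀ {d m} → Odd m → d ∣ m → ∃ λ k → d ≡ suc (k ℕ.+ k)
odd-divisor {d} {m} (o , odd) (divides e eq) = by d (parity (+ d)) refl
  where
  by : ∀ d′ → Parity (+ d′) → d′ ≡ d → ∃ λ k → d′ ≡ suc (k ℕ.+ k)
  by d′ (inj₁ (h , even)) refl = ⊥-elim (even≢odd (+ e * h) o (trans (sym (ℤP.*-distribˡ-+ (+ e) h h))
    (trans (cong (_*_ (+ e)) (sym even)) (trans (sym (ℤP.pos-* e d)) (trans (cong +_ (sym eq)) odd)))))
  by d′ (inj₂ (+ k , eq)) _ = k , ℤP.+-injective eq
  by d′ (inj₂ (-[1+ k ] , ())) _

divisorSeries-σ₁ : ∀ j → Odd (suc j) → divisorSeries j ≡ + σ₁ (suc j)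
divisorSeries-σ₁ j odd = trans (∑-cong (level factorisations j) weight)
  (trans (reindex (level factorisations j) (divisors (suc j)) factor into injective onto (λ d → + d)) (∑-divisors (suc j)))
  where
  P : ℤ × ℤ → Set
  P z = Nonneg² z × factorExponent z ≡ + j
  factor : ℤ × ℤ → ℕ
  factor (a , _) = suc (∣ a ∣ ℕ.+ ∣ a ∣)
  weight : ∀ z → P z → firstFactor z ≡ + factor z
  weight (+ a , b) _ = trans (cong (_+ + 1) (sym (ℤP.pos-* 2 a))) (cong +_ (shape a))
    where
    shape : ∀ a → 2 ℕ.* a ℕ.+ 1 ≡ suc (a ℕ.+ a)
    shape = ℕ-solve-∀
  weight (-[1+ _ ] , _) ((() , _) , _)
  product : ∀ a b → suc (4 ℕ.* (a ℕ.* b) ℕ.+ 2 ℕ.* a ℕ.+ 2 ℕ.* b) ≡ suc (b ℕ.+ b) ℕ.* suc (a ℕ.+ a)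
  product = ℕ-solve-∀
  level-eq : ∀ a b → P (+ a , + b) → suc j ≡ suc (b ℕ.+ b) ℕ.* suc (a ℕ.+ a)
  level-eq a b (_ , eq) = trans (cong suc (ℤP.+-injective (trans (sym eq) (factorExponentℕ a b)))) (product a b)
  into : ∀ z → P z → factor z ∣ suc j
  into (+ a , + b) p = divides (suc (b ℕ.+ b)) (level-eq a b p)
  into (+ _ , -[1+ _ ]) ((_ , ()) , _)
  into (-[1+ _ ] , _) ((() , _) , _)
  halves : ∀ a b → suc (a ℕ.+ a) ≡ suc (b ℕ.+ b) → a ≡ b
  halves a b eq = ℤP.+-injective (double-injective (+ a) (+ b) (cong +_ (ℕP.suc-injective eq)))
  injective : ∀ z w → P z → P w → factor z ≡ factor w → z ≡ w
  injective (+ a , + b) (+ a′ , + b′) p q eq with refl ← halves a a′ eq =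
    cong (λ b → + a , + b) (halves b b′ (ℕP.*-cancelʳ-≡ (suc (b ℕ.+ b)) (suc (b′ ℕ.+ b′)) (suc (a ℕ.+ a))
      (trans (sym (level-eq a b p)) (level-eq a b′ q))))
  injective (+ _ , -[1+ _ ]) _ ((_ , ()) , _) _ _
  injective (-[1+ _ ] , _) _ ((() , _) , _) _ _
  injective (+ _ , + _) (+ _ , -[1+ _ ]) _ ((_ , ()) , _) _
  injective (+ _ , + _) (-[1+ _ ] , _) _ ((() , _) , _) _
  onto : ∀ d → d ∣ suc j → ∃ λ z → P z × factor z ≡ d
  onto d d∣m@(divides e eq) with odd-divisor odd d∣m | odd-divisor odd (divides d (trans eq (ℕP.*-comm e d)))
  ... | a , refl | b , refl = (+ a , + b) , ((ℤ.+≤+ z≤n , ℤ.+≤+ z≤n) ,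
    trans (factorExponentℕ a b) (cong +_ (ℕP.suc-injective (trans (product a b) (sym eq))))) , refl

-- Sums of four squares congruent to 1 modulo 3

not-third : ∀ c d {_ : False (3 ∣? ∣ d ∣)} → + 3 * c ≢ d
not-third c d {3∤d} eq = toWitnessFalse 3∤d (divides ∣ c ∣
  (trans (cong ∣_∣ (sym eq)) (trans (ℤP.abs-* (+ 3) c) (ℕP.*-comm 3 ∣ c ∣))))

pentagonalSeries thirdsSeries thirdsSeries′ : PowerSeries
pentagonalSeries = coeff pentagonal one
thirdsSeries  = coeff thirdsOddSquares one
thirdsSeries′ = coeff thirdsOddSquares′ one

thirdsSeries′≈ : thirdsSeries′ ≈ + 2 · thirdsSeries
thirdsSeries′≈ = coeff-halves thirdsOddSquares thirdsOddSquares′ (λ _ → tt) (λ _ → tt) even odd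
  where
  even : ∀ k → + 0 * ((k + k) * (k + k)) + + 9 * ((k + k) * (k + k) + (k + k)) + + 2 ≡ + 18 * (k * k) + + 18 * (k * k + k) + + 2
  even = solve-∀
  odd : ∀ k → + 0 * (- (+ 1 + (k + k)) * - (+ 1 + (k + k))) + + 9 * (- (+ 1 + (k + k)) * - (+ 1 + (k + k)) + - (+ 1 + (k + k))) + + 2
    ≡ + 18 * (k * k) + + 18 * (k * k + k) + + 2
  odd = solve-∀

-- 4m+1 = ±(6k+1)
fromPentagonal : ℤ → ℤ
fromPentagonal = byParity (λ h → + 3 * h) (λ h → - (+ 3 * h) - + 2)

fromPentagonal-even : ∀ h → fromPentagonal (h + h) ≡ + 3 * h
fromPentagonal-even = byParity-even (λ h → + 3 * h) (λ h → - (+ 3 * h) - + 2)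

fromPentagonal-odd : ∀ h → fromPentagonal (+ 1 + (h + h)) ≡ - (+ 3 * h) - + 2
fromPentagonal-odd = byParity-odd (λ h → + 3 * h) (λ h → - (+ 3 * h) - + 2)

pentagonal-cases : (R : ℤ → ℤ → Set) → (∀ h → R (h + h) (+ 3 * h)) → (∀ h → R (+ 1 + (h + h)) (- (+ 3 * h) - + 2)) →
  ∀ k → R k (fromPentagonal k)
pentagonal-cases R even odd k = by (parity k)
  where
  by : Parity k → R k (fromPentagonal k)
  by (inj₁ (h , refl)) = subst (R (h + h)) (sym (fromPentagonal-even h)) (even h)
  by (inj₂ (h , refl)) = subst (R (+ 1 + (h + h))) (sym (fromPentagonal-odd h)) (odd h)

-- 4m + 1 is divisible by 3 only for m = -3j - 1, where it equals -3(4j + 1); every other 4m + 1 is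
-- ±(6k + 1) for a unique k.
oddSeries-split : oddSeries ≈ pentagonalSeries ⊕ thirdsSeries
oddSeries-split n = ∑-split (level oddSquares n) (level pentagonal n) (level thirdsOddSquares n)
  fromPentagonal (λ j → - (+ 3 * j) - + 1)
  (λ k (_ , eq) → tt , trans (exponent₁ k) eq) (λ j (_ , eq) → tt , trans (exponent₂ j) eq)
  (λ k l _ _ eq → injective l k eq)
  (λ i j _ _ eq → ℤP.*-cancelˡ-≡ (+ 3) i j (ℤP.neg-injective (ℤRing.+-cancelʳ (- + 1) _ _ eq)))
  (λ k j _ _ → disjoint j k)
  (λ m (_ , eq) → cover m eq (thirds m)) one
  where
  e₁ : ∀ h → + 2 * (+ 3 * h * (+ 3 * h)) + + 2 * (+ 3 * h * (+ 3 * h) + + 3 * h) + + 0 ≡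
    + 6 * ((h + h) * (h + h)) + + 3 * ((h + h) * (h + h) + (h + h)) + + 0
  e₁ = solve-∀
  e₂ : ∀ h → + 2 * ((- (+ 3 * h) - + 2) * (- (+ 3 * h) - + 2)) + + 2 * ((- (+ 3 * h) - + 2) * (- (+ 3 * h) - + 2) + (- (+ 3 * h) - + 2)) + + 0 ≡
    + 6 * ((+ 1 + (h + h)) * (+ 1 + (h + h))) + + 3 * ((+ 1 + (h + h)) * (+ 1 + (h + h)) + (+ 1 + (h + h))) + + 0
  e₂ = solve-∀
  exponent₁ : ∀ k → exponent oddSquares (fromPentagonal k) ≡ exponent pentagonal k
  exponent₁ = pentagonal-cases (λ k m → exponent oddSquares m ≡ exponent pentagonal k) e₁ e₂
  exponent₂ : ∀ j → + 2 * ((- (+ 3 * j) - + 1) * (- (+ 3 * j) - + 1)) + + 2 * ((- (+ 3 * j) - + 1) * (- (+ 3 * j) - + 1) + (- (+ 3 * j) - + 1)) + + 0 ≡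
    + 18 * (j * j) + + 18 * (j * j + j) + + 2
  exponent₂ = solve-∀
  clash : ∀ {x y} g h → x ≡ y → + 3 * (g + h) ≡ x - y + - + 2 → ⊥
  clash {x} g h refl eq = not-third (g + h) (- + 2) (trans eq (trans (cong (_+ - + 2) (ℤP.+-inverseʳ x)) (ℤP.+-identityˡ _)))
  difference : ∀ g h → + 3 * (g + h) ≡ + 3 * g - (- (+ 3 * h) - + 2) + - + 2
  difference = solve-∀
  injective : ∀ l k → fromPentagonal k ≡ fromPentagonal l → k ≡ l
  injective l = pentagonal-cases (λ k m → m ≡ fromPentagonal l → k ≡ l)
    (λ g → pentagonal-cases (λ l m → + 3 * g ≡ m → g + g ≡ l)
      (λ h eq → cong (λ h → h + h) (ℤP.*-cancelˡ-≡ (+ 3) g h eq))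
      (λ h eq → ⊥-elim (clash g h eq (difference g h))) l)
    (λ g → pentagonal-cases (λ l m → - (+ 3 * g) - + 2 ≡ m → + 1 + (g + g) ≡ l)
      (λ h eq → ⊥-elim (clash h g (sym eq) (difference h g)))
      (λ h eq → cong (λ h → + 1 + (h + h)) (ℤP.*-cancelˡ-≡ (+ 3) g h (ℤP.neg-injective (ℤRing.+-cancelʳ (- + 2) _ _ eq)))) l)
  disjoint : ∀ j k → fromPentagonal k ≢ - (+ 3 * j) - + 1
  disjoint j = pentagonal-cases (λ _ m → m ≢ - (+ 3 * j) - + 1)
    (λ h eq → not-third (h + j) (- + 1) (trans (ℤP.*-distribˡ-+ (+ 3) h j) (trans (cong (_+ + 3 * j) eq) (cancel₁ j))))
    (λ h eq → not-third (j - h) (+ 1) (trans (cancel₂ j h) (trans (cong (λ x → + 3 * j + x + + 2) eq) (cancel₃ j))))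
    where
    cancel₁ : ∀ j → - (+ 3 * j) - + 1 + + 3 * j ≡ - + 1
    cancel₁ = solve-∀
    cancel₂ : ∀ j h → + 3 * (j - h) ≡ + 3 * j + (- (+ 3 * h) - + 2) + + 2
    cancel₂ = solve-∀
    cancel₃ : ∀ j → + 3 * j + (- (+ 3 * j) - + 1) + + 2 ≡ + 1
    cancel₃ = solve-∀
  cover : ∀ m → exponent oddSquares m ≡ + n →
    Thirds m →
    (∃ λ k → (⊤ × exponent pentagonal k ≡ + n) × fromPentagonal k ≡ m) ⊎
    (∃ λ j → (⊤ × exponent thirdsOddSquares j ≡ + n) × - (+ 3 * j) - + 1 ≡ m)
  cover m eq (inj₁ (t , m≡)) = inj₁ (t + t ,
    (tt , trans (sym (exponent₁ (t + t))) (trans (cong (exponent oddSquares) (trans (fromPentagonal-even t) (sym m≡))) eq)) ,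
    trans (fromPentagonal-even t) (sym m≡))
  cover m eq (inj₂ (inj₁ (t , m≡))) = inj₁ (+ 1 + (h + h) ,
    (tt , trans (sym (exponent₁ (+ 1 + (h + h)))) (trans (cong (exponent oddSquares) from) eq)) , from)
    where
    h = - t - + 1
    shape : ∀ t → - (+ 3 * (- t - + 1)) - + 2 ≡ + 3 * t + + 1
    shape = solve-∀
    from : fromPentagonal (+ 1 + (h + h)) ≡ m
    from = trans (fromPentagonal-odd h) (trans (shape t) (sym m≡))
  cover m eq (inj₂ (inj₂ (t , m≡))) = inj₂ (t ,
    (tt , trans (sym (exponent₂ t)) (trans (cong (exponent oddSquares) from) eq)) , from)
    where
    shape : ∀ t → - (+ 3 * t) - + 1 ≡ - (+ 3 * t + + 1)
    shape = solve-∀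
    from : - (+ 3 * t) - + 1 ≡ m
    from = trans (shape t) (sym m≡)

-- Quadruples, the reflection and the Hadamard map

ℤ⁴ : Set
ℤ⁴ = ℤ × (ℤ × (ℤ × ℤ))

sum⁴ : ℤ⁴ → ℤ
sum⁴ (k₁ , (k₂ , (k₃ , k₄))) = k₁ + k₂ + k₃ + k₄

-- For yᵢ = 6kᵢ + 1 half of Σ yᵢ is 3 Σ kᵢ + 2. Its parity decides whether the reflection of y/2 is
-- integral.
OddSum : ℤ⁴ → Set
OddSum z = ∃ λ h → sum⁴ z ≡ + 1 + (h + h)

oddSum? : Decidable OddSum
oddSum? z = by (parity (sum⁴ z))
  where
  by : Parity (sum⁴ z) → Dec (OddSum z)
  by (inj₁ (g , even)) = no λ (h , odd) → even≢odd g h (trans (sym even) odd)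
  by (inj₂ odd) = yes odd

half : ℤ → ℤ
half = byParity id id

half-odd : ∀ z ((h , _) : OddSum z) → half (sum⁴ z) ≡ h
half-odd z (h , eq) = trans (cong half eq) (byParity-odd id id h)

F⁴ : Family ℤ → Family ℤ⁴
F⁴ F = F ⊗ F ⊗ F ⊗ F

tensor⁴ : (ℤ → ℤ) → ℤ⁴ → ℤ
tensor⁴ w (k₁ , (k₂ , (k₃ , k₄))) = w k₁ * (w k₂ * (w k₃ * w k₄))

coeff-⁴ : ∀ F w → coeff (F⁴ F) (tensor⁴ w) ≈ coeff F w ⊛ (coeff F w ⊛ (coeff F w ⊛ coeff F w))
coeff-⁴ F w n = trans (coeff-⊗ F (F ⊗ F ⊗ F) w (λ (k , (l , m)) → w k * (w l * w m)) n)
  (⊛-congʳ (coeff F w) (λ n → trans (coeff-⊗ F (F ⊗ F) w (λ (k , l) → w k * w l) n)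
    (⊛-congʳ (coeff F w) (coeff-⊗ F F w w) n)) n)

representations : Family ℤ⁴
representations = F⁴ oneModThree

-- The reflection k ↦ k - (Σk + 1)/2 · (1,1,1,1).
reflect-by : ℤ → ℤ⁴ → ℤ⁴
reflect-by w (k₁ , (k₂ , (k₃ , k₄))) = k₁ - w , (k₂ - w , (k₃ - w , k₄ - w))

reflect : ℤ⁴ → ℤ⁴
reflect z = reflect-by (half (sum⁴ z) + + 1) z

reflect-odd : ∀ z ((h , _) : OddSum z) → reflect z ≡ reflect-by (h + + 1) z
reflect-odd z odd = cong (λ h → reflect-by (h + + 1) z) (half-odd z odd)

reflect-oddSum : ∀ z → OddSum z → OddSum (reflect z)
reflect-oddSum z@(k₁ , (k₂ , (k₃ , k₄))) odd@(h , eq) = - h - + 2 , (begin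
  sum⁴ (reflect z)  ≡⟨ trans (cong sum⁴ (reflect-odd z odd)) (shape k₁ k₂ k₃ k₄ (h + + 1)) ⟩
  sum⁴ z - + 4 * (h + + 1)  ≡⟨ trans (cong (_- + 4 * (h + + 1)) eq) (shape′ h) ⟩
  + 1 + ((- h - + 2) + (- h - + 2))  ∎)
  where
  open ≡-Reasoning
  shape : ∀ a b c d w → a - w + (b - w) + (c - w) + (d - w) ≡ a + b + c + d - + 4 * w
  shape = solve-∀
  shape′ : ∀ h → + 1 + (h + h) - + 4 * (h + + 1) ≡ + 1 + ((- h - + 2) + (- h - + 2))
  shape′ = solve-∀

reflect-involutive : ∀ z → OddSum z → reflect (reflect z) ≡ z
reflect-involutive z@(k₁ , (k₂ , (k₃ , k₄))) odd@(h , _) =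
  trans (reflect-odd (reflect z) (reflect-oddSum z odd))
    (trans (cong (reflect-by (- h - + 2 + + 1)) (reflect-odd z odd))
      (cong₂ _,_ (back k₁ h) (cong₂ _,_ (back k₂ h) (cong₂ _,_ (back k₃ h) (back k₄ h)))))
  where
  back : ∀ k h → k - (h + + 1) - (- h - + 2 + + 1) ≡ k
  back = solve-∀

-- For y = 6k + 1 the entries 3u + 1 of the image are y/2 - (Σ y)/4: the vector y/2 reflected in the
-- hyperplane orthogonal to (1,1,1,1), hence of the same squared length Σ y²/4.
reflect-exponent : ∀ z → OddSum z → exponent representations (reflect z) ≡ + 1 + exponent (F⁴ pentagonal) z
reflect-exponent z@(k₁ , (k₂ , (k₃ , k₄))) odd@(h , eq) = begin
  exponent representations (reflect z)
    ≡⟨ trans (cong (exponent representations) (reflect-odd z odd))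
         (cong₂ _+_ (shifted k₁ w) (cong₂ _+_ (shifted k₂ w) (cong₂ _+_ (shifted k₃ w) (shifted k₄ w)))) ⟩
  q k₁ + (+ 3 * k₁ - + 18 * w * k₁ + e) + (q k₂ + (+ 3 * k₂ - + 18 * w * k₂ + e) +
  (q k₃ + (+ 3 * k₃ - + 18 * w * k₃ + e) + (q k₄ + (+ 3 * k₄ - + 18 * w * k₄ + e))))
    ≡⟨ gather (q k₁) (q k₂) (q k₃) (q k₄) k₁ k₂ k₃ k₄ w e ⟩
  Q + (+ 3 - + 18 * w) * sum⁴ z + + 4 * e
    ≡⟨ cong (λ s → Q + (+ 3 - + 18 * w) * s + + 4 * e) eq ⟩
  Q + (+ 3 - + 18 * w) * (+ 1 + (h + h)) + + 4 * e
    ≡⟨ collect Q h ⟩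
  + 1 + Q ∎
  where
  open ≡-Reasoning
  w = h + + 1
  e = + 9 * (w * w) - + 6 * w + + 1
  q = exponent pentagonal
  Q = exponent (F⁴ pentagonal) z
  shifted : ∀ k w → + 3 * ((k - w) * (k - w)) + + 6 * ((k - w) * (k - w) + (k - w)) + + 1 ≡
    + 6 * (k * k) + + 3 * (k * k + k) + + 0 + (+ 3 * k - + 18 * w * k + (+ 9 * (w * w) - + 6 * w + + 1))
  shifted = solve-∀
  gather : ∀ q₁ q₂ q₃ q₄ k₁ k₂ k₃ k₄ w e →
    q₁ + (+ 3 * k₁ - + 18 * w * k₁ + e) + (q₂ + (+ 3 * k₂ - + 18 * w * k₂ + e) +
    (q₃ + (+ 3 * k₃ - + 18 * w * k₃ + e) + (q₄ + (+ 3 * k₄ - + 18 * w * k₄ + e)))) ≡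
    (q₁ + (q₂ + (q₃ + q₄))) + (+ 3 - + 18 * w) * (k₁ + k₂ + k₃ + k₄) + + 4 * e
  gather = solve-∀
  collect : ∀ Q h → Q + (+ 3 - + 18 * (h + + 1)) * (+ 1 + (h + h)) + + 4 * (+ 9 * ((h + + 1) * (h + + 1)) - + 6 * (h + + 1) + + 1) ≡ + 1 + Q
  collect = solve-∀

-- (3k + 1)² has the parity of k + 1, so n has the parity of Σ kᵢ and the image of the odd sums is
-- everything.
representation-odd : ∀ {n} → Odd n → ∀ z → exponent representations z ≡ + n → OddSum z
representation-odd {n} (o , odd) z@(k₁ , (k₂ , (k₃ , k₄))) eq = by (parity (sum⁴ z))
  where
  pieces : ∀ k → + 3 * (k * k) + + 6 * (k * k + k) + + 1 ≡ k + + 1 + (+ 8 * (k * k) + + 6 * k + (k * k - k))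
  pieces = solve-∀
  consecutive : ∀ k → ∃ λ h → k * k - k ≡ h + h
  consecutive k = go (parity k)
    where
    go : Parity k → ∃ λ h → k * k - k ≡ h + h
    go (inj₁ (h , refl)) = + 2 * (h * h) - h , e h
      where
      e : ∀ h → (h + h) * (h + h) - (h + h) ≡ (+ 2 * (h * h) - h) + (+ 2 * (h * h) - h)
      e = solve-∀
    go (inj₂ (h , refl)) = + 2 * (h * h) + h , e h
      where
      e : ∀ h → (+ 1 + (h + h)) * (+ 1 + (h + h)) - (+ 1 + (h + h)) ≡ (+ 2 * (h * h) + h) + (+ 2 * (h * h) + h)
      e = solve-∀
  piece : ∀ k → ∃ λ h → exponent oneModThree k ≡ k + + 1 + (h + h)
  piece k = let h , e = consecutive k in + 4 * (k * k) + + 3 * k + h ,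
    trans (pieces k) (trans (cong (λ c → k + + 1 + (+ 8 * (k * k) + + 6 * k + c)) e) (shape k h))
    where
    shape : ∀ k h → k + + 1 + (+ 8 * (k * k) + + 6 * k + (h + h)) ≡ k + + 1 + ((+ 4 * (k * k) + + 3 * k + h) + (+ 4 * (k * k) + + 3 * k + h))
    shape = solve-∀
  total : ∀ k₁ k₂ k₃ k₄ h₁ h₂ h₃ h₄ → k₁ + + 1 + (h₁ + h₁) + (k₂ + + 1 + (h₂ + h₂) + (k₃ + + 1 + (h₃ + h₃) + (k₄ + + 1 + (h₄ + h₄)))) ≡
    k₁ + k₂ + k₃ + k₄ + ((+ 2 + h₁ + h₂ + h₃ + h₄) + (+ 2 + h₁ + h₂ + h₃ + h₄))
  total = solve-∀
  H : ℤ
  H = + 2 + proj₁ (piece k₁) + proj₁ (piece k₂) + proj₁ (piece k₃) + proj₁ (piece k₄)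
  congruent : exponent representations z ≡ sum⁴ z + (H + H)
  congruent = trans (cong₂ _+_ (proj₂ (piece k₁)) (cong₂ _+_ (proj₂ (piece k₂)) (cong₂ _+_ (proj₂ (piece k₃)) (proj₂ (piece k₄)))))
    (total k₁ k₂ k₃ k₄ (proj₁ (piece k₁)) (proj₁ (piece k₂)) (proj₁ (piece k₃)) (proj₁ (piece k₄)))
  by : Parity (sum⁴ z) → OddSum z
  by (inj₂ oddSum) = oddSum
  by (inj₁ (h , even)) = ⊥-elim (even≢odd (h + H) o (trans (interchange h H) (trans (cong (_+ (H + H)) (sym even))
    (trans (sym congruent) (trans eq odd)))))
    where
    interchange : ∀ h H → (h + H) + (h + H) ≡ (h + h) + (H + H)
    interchange = solve-∀

-- Both sides have coordinates in ℤ⁴ and ρ is an involution on the odd sums, so the same map serves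
-- as its own inverse between the two families.
∑-oddSum : ∀ (G : Family ℤ⁴) (ρ : ℤ⁴ → ℤ⁴) → (∀ z → member G z) →
  (∀ z → OddSum z → OddSum (ρ z)) → (∀ z → OddSum z → ρ (ρ z) ≡ z) →
  (∀ z → OddSum z → exponent representations (ρ z) ≡ + 1 + exponent G z) →
  ∀ j → Odd (suc j) → ∀ v → ∑ (restrict (level G j) oddSum?) (v ∘ ρ) ≡ ∑ (level representations (suc j)) v
∑-oddSum G ρ all preserves involutive exponents j odd = reindex (restrict (level G j) oddSum?) (level representations (suc j)) ρ
  (λ z ((_ , eq) , oddSum) → (tt , (tt , (tt , tt))) , trans (exponents z oddSum) (cong (_+_ (+ 1)) eq))
  (λ z w (_ , p) (_ , q) eq → trans (sym (involutive z p)) (trans (cong ρ eq) (involutive w q)))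
  (λ z (_ , eq) → let oddSum = representation-odd odd z eq in
    ρ z ,
    ((all (ρ z) , ℤRing.+-cancelˡ (+ 1) _ (+ j)
      (trans (sym (exponents (ρ z) (preserves z oddSum)))
        (trans (cong (exponent representations) (involutive z oddSum)) eq))) ,
      preserves z oddSum) ,
    involutive z oddSum)

representationSeries : PowerSeries
representationSeries = coeff representations one

sgn-+ : ∀ k l → sgn (k + l) ≡ sgn k * sgn l
sgn-+ k l = by (parity k) (parity l)
  where
  ee : ∀ g h → (g + g) + (h + h) ≡ (g + h) + (g + h)
  ee = solve-∀
  eo : ∀ g h → (g + g) + (+ 1 + (h + h)) ≡ + 1 + ((g + h) + (g + h))
  eo = solve-∀
  oe : ∀ g h → (+ 1 + (g + g)) + (h + h) ≡ + 1 + ((g + h) + (g + h))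
  oe = solve-∀
  oo : ∀ g h → (+ 1 + (g + g)) + (+ 1 + (h + h)) ≡ (+ 1 + g + h) + (+ 1 + g + h)
  oo = solve-∀
  by : Parity k → Parity l →
    sgn (k + l) ≡ sgn k * sgn l
  by (inj₁ (g , refl)) (inj₁ (h , refl)) = trans (trans (cong sgn (ee g h)) (sgn-even (g + h))) (sym (cong₂ _*_ (sgn-even g) (sgn-even h)))
  by (inj₁ (g , refl)) (inj₂ (h , refl)) = trans (trans (cong sgn (eo g h)) (sgn-odd (g + h))) (sym (cong₂ _*_ (sgn-even g) (sgn-odd h)))
  by (inj₂ (g , refl)) (inj₁ (h , refl)) = trans (trans (cong sgn (oe g h)) (sgn-odd (g + h))) (sym (cong₂ _*_ (sgn-odd g) (sgn-even h)))
  by (inj₂ (g , refl)) (inj₂ (h , refl)) = trans (trans (cong sgn (oo g h)) (sgn-even (+ 1 + g + h))) (sym (cong₂ _*_ (sgn-odd g) (sgn-odd h)))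

tensor⁴-sgn : ∀ z → tensor⁴ sgn z ≡ sgn (sum⁴ z)
tensor⁴-sgn (k₁ , (k₂ , (k₃ , k₄))) = begin
  sgn k₁ * (sgn k₂ * (sgn k₃ * sgn k₄))  ≡⟨ trans (cong (_*_ (sgn k₁)) (sym (ℤP.*-assoc (sgn k₂) (sgn k₃) (sgn k₄)))) (trans
      (sym (ℤP.*-assoc (sgn k₁) (sgn k₂ * sgn k₃) (sgn k₄))) (cong (_* sgn k₄) (sym (ℤP.*-assoc (sgn k₁) (sgn k₂) (sgn k₃))))) ⟩
  sgn k₁ * sgn k₂ * sgn k₃ * sgn k₄  ≡⟨ cong (λ s → s * sgn k₃ * sgn k₄) (sgn-+ k₁ k₂) ⟨
  sgn (k₁ + k₂) * sgn k₃ * sgn k₄  ≡⟨ cong (_* sgn k₄) (sgn-+ (k₁ + k₂) k₃) ⟨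
  sgn (k₁ + k₂ + k₃) * sgn k₄  ≡⟨ sgn-+ (k₁ + k₂ + k₃) k₄ ⟨
  sgn (k₁ + k₂ + k₃ + k₄)  ∎
  where open ≡-Reasoning

evenSum : ∀ z → ¬ OddSum z → ∃ λ h → sum⁴ z ≡ h + h
evenSum z notOdd = [ id , ⊥-elim ∘ notOdd ]′ (parity (sum⁴ z))

-- The sign of a quadruple is (-1)^(Σ k), so the weight 1 exceeds it by 2 on odd sums and by 0 on
-- even ones; the reflection turns the odd sums into representations.
pentagonal⁴-a : ∀ j → Odd (suc j) →
  (pentagonalSeries ⊛ (pentagonalSeries ⊛ (pentagonalSeries ⊛ pentagonalSeries))) j ≡
  a (suc j) + + 2 * representationSeries (suc j)
pentagonal⁴-a j odd = begin
  (pentagonalSeries ⊛ (pentagonalSeries ⊛ (pentagonalSeries ⊛ pentagonalSeries))) j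
    ≡⟨ coeff-⁴ pentagonal one j ⟨
  ∑ E (tensor⁴ one)
    ≡⟨ ∑-cong E (λ z _ → split (sgn (sum⁴ z)) (tensor⁴-sgn z)) ⟩
  ∑ E (λ z → tensor⁴ sgn z + d z)
    ≡⟨ ∑-+ E (tensor⁴ sgn) d ⟩
  ∑ E (tensor⁴ sgn) + ∑ E d
    ≡⟨ cong₂ _+_ (trans (coeff-⁴ pentagonal sgn j) (sym (a-euler j))) (trans (∑-restrict E oddSum? d)
         (trans (cong₂ _+_ oddPart evenPart) (ℤP.+-identityʳ _))) ⟩
  a (suc j) + + 2 * representationSeries (suc j) ∎
  where
  open ≡-Reasoning
  E = level (F⁴ pentagonal) j
  d : ℤ⁴ → ℤ
  d z = + 1 - sgn (sum⁴ z)
  split : ∀ {t} s → t ≡ s → + 1 ≡ t + (+ 1 - s)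
  split s refl = cancel s
    where
    cancel : ∀ s → + 1 ≡ s + (+ 1 - s)
    cancel = solve-∀
  oddPart : ∑ (restrict E oddSum?) d ≡ + 2 * representationSeries (suc j)
  oddPart = trans (∑-cong (restrict E oddSum?) (λ z (_ , (h , eq)) → cong (λ s → + 1 - s) (trans (cong sgn eq) (sgn-odd h))))
    (trans (∑-oddSum (F⁴ pentagonal) reflect (λ _ → tt , (tt , (tt , tt))) reflect-oddSum reflect-involutive reflect-exponent j odd (λ _ → + 2))
      (∑-* (level representations (suc j)) (+ 2) one))
  evenPart : ∑ (restrict E (¬? ∘ oddSum?)) d ≡ + 0
  evenPart = ∑-zero (restrict E (¬? ∘ oddSum?)) (λ z (_ , notOdd) → let h , eq = evenSum z notOdd in
    cong (λ s → + 1 - s) (trans (cong sgn eq) (sgn-even h)))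

mixed : Family ℤ⁴
mixed = pentagonal ⊗ thirdsOddSquares′ ⊗ thirdsOddSquares′ ⊗ thirdsOddSquares′

-- The orthogonal map (k , c) ↦ half of the Hadamard matrix, in the coordinates 6k+1, 3(2c+1) and 3u+1.
hadamard-by : ℤ → ℤ⁴ → ℤ⁴
hadamard-by h (_ , (c₂ , (c₃ , c₄))) = h + + 1 , (h - c₃ - c₄ , (h - c₂ - c₄ , h - c₂ - c₃))

hadamard : ℤ⁴ → ℤ⁴
hadamard z = hadamard-by (half (sum⁴ z)) z

hadamard-sum : ∀ z → OddSum z → sum⁴ (hadamard z) ≡ + 1 + ((proj₁ z - + 1) + (proj₁ z - + 1))
hadamard-sum z@(k , (c₂ , (c₃ , c₄))) odd@(h , eq) = begin
  sum⁴ (hadamard z)  ≡⟨ cong (λ h → sum⁴ (hadamard-by h z)) (half-odd z odd) ⟩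
  sum⁴ (hadamard-by h z)  ≡⟨ shape h k c₂ c₃ c₄ ⟩
  (+ 1 + (h + h)) + (+ 1 + (h + h)) - sum⁴ z - sum⁴ z + (k + k - + 1) ≡⟨ cong (λ s → (+ 1 + (h + h)) + (+ 1 + (h + h)) - s - s + (k + k - + 1)) eq ⟩
  (+ 1 + (h + h)) + (+ 1 + (h + h)) - (+ 1 + (h + h)) - (+ 1 + (h + h)) + (k + k - + 1) ≡⟨ shape′ h k ⟩
  + 1 + ((k - + 1) + (k - + 1))  ∎
  where
  open ≡-Reasoning
  shape : ∀ h k b c d → h + + 1 + (h - c - d) + (h - b - d) + (h - b - c) ≡
    (+ 1 + (h + h)) + (+ 1 + (h + h)) - (k + b + c + d) - (k + b + c + d) + (k + k - + 1)
  shape = solve-∀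
  shape′ : ∀ h k → (+ 1 + (h + h)) + (+ 1 + (h + h)) - (+ 1 + (h + h)) - (+ 1 + (h + h)) + (k + k - + 1) ≡ + 1 + ((k - + 1) + (k - + 1))
  shape′ = solve-∀

hadamard-oddSum : ∀ z → OddSum z → OddSum (hadamard z)
hadamard-oddSum z odd = proj₁ z - + 1 , hadamard-sum z odd

hadamard-involutive : ∀ z → OddSum z → hadamard (hadamard z) ≡ z
hadamard-involutive z@(k , (c₂ , (c₃ , c₄))) odd@(h , eq) =
  trans (cong (λ g → hadamard-by g (hadamard z)) (half-odd (hadamard z) (hadamard-oddSum z odd)))
    (trans (cong (λ h′ → hadamard-by (k - + 1) (hadamard-by h′ z)) (half-odd z odd))
      (cong₂ _,_ (first k) (cong₂ _,_ (second (other k c₂ c₃ c₄)) (cong₂ _,_ (second (other′ k c₂ c₃ c₄)) (second (other″ k c₂ c₃ c₄))))))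
  where
  first : ∀ k → k - + 1 + + 1 ≡ k
  first = solve-∀
  other : ∀ k b c d h → k - + 1 - (h - b - d) - (h - b - c) ≡ b + (k + b + c + d - (+ 1 + (h + h)))
  other = solve-∀
  other′ : ∀ k b c d h → k - + 1 - (h - c - d) - (h - b - c) ≡ c + (k + b + c + d - (+ 1 + (h + h)))
  other′ = solve-∀
  other″ : ∀ k b c d h → k - + 1 - (h - c - d) - (h - b - d) ≡ d + (k + b + c + d - (+ 1 + (h + h)))
  other″ = solve-∀
  second : ∀ {x : ℤ → ℤ} {c} → (∀ h → x h ≡ c + (sum⁴ z - (+ 1 + (h + h)))) → x h ≡ c
  second {c = c} e = trans (e h) (trans (cong (_+_ c) (trans (cong (_- (+ 1 + (h + h))) eq) (ℤP.+-inverseʳ (+ 1 + (h + h))))) (ℤP.+-identityʳ c))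

-- For y = (6k + 1 , 3(2cᵢ + 1)) the entries 3u + 1 of the image are (Σ y)/4 and, three times, (Σ
-- y)/4 minus half the sum of two of the last three yᵢ. This is a Hadamard matrix divided by 4, so
-- the squared length is Σ y²/4.
hadamard-exponent : ∀ z → OddSum z → exponent representations (hadamard z) ≡ + 1 + exponent mixed z
hadamard-exponent z@(k , (c₂ , (c₃ , c₄))) odd@(h , eq) = begin
  exponent representations (hadamard z)  ≡⟨ cong (λ h → exponent representations (hadamard-by h z)) (half-odd z odd) ⟩
  exponent representations (hadamard-by h z)  ≡⟨ identity h c₂ c₃ c₄ ⟩
  -- With k eliminated as 1 + 2h - c₂ - c₃ - c₄ the claim is a polynomial identity.
  + 1 + exponent mixed (+ 1 + (h + h) - c₂ - c₃ - c₄ , (c₂ , (c₃ , c₄)))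
    ≡⟨ cong (λ k → + 1 + exponent mixed (k , (c₂ , (c₃ , c₄)))) (trans (cong (λ s → s - c₂ - c₃ - c₄) (sym eq)) (solved k c₂ c₃ c₄)) ⟩
  + 1 + exponent mixed z ∎
  where
  open ≡-Reasoning
  solved : ∀ k b c d → k + b + c + d - b - c - d ≡ k
  solved = solve-∀
  identity : ∀ h b c d →
    + 3 * ((h + + 1) * (h + + 1)) + + 6 * ((h + + 1) * (h + + 1) + (h + + 1)) + + 1 +
    (+ 3 * ((h - c - d) * (h - c - d)) + + 6 * ((h - c - d) * (h - c - d) + (h - c - d)) + + 1 +
    (+ 3 * ((h - b - d) * (h - b - d)) + + 6 * ((h - b - d) * (h - b - d) + (h - b - d)) + + 1 +
    (+ 3 * ((h - b - c) * (h - b - c)) + + 6 * ((h - b - c) * (h - b - c) + (h - b - c)) + + 1))) ≡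
    + 1 + (+ 6 * ((+ 1 + (h + h) - b - c - d) * (+ 1 + (h + h) - b - c - d))
      + + 3 * ((+ 1 + (h + h) - b - c - d) * (+ 1 + (h + h) - b - c - d) + (+ 1 + (h + h) - b - c - d)) + + 0 +
    (+ 0 * (b * b) + + 9 * (b * b + b) + + 2 + (+ 0 * (c * c) + + 9 * (c * c + c) + + 2 + (+ 0 * (d * d) + + 9 * (d * d + d) + + 2))))
  identity = solve-∀

-- Changing the sign of one multiple of 3, that is c ↦ -1 - c, changes the sum by the odd number -1
-- - 2c. So odd and even sums are equally frequent.
mixed-sum : ∀ j → Odd (suc j) → coeff mixed one j ≡ + 2 * representationSeries (suc j)
mixed-sum j odd = begin
  coeff mixed one j  ≡⟨ ∑-restrict E oddSum? one ⟩
  ∑ Eᵒ one + ∑ (restrict E (¬? ∘ oddSum?)) one  ≡⟨ cong (_+_ (∑ Eᵒ one)) flipped ⟨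
  ∑ Eᵒ one + ∑ Eᵒ one  ≡⟨ cong (λ x → x + x) (∑-oddSum mixed hadamard (λ _ → tt , (tt , (tt , tt)))
        hadamard-oddSum hadamard-involutive hadamard-exponent j odd one) ⟩
  representationSeries (suc j) + representationSeries (suc j)  ≡⟨ double (representationSeries (suc j)) ⟩
  + 2 * representationSeries (suc j)  ∎
  where
  open ≡-Reasoning
  E = level mixed j
  Eᵒ = restrict E oddSum?
  double : ∀ x → x + x ≡ + 2 * x
  double = solve-∀
  ι : ℤ⁴ → ℤ⁴
  ι (k , (c , r)) = k , (- + 1 - c , r)
  ι-involutive : ∀ z → ι (ι z) ≡ z
  ι-involutive (k , (c , r)) = cong (λ c → k , (c , r)) (identity c)
    where
    identity : ∀ c → - + 1 - (- + 1 - c) ≡ c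
    identity = solve-∀
  ι-exponent : ∀ z → exponent mixed (ι z) ≡ exponent mixed z
  ι-exponent (k , (c , (d , e))) = cong (λ x → exponent pentagonal k + (x + (exponent thirdsOddSquares′ d + exponent thirdsOddSquares′ e))) (identity c)
    where
    identity : ∀ c → + 0 * ((- + 1 - c) * (- + 1 - c)) + + 9 * ((- + 1 - c) * (- + 1 - c) + (- + 1 - c)) + + 2 ≡ + 0 * (c * c) + + 9 * (c * c + c) + + 2
    identity = solve-∀
  ι-sum : ∀ z → sum⁴ (ι z) ≡ sum⁴ z - + 1 - (proj₁ (proj₂ z) + proj₁ (proj₂ z))
  ι-sum (k , (c , (d , e))) = identity k c d e
    where
    identity : ∀ k c d e → k + (- + 1 - c) + d + e ≡ k + c + d + e - + 1 - (c + c)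
    identity = solve-∀
  odd→even : ∀ z → OddSum z → ¬ OddSum (ι z)
  odd→even z@(k , (c , r)) (h , eq) (g , eq′) = even≢odd (h - c) g (trans (shape h c)
    (trans (cong (λ s → s - + 1 - (c + c)) (sym eq)) (trans (sym (ι-sum z)) eq′)))
    where
    shape : ∀ h c → (h - c) + (h - c) ≡ + 1 + (h + h) - + 1 - (c + c)
    shape = solve-∀
  even→odd : ∀ z → ¬ OddSum z → OddSum (ι z)
  even→odd z@(k , (c , r)) notOdd = let h , eq = evenSum z notOdd in
    h - c - + 1 , trans (ι-sum z) (trans (cong (λ s → s - + 1 - (c + c)) eq) (shape h c))
    where
    shape : ∀ h c → h + h - + 1 - (c + c) ≡ + 1 + ((h - c - + 1) + (h - c - + 1))
    shape = solve-∀
  flipped : ∑ Eᵒ one ≡ ∑ (restrict E (¬? ∘ oddSum?)) one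
  flipped = reindex Eᵒ (restrict E (¬? ∘ oddSum?)) ι
    (λ z ((m , eq) , o) → (m , trans (ι-exponent z) eq) , odd→even z o)
    (λ z w _ _ eq → trans (sym (ι-involutive z)) (trans (cong ι eq) (ι-involutive w)))
    (λ z ((m , eq) , e) → ι z , ((m , trans (ι-exponent z) eq) , even→odd z e) , ι-involutive z) one

-- Three free signs make the mixed count 8 P Z³, which is 2R by the Hadamard map.
pentagonal⊛thirds³ : ∀ j → Odd (suc j) →
  + 4 * (pentagonalSeries ⊛ (thirdsSeries ⊛ (thirdsSeries ⊛ thirdsSeries))) j ≡ representationSeries (suc j)
pentagonal⊛thirds³ j odd = ℤP.*-cancelˡ-≡ (+ 2) _ _ (begin
  + 2 * (+ 4 * t j)
    ≡⟨ eightfold (t j) ⟩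
  ((t ⊕ t ⊕ t ⊕ t) ⊕ (t ⊕ t ⊕ t ⊕ t)) j
    ≡⟨ solve 2 (λ p z → let t = p :* (z :* (z :* z)) in
         p :* ((z :+ z) :* ((z :+ z) :* (z :+ z))) := (t :+ t :+ t :+ t) :+ (t :+ t :+ t :+ t)) ≈-refl pentagonalSeries thirdsSeries j ⟨
  (pentagonalSeries ⊛ ((thirdsSeries ⊕ thirdsSeries) ⊛ ((thirdsSeries ⊕ thirdsSeries) ⊛ (thirdsSeries ⊕ thirdsSeries)))) j
    ≡⟨ ⊛-congʳ pentagonalSeries (⊛-cong twice (⊛-cong twice twice)) j ⟨
  (pentagonalSeries ⊛ (thirdsSeries′ ⊛ (thirdsSeries′ ⊛ thirdsSeries′))) j
    ≡⟨ tensor j ⟨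
  coeff mixed one j
    ≡⟨ mixed-sum j odd ⟩
  + 2 * representationSeries (suc j) ∎)
  where
  open ≡-Reasoning
  t = pentagonalSeries ⊛ (thirdsSeries ⊛ (thirdsSeries ⊛ thirdsSeries))
  eightfold : ∀ x → + 2 * (+ 4 * x) ≡ (x + x + x + x) + (x + x + x + x)
  eightfold = solve-∀
  double : ∀ x → + 2 * x ≡ x + x
  double = solve-∀
  twice : thirdsSeries′ ≈ thirdsSeries ⊕ thirdsSeries
  twice n = trans (thirdsSeries′≈ n) (double (thirdsSeries n))
  Z = thirdsOddSquares′
  tensor : coeff mixed one ≈ pentagonalSeries ⊛ (thirdsSeries′ ⊛ (thirdsSeries′ ⊛ thirdsSeries′))
  tensor n = trans (coeff-⊗ pentagonal (Z ⊗ Z ⊗ Z) one one n) (⊛-congʳ pentagonalSeries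
    (λ n → trans (coeff-⊗ Z (Z ⊗ Z) one one n) (⊛-congʳ thirdsSeries′ (coeff-⊗ Z Z one one) n)) n)

-- Exponents are 0 (pentagonal) or 2 (thirds) modulo 3.
module _ (i : ℤ) (j : ℕ) (j≡3i : + j ≡ + 3 * i) where

  private
    P = pentagonal
    Z = thirdsOddSquares
    p z : ℤ → ℤ
    p k = + 2 * (k * k) + (k * k + k)
    z k = + 6 * (k * k) + + 6 * (k * k + k)
    residueᴾ : ∀ k → exponent P k ≡ + 3 * p k
    residueᴾ = identity
      where
      identity : ∀ k → + 6 * (k * k) + + 3 * (k * k + k) + + 0 ≡ + 3 * (+ 2 * (k * k) + (k * k + k))
      identity = solve-∀
    residueᶻ : ∀ k → exponent Z k ≡ + 3 * z k + + 2
    residueᶻ = identity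
      where
      identity : ∀ k → + 18 * (k * k) + + 18 * (k * k + k) + + 2 ≡ + 3 * (+ 6 * (k * k) + + 6 * (k * k + k)) + + 2
      identity = solve-∀
    impossible : ∀ {x} c d {_ : False (3 ∣? ∣ d ∣)} → x ≡ + 3 * c - d → x ≡ + j → ⊥
    impossible c d {d≢} eq eq′ = not-third (c - i) d {d≢} (trans (shape c i d) (trans (cong₂ (λ x y → x + d - y) (trans (sym eq) eq′) (sym j≡3i)) (cancel (+ j) d)))
      where
      shape : ∀ c i d → + 3 * (c - i) ≡ + 3 * c - d + d - + 3 * i
      shape = solve-∀
      cancel : ∀ j d → j + d - j ≡ d
      cancel = solve-∀

  P³Z-vanishes : (pentagonalSeries ⊛ (pentagonalSeries ⊛ (pentagonalSeries ⊛ thirdsSeries))) j ≡ + 0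
  P³Z-vanishes = trans (sym (trans (coeff-⊗ P (P ⊗ P ⊗ Z) one one j) (⊛-congʳ pentagonalSeries (λ j →
      trans (coeff-⊗ P (P ⊗ Z) one one j) (⊛-congʳ pentagonalSeries (coeff-⊗ P Z one one) j)) j)))
    (∑-zero (level (P ⊗ P ⊗ P ⊗ Z) j) {one} λ (a , (b , (c , d))) (_ , eq) → ⊥-elim (impossible (p a + p b + p c + z d + + 1) (+ 1)
      (trans (cong₂ _+_ (residueᴾ a) (cong₂ _+_ (residueᴾ b) (cong₂ _+_ (residueᴾ c) (residueᶻ d)))) (shape (p a) (p b) (p c) (z d))) eq))
    where
    shape : ∀ a b c d → + 3 * a + (+ 3 * b + (+ 3 * c + (+ 3 * d + + 2))) ≡ + 3 * (a + b + c + d + + 1) - + 1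
    shape = solve-∀

  P²Z²-vanishes : (pentagonalSeries ⊛ (pentagonalSeries ⊛ (thirdsSeries ⊛ thirdsSeries))) j ≡ + 0
  P²Z²-vanishes = trans (sym (trans (coeff-⊗ P (P ⊗ Z ⊗ Z) one one j) (⊛-congʳ pentagonalSeries (λ j →
      trans (coeff-⊗ P (Z ⊗ Z) one one j) (⊛-congʳ pentagonalSeries (coeff-⊗ Z Z one one) j)) j)))
    (∑-zero (level (P ⊗ P ⊗ Z ⊗ Z) j) {one} λ (a , (b , (c , d))) (_ , eq) → ⊥-elim (impossible (p a + p b + z c + z d + + 2) (+ 2)
      (trans (cong₂ _+_ (residueᴾ a) (cong₂ _+_ (residueᴾ b) (cong₂ _+_ (residueᶻ c) (residueᶻ d)))) (shape (p a) (p b) (z c) (z d))) eq))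
    where
    shape : ∀ a b c d → + 3 * a + (+ 3 * b + (+ 3 * c + + 2 + (+ 3 * d + + 2))) ≡ + 3 * (a + b + c + d + + 2) - + 2
    shape = solve-∀

  Z⁴-vanishes : (thirdsSeries ⊛ (thirdsSeries ⊛ (thirdsSeries ⊛ thirdsSeries))) j ≡ + 0
  Z⁴-vanishes = trans (sym (coeff-⁴ Z one j))
    (∑-zero (level (F⁴ Z) j) {one} λ (a , (b , (c , d))) (_ , eq) → ⊥-elim (impossible (z a + z b + z c + z d + + 3) (+ 1)
      (trans (cong₂ _+_ (residueᶻ a) (cong₂ _+_ (residueᶻ b) (cong₂ _+_ (residueᶻ c) (residueᶻ d)))) (shape (z a) (z b) (z c) (z d))) eq))
    where
    shape : ∀ a b c d → + 3 * a + + 2 + (+ 3 * b + + 2 + (+ 3 * c + + 2 + (+ 3 * d + + 2))) ≡ + 3 * (a + b + c + d + + 3) - + 1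
    shape = solve-∀

  -- Of the expanded (P + Z)⁴ only P⁴ and 4 P Z³ reach an exponent divisible by 3; they contribute a
  -- + 2R and R.
  σ₁-decomposition : Odd (suc j) → + σ₁ (suc j) ≡ a (suc j) + + 3 * representationSeries (suc j)
  σ₁-decomposition odd = begin
    + σ₁ (suc j)
      ≡⟨ trans (four-odd-squares j) (divisorSeries-σ₁ j odd) ⟨
    (oddSeries ⊛ (oddSeries ⊛ (oddSeries ⊛ oddSeries))) j
      ≡⟨ ⊛-cong s (⊛-cong s (⊛-cong s s)) j ⟩
    ((x ⊕ y) ⊛ ((x ⊕ y) ⊛ ((x ⊕ y) ⊛ (x ⊕ y)))) j
      ≡⟨ solve 2 (λ x y → let u = x :* (x :* (x :* y)) ; v = x :* (x :* (y :* y)) ; w = x :* (y :* (y :* y)) in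
           (x :+ y) :* ((x :+ y) :* ((x :+ y) :* (x :+ y))) :=
           x :* (x :* (x :* x)) :+ (w :+ w :+ w :+ w) :+ ((u :+ u :+ u :+ u) :+ (v :+ v :+ v :+ v :+ v :+ v) :+ y :* (y :* (y :* y)))) ≈-refl x y j ⟩
    (x⁴ j + (w j + w j + w j + w j)) + ((u j + u j + u j + u j) + (v j + v j + v j + v j + v j + v j) + y⁴ j)
      ≡⟨ collect P³Z-vanishes P²Z²-vanishes Z⁴-vanishes (x⁴ j) (w j) ⟩
    x⁴ j + + 4 * w j
      ≡⟨ cong₂ _+_ (pentagonal⁴-a j odd) (pentagonal⊛thirds³ j odd) ⟩
    a (suc j) + + 2 * R + R
      ≡⟨ triple (a (suc j)) R ⟩
    a (suc j) + + 3 * R ∎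
    where
    open ≡-Reasoning
    x = pentagonalSeries
    y = thirdsSeries
    x⁴ = x ⊛ (x ⊛ (x ⊛ x))
    u = x ⊛ (x ⊛ (x ⊛ y))
    v = x ⊛ (x ⊛ (y ⊛ y))
    w = x ⊛ (y ⊛ (y ⊛ y))
    y⁴ = y ⊛ (y ⊛ (y ⊛ y))
    R = representationSeries (suc j)
    s = oddSeries-split
    triple : ∀ a r → a + + 2 * r + r ≡ a + + 3 * r
    triple = solve-∀
    collect : ∀ {u v y} → u ≡ + 0 → v ≡ + 0 → y ≡ + 0 → ∀ x w →
      (x + (w + w + w + w)) + ((u + u + u + u) + (v + v + v + v + v + v) + y) ≡ x + + 4 * w
    collect refl refl refl = identity
      where
      identity : ∀ x w → (x + (w + w + w + w)) + + 0 ≡ x + + 4 * w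
      identity = solve-∀

-- The count r₁₃ and multiplicativity

concatMap-map : ∀ (f : A × B → Bool) xs ys → concatMap (λ x → map (λ y → f (x , y)) ys) xs ≡ map f (cartesianProduct xs ys)
concatMap-map f []       ys = refl
concatMap-map f (x ∷ xs) ys = trans (cong₂ _++_ (map-∘ ys) (concatMap-map f xs ys)) (sym (map-++ f (map (x ,_) ys) _))

filter-map : ∀ (f : A → Bool) xs → length (filter T? (map f xs)) ≡ length (filter (T? ∘ f) xs)
filter-map f [] = refl
filter-map f (x ∷ xs) with f x
... | true  = cong suc (filter-map f xs)
... | false = filter-map f xs

squares : ℤ⁴ → ℤ
squares (x₁ , (x₂ , (x₃ , x₄))) = x₁ * x₁ + x₂ * x₂ + x₃ * x₃ + x₄ * x₄

solves : ℕ → ℤ⁴ → Bool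
solves n z@(x₁ , (x₂ , (x₃ , x₄))) =
  (∣ squares z ∣ ≡ᵇ n) ∧ ≡1mod3 x₁ ∧ ≡1mod3 x₂ ∧ ≡1mod3 x₃ ∧ ≡1mod3 x₄

box : ℕ → List ℤ⁴
box n = cartesianProduct (range n) (cartesianProduct (range n) (cartesianProduct (range n) (range n)))

r₁₃-box : ∀ n → r₁₃ n ≡ length (filter (T? ∘ solves n) (box n))
r₁₃-box n = trans (cong (λ xs → length (filter T? xs)) flatten) (filter-map (solves n) (box n))
  where
  r = range n
  flatten : concatMap (λ x₁ → concatMap (λ x₂ → concatMap (λ x₃ → map (λ x₄ → solves n (x₁ , (x₂ , (x₃ , x₄)))) r) r) r) r
    ≡ map (solves n) (box n)
  flatten = trans (concatMap-cong (λ x₁ → trans (concatMap-cong (λ x₂ →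
      concatMap-map (λ (x₃ , x₄) → solves n (x₁ , (x₂ , (x₃ , x₄)))) r r) r)
      (concatMap-map (λ (x₂ , y) → solves n (x₁ , (x₂ , y))) r (cartesianProduct r r))) r)
    (concatMap-map (solves n) r (cartesianProduct r (cartesianProduct r r)))

∈-range : ∀ x n → ∣ x ∣ ℕ.≤ n → x ∈ range n
∈-range (+ m) n m≤n = subst (_∈ range n) (cancel (+ m) (+ n)) (∈-map⁺ (λ i → + i - + n) (∈-upTo⁺ (s≤s (ℕP.+-monoˡ-≤ n m≤n))))
  where
  cancel : ∀ x y → x + y - y ≡ x
  cancel = solve-∀
∈-range -[1+ m ] n m<n with k , refl ← ℕP.m≤n⇒∃[o]m+o≡n m<n =
  subst (_∈ range (suc m ℕ.+ k)) (cancel (+ suc m) (+ k))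
    (∈-map⁺ (λ i → + i - + (suc m ℕ.+ k)) (∈-upTo⁺ (s≤s (ℕP.≤-trans (ℕP.m≤n+m k (suc m)) (ℕP.m≤m+n (suc m ℕ.+ k) _)))))
  where
  cancel : ∀ x y → y - (x + y) ≡ - x
  cancel = solve-∀

range-unique : ∀ n → Unique (range n)
range-unique n = Uniqueₚ.map⁺ (λ eq → ℤP.+-injective (ℤRing.+-cancelʳ (- + n) _ _ eq)) (Uniqueₚ.upTo⁺ (suc (n ℕ.+ n)))

squares-abs : (z : ℤ⁴) → let (x₁ , (x₂ , (x₃ , x₄))) = z in
  squares z ≡ + (∣ x₁ ∣ ℕ.* ∣ x₁ ∣ ℕ.+ ∣ x₂ ∣ ℕ.* ∣ x₂ ∣ ℕ.+ ∣ x₃ ∣ ℕ.* ∣ x₃ ∣ ℕ.+ ∣ x₄ ∣ ℕ.* ∣ x₄ ∣)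
squares-abs (x₁ , (x₂ , (x₃ , x₄))) = cong₂ _+_ (cong₂ _+_ (cong₂ _+_ (+square x₁) (+square x₂)) (+square x₃)) (+square x₄)

squares-nonneg : ∀ z → squares z ≡ + ∣ squares z ∣
squares-nonneg z = trans (squares-abs z) (cong (λ i → + ∣ i ∣) (sym (squares-abs z)))

Solution : ℕ → ℤ⁴ → Set
Solution n z = T (solves n z)

solution-bounds : ∀ n (z : ℤ⁴) → let (x₁ , (x₂ , (x₃ , x₄))) = z in ∣ squares z ∣ ≡ n →
  ∣ x₁ ∣ ℕ.≤ n × ∣ x₂ ∣ ℕ.≤ n × ∣ x₃ ∣ ℕ.≤ n × ∣ x₄ ∣ ℕ.≤ n
solution-bounds n z@(x₁ , (x₂ , (x₃ , x₄))) eq =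
  bound x₁ (ℕP.≤-trans (ℕP.m≤m+n _ _) (ℕP.≤-trans (ℕP.m≤m+n _ _) (ℕP.m≤m+n _ (s x₄)))) ,
  bound x₂ (ℕP.≤-trans (ℕP.m≤n+m _ (s x₁)) (ℕP.≤-trans (ℕP.m≤m+n _ _) (ℕP.m≤m+n _ (s x₄)))) ,
  bound x₃ (ℕP.≤-trans (ℕP.m≤n+m _ (s x₁ ℕ.+ s x₂)) (ℕP.m≤m+n _ (s x₄))) ,
  bound x₄ (ℕP.m≤n+m _ (s x₁ ℕ.+ s x₂ ℕ.+ s x₃))
  where
  s : ℤ → ℕ
  s x = ∣ x ∣ ℕ.* ∣ x ∣
  total : s x₁ ℕ.+ s x₂ ℕ.+ s x₃ ℕ.+ s x₄ ≡ n
  total = trans (cong ∣_∣ (sym (squares-abs z))) eq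
  self : ∀ m → m ℕ.≤ m ℕ.* m
  self zero    = z≤n
  self (suc m) = ℕP.m≤m*n (suc m) (suc m)
  bound : ∀ x → s x ℕ.≤ s x₁ ℕ.+ s x₂ ℕ.+ s x₃ ℕ.+ s x₄ → ∣ x ∣ ℕ.≤ n
  bound x s≤ = ℕP.≤-trans (self ∣ x ∣) (subst (s x ℕ.≤_) total s≤)

OneModThree⁴ : ℤ⁴ → Set
OneModThree⁴ (x₁ , (x₂ , (x₃ , x₄))) = T (≡1mod3 x₁) × T (≡1mod3 x₂) × T (≡1mod3 x₃) × T (≡1mod3 x₄)

solution⇒ : ∀ n z → Solution n z → ∣ squares z ∣ ≡ n × OneModThree⁴ z
solution⇒ n z t =
  let e , t₁ = Equivalence.to T-∧ t ; c₁ , t₂ = Equivalence.to T-∧ t₁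
      c₂ , t₃ = Equivalence.to T-∧ t₂ ; c₃ , c₄ = Equivalence.to T-∧ t₃
  in ℕP.≡ᵇ⇒≡ ∣ squares z ∣ n e , c₁ , c₂ , c₃ , c₄

⇒solution : ∀ n z → ∣ squares z ∣ ≡ n → OneModThree⁴ z → Solution n z
⇒solution n z e (c₁ , c₂ , c₃ , c₄) = Equivalence.from T-∧ (ℕP.≡⇒≡ᵇ ∣ squares z ∣ n e ,
  Equivalence.from T-∧ (c₁ , Equivalence.from T-∧ (c₂ , Equivalence.from T-∧ (c₃ , c₄))))

solutions : ∀ n → Enumeration (Solution n)
solutions n = record
  { elements = filter (T? ∘ solves n) (box n)
  ; unique   = Uniqueₚ.filter⁺ (T? ∘ solves n) (Uniqueₚ.cartesianProduct⁺ u (Uniqueₚ.cartesianProduct⁺ u (Uniqueₚ.cartesianProduct⁺ u u)))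
  ; sound    = λ z∈ → proj₂ (∈-filter⁻ (T? ∘ solves n) {xs = box n} z∈)
  ; complete = λ {z} t → ∈-filter⁺ (T? ∘ solves n) (candidate z (solution-bounds n z (proj₁ (solution⇒ n z t)))) t
  }
  where
  u = range-unique n
  candidate : (z : ℤ⁴) → let (x₁ , (x₂ , (x₃ , x₄))) = z in
    ∣ x₁ ∣ ℕ.≤ n × ∣ x₂ ∣ ℕ.≤ n × ∣ x₃ ∣ ℕ.≤ n × ∣ x₄ ∣ ℕ.≤ n → z ∈ box n
  candidate (x₁ , (x₂ , (x₃ , x₄))) (b₁ , b₂ , b₃ , b₄) = ∈-cartesianProduct⁺ (∈-range x₁ n b₁)
    (∈-cartesianProduct⁺ (∈-range x₂ n b₂) (∈-cartesianProduct⁺ (∈-range x₃ n b₃) (∈-range x₄ n b₄)))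

≡1mod3⇒ : ∀ x → T (≡1mod3 x) → ∃ λ u → + 3 * u + + 1 ≡ x
≡1mod3⇒ x t = x /ℕ 3 , sym (trans (a≡a%ℕn+[a/ℕn]*n x 3)
  (trans (cong (λ r → + r + x /ℕ 3 * + 3) (ℕP.≡ᵇ⇒≡ (x %ℕ 3) 1 t)) (shape (x /ℕ 3))))
  where
  shape : ∀ q → + 1 + q * + 3 ≡ + 3 * q + + 1
  shape = solve-∀

⇒≡1mod3 : ∀ u → T (≡1mod3 (+ 3 * u + + 1))
⇒≡1mod3 u = by (x %ℕ 3) (n%ℕd<d x 3) (a≡a%ℕn+[a/ℕn]*n x 3)
  where
  x = + 3 * u + + 1
  q = x /ℕ 3
  by : ∀ r → r ℕ.< 3 → x ≡ + r + q * + 3 → T (r ≡ᵇ 1)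
  by 0 _ eq = not-third (q - u) (+ 1) (trans (shape q u) (trans (cong (_- + 3 * u) (sym eq)) (cancel u)))
    where
    shape : ∀ q u → + 3 * (q - u) ≡ + 0 + q * + 3 - + 3 * u
    shape = solve-∀
    cancel : ∀ u → + 3 * u + + 1 - + 3 * u ≡ + 1
    cancel = solve-∀
  by 1 _ _ = tt
  by 2 _ eq = not-third (u - q) (+ 1) (trans (shape u q) (trans (cong (λ x → x - + 1 - q * + 3) eq) (cancel q)))
    where
    shape : ∀ u q → + 3 * (u - q) ≡ + 3 * u + + 1 - + 1 - q * + 3
    shape = solve-∀
    cancel : ∀ q → + 2 + q * + 3 - + 1 - q * + 3 ≡ + 1
    cancel = solve-∀
  by (suc (suc (suc _))) (s≤s (s≤s (s≤s ())))

toSolution : ℤ⁴ → ℤ⁴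
toSolution (u₁ , (u₂ , (u₃ , u₄))) = + 3 * u₁ + + 1 , (+ 3 * u₂ + + 1 , (+ 3 * u₃ + + 1 , + 3 * u₄ + + 1))

toSolution-squares : ∀ z → squares (toSolution z) ≡ exponent representations z
toSolution-squares (u₁ , (u₂ , (u₃ , u₄))) = trans (cong₂ _+_ (cong₂ _+_ (cong₂ _+_ (square u₁) (square u₂)) (square u₃)) (square u₄))
  (reassociate (q u₁) (q u₂) (q u₃) (q u₄))
  where
  q = exponent oneModThree
  square : ∀ u → (+ 3 * u + + 1) * (+ 3 * u + + 1) ≡ + 3 * (u * u) + + 6 * (u * u + u) + + 1
  square = solve-∀
  reassociate : ∀ a b c d → a + b + c + d ≡ a + (b + (c + d))
  reassociate = solve-∀

representations-r₁₃ : ∀ n → representationSeries n ≡ + r₁₃ n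
representations-r₁₃ n = begin
  representationSeries n  ≡⟨ reindex (level representations n) (solutions n) toSolution
    (λ z (_ , eq) → ⇒solution n (toSolution z) (cong ∣_∣ (trans (toSolution-squares z) eq)) (residues z))
    (λ z w _ _ → injective z w)
    (λ z t → onto z (solution⇒ n z t)) one ⟩
  ∑ (solutions n) one  ≡⟨ Sum-1 (elements (solutions n)) ⟩
  + length (elements (solutions n))  ≡⟨ cong +_ (r₁₃-box n) ⟨
  + r₁₃ n  ∎
  where
  open ≡-Reasoning
  residues : ∀ z → OneModThree⁴ (toSolution z)
  residues (u₁ , (u₂ , (u₃ , u₄))) = ⇒≡1mod3 u₁ , ⇒≡1mod3 u₂ , ⇒≡1mod3 u₃ , ⇒≡1mod3 u₄
  affine : ∀ {u v} → + 3 * u + + 1 ≡ + 3 * v + + 1 → u ≡ v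
  affine {u} {v} eq = ℤP.*-cancelˡ-≡ (+ 3) u v (ℤRing.+-cancelʳ (+ 1) _ _ eq)
  injective : ∀ z w → toSolution z ≡ toSolution w → z ≡ w
  injective z w eq = cong₂ _,_ (affine (cong proj₁ eq)) (cong₂ _,_ (affine (cong (proj₁ ∘ proj₂) eq))
    (cong₂ _,_ (affine (cong (proj₁ ∘ proj₂ ∘ proj₂) eq)) (affine (cong (proj₂ ∘ proj₂ ∘ proj₂) eq))))
  onto : ∀ z → ∣ squares z ∣ ≡ n × OneModThree⁴ z →
    ∃ λ w → (member representations w × exponent representations w ≡ + n) × toSolution w ≡ z
  onto z@(x₁ , (x₂ , (x₃ , x₄))) (e , (c₁ , c₂ , c₃ , c₄)) =
    let u₁ , e₁ = ≡1mod3⇒ x₁ c₁ ; u₂ , e₂ = ≡1mod3⇒ x₂ c₂ ; u₃ , e₃ = ≡1mod3⇒ x₃ c₃ ; u₄ , e₄ = ≡1mod3⇒ x₄ c₄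
        w = u₁ , (u₂ , (u₃ , u₄))
        w↦z = cong₂ _,_ e₁ (cong₂ _,_ e₂ (cong₂ _,_ e₃ e₄))
    in w , ((tt , (tt , (tt , tt))) , trans (sym (toSolution-squares w))
         (trans (cong squares w↦z) (trans (squares-nonneg z) (cong +_ e)))) , w↦z

-- Residues modulo 6, multiplicative functions and the telescoping sum

OneModSix : ℕ → Set
OneModSix n = ∃ λ i → n ≡ suc (6 ℕ.* i)

oneModSix-odd : ∀ {n} → OneModSix n → Odd n
oneModSix-odd (i , refl) = + 3 * + i , cong (_+_ (+ 1)) (trans (ℤP.pos-* 6 i) (shape (+ i)))
  where
  shape : ∀ i → + 6 * i ≡ + 3 * i + + 3 * i
  shape = solve-∀

oneModSix-notThird : ∀ {n} → OneModSix n → NotThird n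
oneModSix-notThird (i , refl) c eq = not-third (c - + 2 * + i) (+ 1)
  (trans (shape c (+ i)) (trans (cong (_- + 6 * + i) (trans (sym eq) (cong (_+_ (+ 1)) (ℤP.pos-* 6 i)))) (cancel (+ i))))
  where
  shape : ∀ c i → + 3 * (c - + 2 * i) ≡ + 3 * c - + 6 * i
  shape = solve-∀
  cancel : ∀ i → + 1 + + 6 * i - + 6 * i ≡ + 1
  cancel = solve-∀

oneModSix-nonZero : ∀ {n} → OneModSix n → ℕ.NonZero n
oneModSix-nonZero (_ , refl) = _

oneModSix-* : ∀ {m n} → OneModSix m → OneModSix n → OneModSix (m ℕ.* n)
oneModSix-* (i , refl) (j , refl) = i ℕ.+ j ℕ.+ 6 ℕ.* (i ℕ.* j) , shape i j
  where
  shape : ∀ i j → suc (6 ℕ.* i) ℕ.* suc (6 ℕ.* j) ≡ suc (6 ℕ.* (i ℕ.+ j ℕ.+ 6 ℕ.* (i ℕ.* j)))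
  shape = ℕ-solve-∀

oneModSix-^ : ∀ {m} → OneModSix m → ∀ k → OneModSix (m ^ k)
oneModSix-^ m≡1 zero    = 0 , refl
oneModSix-^ m≡1 (suc k) = oneModSix-* m≡1 (oneModSix-^ m≡1 k)

σ₁-a-r₁₃ : ∀ n → OneModSix n → + σ₁ n ≡ a n + + 3 * + r₁₃ n
σ₁-a-r₁₃ n one₆@(i , refl) = trans (σ₁-decomposition (+ 2 * + i) (6 ℕ.* i) (trans (ℤP.pos-* 6 i) (shape (+ i))) (oneModSix-odd one₆))
  (cong (λ r → a n + + 3 * r) (representations-r₁₃ n))
  where
  shape : ∀ i → + 6 * i ≡ + 3 * (+ 2 * i)
  shape = solve-∀

-- A divisor f of m n is gcd(f, m) times a cofactor. As f divides gcd(n f, n m) = n gcd(f, m), the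
-- cofactor divides n.
σ₁-multiplicative : ∀ m n .{{_ : ℕ.NonZero m}} .{{_ : ℕ.NonZero n}} → Coprime m n → + σ₁ (m ℕ.* n) ≡ + σ₁ m * + σ₁ n
σ₁-multiplicative m n coprime = begin
  + σ₁ (m ℕ.* n)  ≡⟨ ∑-divisors (m ℕ.* n) ⟨
  ∑ F (λ d → + d)  ≡⟨ reindex E F (λ (d , e) → d ℕ.* e)
        (λ (d , e) (p , q) → ∣.*-pres-∣ p q)
        (λ (d , e) (d′ , e′) (p , q) (p′ , q′) → injective d e d′ e′ p q p′ q′)
        onto (λ d → + d) ⟨
  ∑ E (λ (d , e) → + (d ℕ.* e))  ≡⟨ ∑-cong E (λ (d , e) _ → ℤP.pos-* d e) ⟩
  ∑ E (λ (d , e) → + d * + e)  ≡⟨ ∑-× (divisors m) (divisors n) (λ d → + d) (λ d → + d) ⟩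
  ∑ (divisors m) (λ d → + d) * ∑ (divisors n) (λ d → + d) ≡⟨ cong₂ _*_ (∑-divisors m) (∑-divisors n) ⟩
  + σ₁ m * + σ₁ n  ∎
  where
  open ≡-Reasoning
  instance
    mn≢0 : ℕ.NonZero (m ℕ.* n)
    mn≢0 = ℕP.m*n≢0 m n
  E = divisors m ×-enumeration divisors n
  F = divisors (m ℕ.* n)
  divides-left : ∀ {d e d′ e′} → d ∣ m → e′ ∣ n → d ℕ.* e ≡ d′ ℕ.* e′ → d ∣ d′
  divides-left {d} {e} {d′} {e′} p q′ eq = coprime-divisor (λ (x , y) → coprime (∣.∣-trans x p , ∣.∣-trans y q′))
    (subst (d ∣_) (trans eq (ℕP.*-comm d′ e′)) (∣.m∣m*n e))
  injective : ∀ d e d′ e′ → d ∣ m → e ∣ n → d′ ∣ m → e′ ∣ n → d ℕ.* e ≡ d′ ℕ.* e′ → (d , e) ≡ (d′ , e′)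
  injective d e d′ e′ p q p′ q′ eq = cong₂ _,_ d≡d′ (ℕP.*-cancelˡ-≡ e e′ d {{nonZero}} (trans eq (cong (ℕ._* e′) (sym d≡d′))))
    where
    d≡d′ : d ≡ d′
    d≡d′ = ∣-antisym (divides-left p q′ eq) (divides-left p′ q (sym eq))
    nonZero : ℕ.NonZero d
    nonZero = ℕ.≢-nonZero λ { refl → ℕ.≢-nonZero⁻¹ m (∣.0∣⇒≡0 p) }
  onto : ∀ f → f ∣ m ℕ.* n → ∃ λ de → ((_∣ m) (proj₁ de) × (_∣ n) (proj₂ de)) × proj₁ de ℕ.* proj₂ de ≡ f
  onto f f∣mn = by (gcd[m,n]∣m f m)
    where
    g = gcd f m
    instance
      g≢0 : ℕ.NonZero g
      g≢0 = ℕ.≢-nonZero λ eq → ℕ.≢-nonZero⁻¹ m (gcd[m,n]≡0⇒n≡0 f eq)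
    f∣ng : f ∣ n ℕ.* g
    f∣ng = subst (f ∣_) (sym (c*gcd[m,n]≡gcd[cm,cn] n f m))
      (gcd-greatest (∣.n∣m*n n) (subst (f ∣_) (ℕP.*-comm m n) f∣mn))
    by : g ∣ f → ∃ λ de → ((_∣ m) (proj₁ de) × (_∣ n) (proj₂ de)) × proj₁ de ℕ.* proj₂ de ≡ f
    by (divides e eq) = (g , e) , (gcd[m,n]∣n f m , ∣.*-cancelʳ-∣ g (subst (_∣ n ℕ.* g) eq f∣ng)) , trans (ℕP.*-comm g e) (sym eq)

coprime-* : ∀ {m n o} → Coprime m o → Coprime n o → Coprime (m ℕ.* n) o
coprime-* cm cn (d∣mn , d∣o) = cn (coprime-divisor (λ (x , y) → cm (y , ∣.∣-trans x d∣o)) d∣mn , d∣o)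

coprime-1 : ∀ {o} → Coprime 1 o
coprime-1 (d∣1 , _) = ∣.∣1⇒≡1 d∣1

coprime-^ : ∀ {m o} → Coprime m o → ∀ k → Coprime (m ^ k) o
coprime-^ c zero    = coprime-1
coprime-^ c (suc k) = coprime-* c (coprime-^ c k)

coprime-∏ : ∀ {k o} (f : Fin k → ℕ) → (∀ i → Coprime (f i) o) → Coprime (∏ℕ f) o
coprime-∏ {zero}  f c = coprime-1
coprime-∏ {suc k} f c = coprime-* (c Fin.zero) (coprime-∏ (f ∘ Fin.suc) (c ∘ Fin.suc))

distinct-primes-coprime : ∀ {p q} → Prime p → Prime q → p ≢ q → Coprime p q
distinct-primes-coprime {p} {q} prime-p prime-q p≢q (d∣p , d∣q) =
  by (prime⇒irreducible prime-p d∣p) (prime⇒irreducible prime-q d∣q)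
  where
  by : ∀ {d} → d ≡ 1 ⊎ d ≡ p → d ≡ 1 ⊎ d ≡ q → d ≡ 1
  by (inj₁ d≡1) _ = d≡1
  by _ (inj₁ d≡1) = d≡1
  by (inj₂ d≡p) (inj₂ d≡q) = ⊥-elim (p≢q (trans (sym d≡p) d≡q))

∏Fin-1 : ∀ k → ∏Fin {k} (λ _ → + 1) ≡ + 1
∏Fin-1 zero    = refl
∏Fin-1 (suc k) = trans (ℤP.*-identityˡ _) (∏Fin-1 k)

∑Fin-* : ∀ {k} c (f g : Fin k → ℤ) → (∀ i → f i ≡ c * g i) → ∑Fin f ≡ c * ∑Fin g
∑Fin-* {zero}  c f g eq = sym (ℤP.*-zeroʳ c)
∑Fin-* {suc k} c f g eq = trans (cong₂ _+_ (eq Fin.zero) (∑Fin-* c (f ∘ Fin.suc) (g ∘ Fin.suc) (eq ∘ Fin.suc)))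
  (sym (ℤP.*-distribˡ-+ c (g Fin.zero) _))

-- Replacing s by t one index at a time from the left, the step at i changes the product by s i - t
-- i = 3 ρ i times the t before and the s after.
telescope : ∀ {k} (s t ρ : Fin k → ℤ) → (∀ i → s i ≡ t i + + 3 * ρ i) →
  ∏Fin s ≡ ∏Fin t + + 3 * ∑Fin (λ i →
    ∏Fin (λ j → if toℕ i <ᵇ toℕ j then s j else + 1) * ∏Fin (λ j → if toℕ j <ᵇ toℕ i then t j else + 1) * ρ i)
telescope {zero}  s t ρ eq = refl
telescope {suc k} s t ρ eq = begin
  s₀ * ∏Fin (s ∘ Fin.suc)  ≡⟨ cong (_* ∏Fin (s ∘ Fin.suc)) (eq Fin.zero) ⟩
  (t₀ + + 3 * ρ₀) * ∏Fin (s ∘ Fin.suc)  ≡⟨ expand t₀ ρ₀ _ ⟩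
  t₀ * ∏Fin (s ∘ Fin.suc) + + 3 * (∏Fin (s ∘ Fin.suc) * ρ₀)
    ≡⟨ cong (λ x → t₀ * x + + 3 * (∏Fin (s ∘ Fin.suc) * ρ₀)) (telescope (s ∘ Fin.suc) (t ∘ Fin.suc) (ρ ∘ Fin.suc) (eq ∘ Fin.suc)) ⟩
  t₀ * (∏Fin (t ∘ Fin.suc) + + 3 * S) + + 3 * (∏Fin (s ∘ Fin.suc) * ρ₀)
    ≡⟨ collect t₀ (∏Fin (t ∘ Fin.suc)) S (∏Fin (s ∘ Fin.suc)) ρ₀ ⟩
  -- The factors + 1 are the values of the conditionals at excluded indices, in the shape that
  -- unfolding the sum produces.
  t₀ * ∏Fin (t ∘ Fin.suc) + + 3 * (+ 1 * ∏Fin (s ∘ Fin.suc) * (+ 1 * + 1) * ρ₀ + t₀ * S)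
    ≡⟨ cong₂ (λ x y → t₀ * ∏Fin (t ∘ Fin.suc) + + 3 * (+ 1 * ∏Fin (s ∘ Fin.suc) * (+ 1 * x) * ρ₀ + y))
         (sym (∏Fin-1 k)) (sym (∑Fin-* t₀ (λ i → + 1 * upper i * (t₀ * lower i) * ρ (Fin.suc i)) (λ i → upper i * lower i * ρ (Fin.suc i))
           (λ i → shuffle (upper i) t₀ (lower i) (ρ (Fin.suc i))))) ⟩
  t₀ * ∏Fin (t ∘ Fin.suc) + + 3 * (+ 1 * ∏Fin (s ∘ Fin.suc) * (+ 1 * ∏Fin {k} (λ _ → + 1)) * ρ₀
    + ∑Fin (λ i → + 1 * upper i * (t₀ * lower i) * ρ (Fin.suc i))) ∎
  where
  open ≡-Reasoning
  s₀ = s Fin.zero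
  t₀ = t Fin.zero
  ρ₀ = ρ Fin.zero
  upper lower : Fin k → ℤ
  upper i = ∏Fin (λ j → if toℕ i <ᵇ toℕ j then s (Fin.suc j) else + 1)
  lower i = ∏Fin (λ j → if toℕ j <ᵇ toℕ i then t (Fin.suc j) else + 1)
  S = ∑Fin (λ i → upper i * lower i * ρ (Fin.suc i))
  expand : ∀ t r x → (t + + 3 * r) * x ≡ t * x + + 3 * (x * r)
  expand = solve-∀
  collect : ∀ t x s y r → t * (x + + 3 * s) + + 3 * (y * r) ≡ t * x + + 3 * (+ 1 * y * (+ 1 * + 1) * r + t * s)
  collect = solve-∀
  shuffle : ∀ a t b r → + 1 * a * (t * b) * r ≡ t * (a * b * r)
  shuffle = solve-∀

oneModSix-∏ : ∀ {k} (f : Fin k → ℕ) → (∀ i → OneModSix (f i)) → OneModSix (∏ℕ f)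
oneModSix-∏ {zero}  f h = 0 , refl
oneModSix-∏ {suc k} f h = oneModSix-* (h Fin.zero) (oneModSix-∏ (f ∘ Fin.suc) (h ∘ Fin.suc))

multiplicative-∏ : (F : ℕ → ℤ) → F 1 ≡ + 1 →
  (∀ m n → OneModSix m → OneModSix n → Coprime m n → F (m ℕ.* n) ≡ F m * F n) →
  ∀ {k} (f : Fin k → ℕ) → (∀ i → OneModSix (f i)) → (∀ i j → i ≢ j → Coprime (f i) (f j)) →
  F (∏ℕ f) ≡ ∏Fin (λ i → F (f i))
multiplicative-∏ F F1 mult {zero}  f h c = F1
multiplicative-∏ F F1 mult {suc k} f h c = trans
  (mult (f Fin.zero) (∏ℕ (f ∘ Fin.suc)) (h Fin.zero) (oneModSix-∏ (f ∘ Fin.suc) (h ∘ Fin.suc))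
    (coprime-sym (coprime-∏ (f ∘ Fin.suc) (λ i → c (Fin.suc i) Fin.zero (λ eq → 0≢1+n (sym eq))))))
  (cong (_*_ (F (f Fin.zero))) (multiplicative-∏ F F1 mult (f ∘ Fin.suc) (h ∘ Fin.suc)
    (λ i j i≢j → c (Fin.suc i) (Fin.suc j) (λ eq → i≢j (suc-injective eq)))))

∣-∏ : ∀ {k} (f : Fin k → ℕ) i → f i ∣ ∏ℕ f
∣-∏ f Fin.zero    = ∣.m∣m*n (∏ℕ (f ∘ Fin.suc))
∣-∏ f (Fin.suc i) = ∣.∣n⇒∣m*n (f Fin.zero) (∣-∏ (f ∘ Fin.suc) i)

∣-^ : ∀ m {k} → 0 < k → m ∣ m ^ k
∣-^ m {suc k} _ = ∣.m∣m*n (m ^ k)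

%6⇒oneModSix : ∀ n → n % 6 ≡ 1 → OneModSix n
%6⇒oneModSix n eq = n ℕ./ 6 , trans (m≡m%n+[m/n]*n n 6) (trans (cong (ℕ._+ n ℕ./ 6 ℕ.* 6) eq) (cong suc (ℕP.*-comm (n ℕ./ 6) 6)))

-- A divisor of n ≡ 1 (mod 6) is coprime to 6, hence 1 or 5 modulo 6; in the second case α is even
-- and 25 ≡ 1.
prime-power-residue : ∀ {n p α} → OneModSix n → p ∣ n → (p % 6 ≡ 5 → 2 ∣ α) → OneModSix (p ^ α)
prime-power-residue {n} {p} {α} (i , refl) p∣n even = by (p % 6) (p ℕ./ 6) (m%n<n p 6) refl (m≡m%n+[m/n]*n p 6)
  where
  common : ∀ d → d ∣ p → d ∣ 6 → d ∣ 1
  common d d∣p d∣6 = ∣.∣m+n∣m⇒∣n (subst (d ∣_) (ℕP.+-comm 1 (6 ℕ.* i)) (∣.∣-trans d∣p p∣n)) (∣.∣m⇒∣m*n i d∣6)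
  clash : ∀ d r q {_ : False (d ∣? 1)} → d ∣ r → d ∣ 6 → p ≡ r ℕ.+ q ℕ.* 6 → OneModSix (p ^ α)
  clash d r q {d∤1} d∣r d∣6 eq = ⊥-elim (toWitnessFalse d∤1
    (common d (subst (d ∣_) (sym eq) (∣.∣m∣n⇒∣m+n d∣r (∣.∣n⇒∣m*n q d∣6))) d∣6))
  five : ∀ q → (5 ℕ.+ q ℕ.* 6) ℕ.* ((5 ℕ.+ q ℕ.* 6) ℕ.* 1) ≡ suc (6 ℕ.* (4 ℕ.+ 10 ℕ.* q ℕ.+ 6 ℕ.* (q ℕ.* q)))
  five = ℕ-solve-∀
  by : ∀ r q → r ℕ.< 6 → p % 6 ≡ r → p ≡ r ℕ.+ q ℕ.* 6 → OneModSix (p ^ α)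
  by 0 q _ _ eq = clash 2 0 q (divides 0 refl) (divides 3 refl) eq
  by 1 q _ _ eq = oneModSix-^ (q , trans eq (cong suc (ℕP.*-comm q 6))) α
  by 2 q _ _ eq = clash 2 2 q (divides 1 refl) (divides 3 refl) eq
  by 3 q _ _ eq = clash 3 3 q (divides 1 refl) (divides 2 refl) eq
  by 4 q _ _ eq = clash 2 4 q (divides 2 refl) (divides 3 refl) eq
  by 5 q _ r≡5 eq = square (even r≡5)
    where
    square : 2 ∣ α → OneModSix (p ^ α)
    square (divides h α≡) = subst OneModSix (trans (ℕP.^-*-assoc p 2 h) (cong (p ^_) (trans (ℕP.*-comm 2 h) (sym α≡))))
      (oneModSix-^ (4 ℕ.+ 10 ℕ.* q ℕ.+ 6 ℕ.* (q ℕ.* q) , trans (cong (_^ 2) eq) (five q)) h)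
  by (suc (suc (suc (suc (suc (suc _)))))) _ (s≤s (s≤s (s≤s (s≤s (s≤s (s≤s ())))))) _ _

theorem9 : (k : ℕ) (p α : Fin k → ℕ) (n : ℕ) →
    (∀ i → Prime (p i)) →
    Injective _≡_ _≡_ p →
    (∀ i → 0 < α i) →
    n ≡ ∏ℕ (λ i → p i ^ α i) →
    n % 6 ≡ 1 →
    (∀ i → p i % 6 ≡ 5 → 2 ∣ α i) →
    + r₁₃ n ≡ ∑Fin (λ i →
    ∏Fin (λ j → if toℕ i <ᵇ toℕ j then + σ₁ (p j ^ α j) else + 1)
    * ∏Fin (λ j → if toℕ j <ᵇ toℕ i then a (p j ^ α j) else + 1)
    * + r₁₃ (p i ^ α i))
-- Both a n + 3 r₁₃ n and a n + 3 S equal σ₁ n, so a n and the factor 3 cancel.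
theorem9 k p α n primes distinct positive n≡∏ n≡1 even = ℤP.*-cancelˡ-≡ (+ 3) (+ r₁₃ n) S
  (ℤRing.+-cancelˡ (a n) (+ 3 * + r₁₃ n) (+ 3 * S) (begin
    a n + + 3 * + r₁₃ n  ≡⟨ σ₁-a-r₁₃ n n≡1₆ ⟨
    + σ₁ n  ≡⟨ trans (cong (λ n → + σ₁ n) n≡∏) (multiplicative-∏ (λ n → + σ₁ n) refl
        (λ m n h h′ → σ₁-multiplicative m n {{oneModSix-nonZero h}} {{oneModSix-nonZero h′}}) q q≡1₆ q-coprime) ⟩
    ∏Fin (λ i → + σ₁ (q i))  ≡⟨ telescope (λ i → + σ₁ (q i)) (λ i → a (q i)) (λ i → + r₁₃ (q i)) (λ i → σ₁-a-r₁₃ (q i) (q≡1₆ i)) ⟩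
    ∏Fin (λ i → a (q i)) + + 3 * S  ≡⟨ cong (_+ + 3 * S) (trans (cong a n≡∏) (multiplicative-∏ a refl
        (λ m n h h′ → a-multiplicative m n {{oneModSix-nonZero h}} {{oneModSix-nonZero h′}}
        (oneModSix-odd h) (oneModSix-odd h′) (oneModSix-notThird h)) q q≡1₆ q-coprime)) ⟨
    a n + + 3 * S  ∎))
  where
  open ≡-Reasoning
  q : Fin k → ℕ
  q i = p i ^ α i
  S : ℤ
  S = ∑Fin (λ i →
    ∏Fin (λ j → if toℕ i <ᵇ toℕ j then + σ₁ (q j) else + 1)
    * ∏Fin (λ j → if toℕ j <ᵇ toℕ i then a (q j) else + 1)
    * + r₁₃ (q i))
  n≡1₆ = %6⇒oneModSix n n≡1
  q≡1₆ : ∀ i → OneModSix (q i)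
  q≡1₆ i = prime-power-residue {α = α i} n≡1₆
    (∣.∣-trans (∣-^ (p i) (positive i)) (subst (q i ∣_) (sym n≡∏) (∣-∏ q i))) (even i)
  q-coprime : ∀ i j → i ≢ j → Coprime (q i) (q j)
  q-coprime i j i≢j = coprime-^ (coprime-sym (coprime-^ (distinct-primes-coprime (primes j) (primes i) (λ eq → i≢j (sym (distinct eq)))) (α j))) (α i)
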